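{- Let $\Gamma$ be a rationally metrised graph and $u,v$ vertices of $\Gamma$. Let $\mathrm W_\bullet$ be the filtration of $\mathbb Q\pi_1(\Gamma;u,v)$ given by $\mathrm W_{ -k}\mathbb Q\pi_1(\Gamma;u,v)=\mathbb Q\pi_1(\Gamma;u,v)\cdot J^k$, where $J$ is the augmentation ideal of the group algebra $\mathbb Q\pi_1(\Gamma,u)$. Then for every $n\ge0$ the higher cycle pairing induces a perfect pairing \[\int\colon\mathbb Q\pi_1(\Gamma;u,v)/\mathrm W_{ -n-1}\otimes\textstyle\bigoplus_{m\le n}\mathrm H_1(\Gamma)^{\otimes m}\to\mathbb Q,\] and the resulting isomorphisms $\mathbb Q\pi_1(\Gamma;u,v)/\mathrm W_{ -n-1}\xrightarrow{\sim}\bigoplus_{m\le n}\mathrm H^1(\Gamma)^{\otimes m}$ induce an isomorphism \[\widehat{\mathbb Q}\pi_1(\Gamma;u,v):=\varprojlim_n\mathbb Q\pi_1(\Gamma;u,v)/\mathrm W_{ -n-1}\xrightarrow{\sim}\prod_{m\ge0}\mathrm H^1(\Gamma)^{\otimes m}.\]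
   Context: A graph consists of finite sets of vertices $V$, oriented edges $E$ and half-edges $D$, a source map $s\colon E\sqcup D\to V$, and a fixed-point-free involution $e\mapsto e^{ -1}$ on $E$, with $t(e):=s(e^{ -1})$; graphs are nonempty and connected. A rationally metrised graph also has lengths $\ell\colon E\to\mathbb Q_{>0}$ with $\ell(e^{ -1})=\ell(e)$. $\pi_1(\Gamma;u,v)$ is the set of homotopy classes of paths from $u$ to $v$, composition written right to left ($\gamma'\gamma$ means $\gamma$ then $\gamma'$), and $\mathbb Q\pi_1(\Gamma;u,v)$ the $\mathbb Q$-vector space on it. $\mathbb Q\cdot E^{\pm}$ is the $\mathbb Q$-span of edges modulo $e^{ -1}=-e$, with pairing $\int_e e'=\pm\ell(e)$ if $e'=e^{\pm1}$ and $0$ otherwise; $\mathrm H_1(\Gamma)=\mathrm H_1(\Gamma,\mathbb Q)\subset\mathbb Q\cdot E^\pm$ with the restricted (cycle) pairing, $\mathrm H^1(\Gamma)=\mathrm{Hom}(\mathrm H_1(\Gamma),\mathbb Q)$. The higher cycle pairing $\int_\gamma\omega_1\cdots\omega_n$ for $\omega_i\in\mathrm H_1(\Gamma)$ is defined by: for the constant path, $1$ if $n=0$ and $0$ otherwise; for an edge, $\int_e\omega_1\cdots\omega_n=\frac1{n!}\prod_i\int_e\omega_i$; and $\int_{e\gamma}\omega_1\cdots\omega_n=\sum_{i=0}^n\int_e\omega_{i+1}\cdots\omega_n\cdot\int_\gamma\omega_1\cdots\omega_i$ when $s(e)=t(\gamma)$; extended bilinearly (it is well-defined on homotopy classes). $\bigoplus_{m\le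 n}\mathrm H_1(\Gamma)^{\otimes m}$ is the part of tensor length $\le n$ of the shuffle algebra; $\mathrm H^1(\Gamma)^{\otimes m}$ is dual to $\mathrm H_1(\Gamma)^{\otimes m}$. -}

module Defs where

open import Level using (0ℓ)
open import Algebra.Bundles using (CommutativeMonoid)
open import Algebra.Module.Bundles using (LeftModule)
import Algebra.Module.Construct.TensorUnit as TensorUnit
open import Algebra.Module.Morphism.Structures using (module LeftModuleMorphisms)
open import Algebra.Module.Properties.LeftModule using (inverseˡ-uniqueᴹ)
import Algebra.Properties.AbelianGroup as AbelianGroupProperties
import Algebra.Properties.CommutativeSemigroup as CommutativeSemigroupProperties
open import Data.Fin.Base using (Fin; toℕ)
open import Data.Fin.Properties using (inj⇒≟)
open import Data.Integer.Base using (+_)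
open import Data.List.Base using (List; []; _∷_; length; take; drop; map; foldr)
open import Data.Nat.Base using (ℕ; zero; suc; _!)
open import Data.Nat.Properties using (_!≢0)
open import Data.Product.Base using (Σ; _,_; proj₁; proj₂)
open import Data.Rational.Base using (ℚ; 0ℚ; 1ℚ; _+_; _*_; -_; _/_; Positive)
open import Data.Rational.Properties using (+-*-ring; +-0-commutativeMonoid)
import Data.Rational.Properties as ℚ
open import Data.Sum.Base using (_⊎_; inj₁; inj₂)
open import Data.Vec.Base using (Vec; toList; zipWith; _[_]≔_)
open import Data.Vec.Relation.Binary.Pointwise.Inductive using (Pointwise)
open import Function.Bundles using (_↔_)
open import Function.Properties.Inverse using (↔⇒↣)
open import Relation.Binary.Bundles using (Setoid)
open import Relation.Binary.Construct.Closure.Equivalence using () renaming (setoid to equivalenceClosure)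
open import Relation.Binary.Core using (Rel)
open import Relation.Binary.Definitions using (DecidableEquality)
open import Relation.Binary.PropositionalEquality using (_≡_; refl; setoid)
import Relation.Binary.Reasoning.Setoid as SetoidReasoning
open import Relation.Nullary using (¬_; yes; no)
open import Relation.Unary using (Pred; U; _∈_; _⊆_)
open import Algebra.Properties.CommutativeMonoid.Sum +-0-commutativeMonoid using (sum-syntax)

VectorSpace : Set₁
VectorSpace = LeftModule +-*-ring 0ℓ 0ℓ

∣_∣ : VectorSpace → Set
∣ M ∣ = LeftModule.Carrierᴹ M

ℚ¹ : VectorSpace
ℚ¹ = TensorUnit.leftModule

IsLinear : (M N : VectorSpace) → (∣ M ∣ → ∣ N ∣) → Set
IsLinear M N = IsLeftModuleHomomorphism
  where open LeftModuleMorphisms (LeftModule.rawLeftModule M) (LeftModule.rawLeftModule N)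

IsIsomorphism : (M N : VectorSpace) → (∣ M ∣ → ∣ N ∣) → Set
IsIsomorphism M N = IsLeftModuleIsomorphism
  where open LeftModuleMorphisms (LeftModule.rawLeftModule M) (LeftModule.rawLeftModule N)

record LinearMap (M N : VectorSpace) : Set where
  field
    ⟦_⟧      : ∣ M ∣ → ∣ N ∣
    isLinear : IsLinear M N ⟦_⟧

  open LeftModuleMorphisms.IsLeftModuleHomomorphism isLinear public

open LinearMap public using (⟦_⟧)

module _ (M N : VectorSpace) where
  private
    module M = LeftModule M
    module N = LeftModule N
    open SetoidReasoning N.≈ᴹ-setoid

  mkIsLinear : (f : ∣ M ∣ → ∣ N ∣) →
    (∀ {x y} → x M.≈ᴹ y → f x N.≈ᴹ f y) →
    (∀ x y → f (x M.+ᴹ y) N.≈ᴹ f x N.+ᴹ f y) →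
    (∀ a x → f (a M.*ₗ x) N.≈ᴹ a N.*ₗ f x) →
    IsLinear M N f
  mkIsLinear f f-cong f-+ f-* = record
    { +ᴹ-isGroupHomomorphism = record
      { isMonoidHomomorphism = record
        { isMagmaHomomorphism = record
          { isRelHomomorphism = record { cong = f-cong }
          ; homo = f-+
          }
        ; ε-homo = f-0
        }
      ; ⁻¹-homo = λ x → inverseˡ-uniqueᴹ N (f (M.-ᴹ x)) (f x) (begin
          f (M.-ᴹ x) N.+ᴹ f x   ≈⟨ f-+ (M.-ᴹ x) x ⟨
          f (M.-ᴹ x M.+ᴹ x)     ≈⟨ f-cong (M.-ᴹ‿inverseˡ x) ⟩
          f M.0ᴹ                ≈⟨ f-0 ⟩
          N.0ᴹ                  ∎)
      }
    ; *ₗ-homo = f-*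
    }
    where
    f-0 : f M.0ᴹ N.≈ᴹ N.0ᴹ
    f-0 = begin
      f M.0ᴹ               ≈⟨ f-cong (M.*ₗ-zeroˡ M.0ᴹ) ⟨
      f (0ℚ M.*ₗ M.0ᴹ)     ≈⟨ f-* 0ℚ M.0ᴹ ⟩
      0ℚ N.*ₗ f M.0ᴹ       ≈⟨ N.*ₗ-zeroˡ (f M.0ᴹ) ⟩
      N.0ᴹ                 ∎

Hom : VectorSpace → VectorSpace → VectorSpace
Hom M N = record
  { Carrierᴹ = LinearMap M N
  ; _≈ᴹ_ = λ f g → ∀ x → ⟦ f ⟧ x N.≈ᴹ ⟦ g ⟧ x
  ; _+ᴹ_ = λ f g → record
    { ⟦_⟧ = λ x → ⟦ f ⟧ x N.+ᴹ ⟦ g ⟧ x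
    ; isLinear = mkIsLinear M N _
        (λ p → N.+ᴹ-cong (LinearMap.⟦⟧-cong f p) (LinearMap.⟦⟧-cong g p))
        (λ x y → N.≈ᴹ-trans (N.+ᴹ-cong (LinearMap.+ᴹ-homo f x y) (LinearMap.+ᴹ-homo g x y))
                            (interchange _ _ _ _))
        (λ a x → N.≈ᴹ-trans (N.+ᴹ-cong (LinearMap.*ₗ-homo f a x) (LinearMap.*ₗ-homo g a x))
                            (N.≈ᴹ-sym (N.*ₗ-distribˡ a _ _)))
    }
  ; _*ₗ_ = scale
  ; 0ᴹ = record
    { ⟦_⟧ = λ _ → N.0ᴹ
    ; isLinear = mkIsLinear M N _
        (λ _ → N.≈ᴹ-refl)
        (λ _ _ → N.≈ᴹ-sym (N.+ᴹ-identityˡ N.0ᴹ))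
        (λ a _ → N.≈ᴹ-sym (N.*ₗ-zeroʳ a))
    }
  ; -ᴹ_ = λ f → record
    { ⟦_⟧ = λ x → N.-ᴹ ⟦ f ⟧ x
    ; isLinear = mkIsLinear M N _
        (λ p → N.-ᴹ‿cong (LinearMap.⟦⟧-cong f p))
        (λ x y → N.≈ᴹ-trans (N.-ᴹ‿cong (LinearMap.+ᴹ-homo f x y)) (N.≈ᴹ-sym (⁻¹-∙-comm _ _)))
        (λ a x → N.≈ᴹ-trans (N.-ᴹ‿cong (LinearMap.*ₗ-homo f a x)) (neg-* a _))
    }
  ; isLeftModule = record
    { isLeftSemimodule = record
      { +ᴹ-isCommutativeMonoid = record
        { isMonoid = record
          { isSemigroup = record
            { isMagma = record
              { isEquivalence = record
                { refl = λ _ → N.≈ᴹ-refl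
                ; sym = λ p x → N.≈ᴹ-sym (p x)
                ; trans = λ p q x → N.≈ᴹ-trans (p x) (q x)
                }
              ; ∙-cong = λ p q x → N.+ᴹ-cong (p x) (q x)
              }
            ; assoc = λ f g h x → N.+ᴹ-assoc _ _ _
            }
          ; identity = (λ f x → N.+ᴹ-identityˡ _) , (λ f x → N.+ᴹ-identityʳ _)
          }
        ; comm = λ f g x → N.+ᴹ-comm _ _
        }
      ; isPreleftSemimodule = record
        { *ₗ-cong = λ a≡b p x → N.*ₗ-cong a≡b (p x)
        ; *ₗ-zeroˡ = λ f x → N.*ₗ-zeroˡ _
        ; *ₗ-distribʳ = λ f a b x → N.*ₗ-distribʳ _ a b
        ; *ₗ-identityˡ = λ f x → N.*ₗ-identityˡ _
        ; *ₗ-assoc = λ a b f x → N.*ₗ-assoc a b _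
        ; *ₗ-zeroʳ = λ a x → N.*ₗ-zeroʳ a
        ; *ₗ-distribˡ = λ a f g x → N.*ₗ-distribˡ a _ _
        }
      }
    ; -ᴹ‿cong = λ p x → N.-ᴹ‿cong (p x)
    ; -ᴹ‿inverse = (λ f x → N.-ᴹ‿inverseˡ _) , (λ f x → N.-ᴹ‿inverseʳ _)
    }
  }
  where
  module N = LeftModule N
  open AbelianGroupProperties N.+ᴹ-abelianGroup using (⁻¹-∙-comm)
  open SetoidReasoning N.≈ᴹ-setoid
  open CommutativeSemigroupProperties
    (CommutativeMonoid.commutativeSemigroup N.+ᴹ-commutativeMonoid) using (interchange)

  neg-* : ∀ a y → N.-ᴹ (a N.*ₗ y) N.≈ᴹ a N.*ₗ (N.-ᴹ y)
  neg-* a y = N.≈ᴹ-sym (inverseˡ-uniqueᴹ N (a N.*ₗ (N.-ᴹ y)) (a N.*ₗ y) (begin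
    a N.*ₗ (N.-ᴹ y) N.+ᴹ a N.*ₗ y   ≈⟨ N.*ₗ-distribˡ a _ _ ⟨
    a N.*ₗ (N.-ᴹ y N.+ᴹ y)          ≈⟨ N.*ₗ-cong refl (N.-ᴹ‿inverseˡ y) ⟩
    a N.*ₗ N.0ᴹ                     ≈⟨ N.*ₗ-zeroʳ a ⟩
    N.0ᴹ                            ∎))

  *-swap : ∀ a b y → a N.*ₗ (b N.*ₗ y) N.≈ᴹ b N.*ₗ (a N.*ₗ y)
  *-swap a b y = begin
    a N.*ₗ (b N.*ₗ y)   ≈⟨ N.*ₗ-assoc a b y ⟨
    (a * b) N.*ₗ y      ≈⟨ N.*ₗ-cong (ℚ.*-comm a b) N.≈ᴹ-refl ⟩
    (b * a) N.*ₗ y      ≈⟨ N.*ₗ-assoc b a y ⟩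
    b N.*ₗ (a N.*ₗ y)   ∎

  scale : ℚ → LinearMap M N → LinearMap M N
  scale a f = record
    { ⟦_⟧ = λ x → a N.*ₗ ⟦ f ⟧ x
    ; isLinear = mkIsLinear M N _
        (λ p → N.*ₗ-cong refl (LinearMap.⟦⟧-cong f p))
        (λ x y → N.≈ᴹ-trans (N.*ₗ-cong refl (LinearMap.+ᴹ-homo f x y)) (N.*ₗ-distribˡ a _ _))
        (λ b x → N.≈ᴹ-trans (N.*ₗ-cong refl (LinearMap.*ₗ-homo f b x)) (*-swap a b _))
    }

Dual : VectorSpace → VectorSpace
Dual M = Hom M ℚ¹

record IsBilinear (M N : VectorSpace) (⟨_,_⟩ : ∣ M ∣ → ∣ N ∣ → ℚ) : Set where
  private
    module M = LeftModule M
    module N = LeftModule N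
  field
    ⟨⟩-cong : ∀ {x x′ y y′} → x M.≈ᴹ x′ → y N.≈ᴹ y′ → ⟨ x , y ⟩ ≡ ⟨ x′ , y′ ⟩
    +-homoˡ : ∀ x x′ y → ⟨ x M.+ᴹ x′ , y ⟩ ≡ ⟨ x , y ⟩ + ⟨ x′ , y ⟩
    +-homoʳ : ∀ x y y′ → ⟨ x , y N.+ᴹ y′ ⟩ ≡ ⟨ x , y ⟩ + ⟨ x , y′ ⟩
    *-homoˡ : ∀ a x y → ⟨ a M.*ₗ x , y ⟩ ≡ a * ⟨ x , y ⟩
    *-homoʳ : ∀ a x y → ⟨ x , a N.*ₗ y ⟩ ≡ a * ⟨ x , y ⟩

  adjointˡ : ∣ M ∣ → ∣ Dual N ∣
  adjointˡ x = record
    { ⟦_⟧ = λ y → ⟨ x , y ⟩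
    ; isLinear = mkIsLinear N ℚ¹ _ (⟨⟩-cong M.≈ᴹ-refl) (+-homoʳ x) (λ a → *-homoʳ a x)
    }

  adjointʳ : ∣ N ∣ → ∣ Dual M ∣
  adjointʳ y = record
    { ⟦_⟧ = λ x → ⟨ x , y ⟩
    ; isLinear = mkIsLinear M ℚ¹ _ (λ p → ⟨⟩-cong p N.≈ᴹ-refl)
                   (λ x x′ → +-homoˡ x x′ y) (λ a x → *-homoˡ a x y)
    }

-- The carriers of a quotient are those of the original space, so for M a
-- quotient `isBilinear` contains the claim that the pairing descends to it.
record IsPerfectPairing (M N : VectorSpace) (⟨_,_⟩ : ∣ M ∣ → ∣ N ∣ → ℚ) : Set where
  field
    isBilinear : IsBilinear M N ⟨_,_⟩

  open IsBilinear isBilinear public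

  field
    adjointˡ-isIsomorphism : IsIsomorphism M (Dual N) adjointˡ
    adjointʳ-isIsomorphism : IsIsomorphism N (Dual M) adjointʳ

-- Products of spaces; for finite I this is also the direct sum.
Π : (I : Set) → (I → VectorSpace) → VectorSpace
Π I M = record
  { Carrierᴹ = ∀ i → ∣ M i ∣
  ; _≈ᴹ_ = λ x y → ∀ i → M._≈ᴹ_ i (x i) (y i)
  ; _+ᴹ_ = λ x y i → M._+ᴹ_ i (x i) (y i)
  ; _*ₗ_ = λ a x i → M._*ₗ_ i a (x i)
  ; 0ᴹ = λ i → M.0ᴹ i
  ; -ᴹ_ = λ x i → M.-ᴹ_ i (x i)
  ; isLeftModule = record
    { isLeftSemimodule = record
      { +ᴹ-isCommutativeMonoid = record
        { isMonoid = record
          { isSemigroup = record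
            { isMagma = record
              { isEquivalence = record
                { refl = λ i → M.≈ᴹ-refl i
                ; sym = λ p i → M.≈ᴹ-sym i (p i)
                ; trans = λ p q i → M.≈ᴹ-trans i (p i) (q i)
                }
              ; ∙-cong = λ p q i → M.+ᴹ-cong i (p i) (q i)
              }
            ; assoc = λ x y z i → M.+ᴹ-assoc i _ _ _
            }
          ; identity = (λ x i → M.+ᴹ-identityˡ i _) , (λ x i → M.+ᴹ-identityʳ i _)
          }
        ; comm = λ x y i → M.+ᴹ-comm i _ _
        }
      ; isPreleftSemimodule = record
        { *ₗ-cong = λ a≡b p i → M.*ₗ-cong i a≡b (p i)
        ; *ₗ-zeroˡ = λ x i → M.*ₗ-zeroˡ i _
        ; *ₗ-distribʳ = λ x a b i → M.*ₗ-distribʳ i _ a b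
        ; *ₗ-identityˡ = λ x i → M.*ₗ-identityˡ i _
        ; *ₗ-assoc = λ a b x i → M.*ₗ-assoc i a b _
        ; *ₗ-zeroʳ = λ a i → M.*ₗ-zeroʳ i a
        ; *ₗ-distribˡ = λ a x y i → M.*ₗ-distribˡ i a _ _
        }
      }
    ; -ᴹ‿cong = λ p i → M.-ᴹ‿cong i (p i)
    ; -ᴹ‿inverse = (λ x i → M.-ᴹ‿inverseˡ i _) , (λ x i → M.-ᴹ‿inverseʳ i _)
    }
  }
  where module M i = LeftModule (M i)

record IsSubspace (M : VectorSpace) (P : Pred ∣ M ∣ 0ℓ) : Set where
  open LeftModule M
  field
    resp     : ∀ {x y} → x ≈ᴹ y → P x → P y
    0-closed : P 0ᴹ
    +-closed : ∀ {x y} → P x → P y → P (x +ᴹ y)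
    *-closed : ∀ a {x} → P x → P (a *ₗ x)

  -‿closed : ∀ {x} → P x → P (-ᴹ x)
  -‿closed {x} p = resp (inverseˡ-uniqueᴹ M _ x eq) (*-closed (- 1ℚ) p)
    where
    open SetoidReasoning ≈ᴹ-setoid
    eq : (- 1ℚ) *ₗ x +ᴹ x ≈ᴹ 0ᴹ
    eq = begin
      (- 1ℚ) *ₗ x +ᴹ x           ≈⟨ +ᴹ-cong ≈ᴹ-refl (*ₗ-identityˡ x) ⟨
      (- 1ℚ) *ₗ x +ᴹ 1ℚ *ₗ x     ≈⟨ *ₗ-distribʳ x (- 1ℚ) 1ℚ ⟨
      0ℚ *ₗ x                    ≈⟨ *ₗ-zeroˡ x ⟩
      0ᴹ                         ∎

data Span (M : VectorSpace) (S : Pred ∣ M ∣ 0ℓ) : Pred ∣ M ∣ 0ℓ where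
  resp     : ∀ {x y} → LeftModule._≈ᴹ_ M x y → Span M S x → Span M S y
  incl     : ∀ {x} → S x → Span M S x
  0-closed : Span M S (LeftModule.0ᴹ M)
  +-closed : ∀ {x y} → Span M S x → Span M S y → Span M S (LeftModule._+ᴹ_ M x y)
  *-closed : ∀ a {x} → Span M S x → Span M S (LeftModule._*ₗ_ M a x)

Span-isSubspace : ∀ M S → IsSubspace M (Span M S)
Span-isSubspace M S = record
  { resp = resp ; 0-closed = 0-closed ; +-closed = +-closed ; *-closed = *-closed }

Span-mono : ∀ M {S T} → S ⊆ T → Span M S ⊆ Span M T
Span-mono M S⊆T (resp e p)     = resp e (Span-mono M S⊆T p)
Span-mono M S⊆T (incl s)       = incl (S⊆T s)
Span-mono M S⊆T 0-closed       = 0-closed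
Span-mono M S⊆T (+-closed p q) = +-closed (Span-mono M S⊆T p) (Span-mono M S⊆T q)
Span-mono M S⊆T (*-closed a p) = *-closed a (Span-mono M S⊆T p)

Subspace : (M : VectorSpace) {P : Pred ∣ M ∣ 0ℓ} → IsSubspace M P → VectorSpace
Subspace M {P} sub = record
  { Carrierᴹ = Σ ∣ M ∣ P
  ; _≈ᴹ_ = λ x y → proj₁ x ≈ᴹ proj₁ y
  ; _+ᴹ_ = λ (x , p) (y , q) → x +ᴹ y , S.+-closed p q
  ; _*ₗ_ = λ a (x , p) → a *ₗ x , S.*-closed a p
  ; 0ᴹ = 0ᴹ , S.0-closed
  ; -ᴹ_ = λ (x , p) → -ᴹ x , S.-‿closed p
  ; isLeftModule = record
    { isLeftSemimodule = record
      { +ᴹ-isCommutativeMonoid = record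
        { isMonoid = record
          { isSemigroup = record
            { isMagma = record
              { isEquivalence = record { refl = ≈ᴹ-refl ; sym = ≈ᴹ-sym ; trans = ≈ᴹ-trans }
              ; ∙-cong = +ᴹ-cong
              }
            ; assoc = λ x y z → +ᴹ-assoc _ _ _
            }
          ; identity = (λ x → +ᴹ-identityˡ _) , (λ x → +ᴹ-identityʳ _)
          }
        ; comm = λ x y → +ᴹ-comm _ _
        }
      ; isPreleftSemimodule = record
        { *ₗ-cong = *ₗ-cong
        ; *ₗ-zeroˡ = λ x → *ₗ-zeroˡ _
        ; *ₗ-distribʳ = λ x a b → *ₗ-distribʳ _ a b
        ; *ₗ-identityˡ = λ x → *ₗ-identityˡ _
        ; *ₗ-assoc = λ a b x → *ₗ-assoc a b _
        ; *ₗ-zeroʳ = *ₗ-zeroʳ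
        ; *ₗ-distribˡ = λ a x y → *ₗ-distribˡ a _ _
        }
      }
    ; -ᴹ‿cong = -ᴹ‿cong
    ; -ᴹ‿inverse = (λ x → -ᴹ‿inverseˡ _) , (λ x → -ᴹ‿inverseʳ _)
    }
  }
  where
  open LeftModule M
  module S = IsSubspace sub

infix 4 _≈[_]_

record _≈[_]_ {M : VectorSpace} (x : ∣ M ∣) (P : Pred ∣ M ∣ 0ℓ) (y : ∣ M ∣) : Set where
  constructor mod
  open LeftModule M
  field
    difference : P (x +ᴹ -ᴹ y)

Quotient : (M : VectorSpace) (P : Pred ∣ M ∣ 0ℓ) → IsSubspace M P → VectorSpace
Quotient M P sub = record
  { Carrierᴹ = ∣ M ∣
  ; _≈ᴹ_ = _∼_
  ; _+ᴹ_ = _+ᴹ_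
  ; _*ₗ_ = _*ₗ_
  ; 0ᴹ = 0ᴹ
  ; -ᴹ_ = -ᴹ_
  ; isLeftModule = record
    { isLeftSemimodule = record
      { +ᴹ-isCommutativeMonoid = record
        { isMonoid = record
          { isSemigroup = record
            { isMagma = record
              { isEquivalence = record { refl = lift ≈ᴹ-refl ; sym = ∼-sym ; trans = ∼-trans }
              ; ∙-cong = ∼-+
              }
            ; assoc = λ x y z → lift (+ᴹ-assoc x y z)
            }
          ; identity = (λ x → lift (+ᴹ-identityˡ x)) , (λ x → lift (+ᴹ-identityʳ x))
          }
        ; comm = λ x y → lift (+ᴹ-comm x y)
        }
      ; isPreleftSemimodule = record
        { *ₗ-cong = λ { {a} refl p → ∼-* a p }
        ; *ₗ-zeroˡ = λ x → lift (*ₗ-zeroˡ x)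
        ; *ₗ-distribʳ = λ x a b → lift (*ₗ-distribʳ x a b)
        ; *ₗ-identityˡ = λ x → lift (*ₗ-identityˡ x)
        ; *ₗ-assoc = λ a b x → lift (*ₗ-assoc a b x)
        ; *ₗ-zeroʳ = λ a → lift (*ₗ-zeroʳ a)
        ; *ₗ-distribˡ = λ a x y → lift (*ₗ-distribˡ a x y)
        }
      }
    ; -ᴹ‿cong = ∼-neg
    ; -ᴹ‿inverse = (λ x → lift (-ᴹ‿inverseˡ x)) , (λ x → lift (-ᴹ‿inverseʳ x))
    }
  }
  where
  open LeftModule M
  module S = IsSubspace sub
  open AbelianGroupProperties +ᴹ-abelianGroup using (⁻¹-∙-comm; ⁻¹-involutive)
  open SetoidReasoning ≈ᴹ-setoid
  open CommutativeSemigroupProperties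
    (CommutativeMonoid.commutativeSemigroup +ᴹ-commutativeMonoid) using (interchange)

  _∼_ : ∣ M ∣ → ∣ M ∣ → Set
  x ∼ y = _≈[_]_ {M} x P y

  lift : ∀ {x y} → x ≈ᴹ y → x ∼ y
  lift {x} {y} e =
    mod (S.resp (≈ᴹ-trans (≈ᴹ-sym (-ᴹ‿inverseʳ y)) (+ᴹ-cong (≈ᴹ-sym e) ≈ᴹ-refl)) S.0-closed)

  neg-diff : ∀ x y → -ᴹ (x +ᴹ -ᴹ y) ≈ᴹ (-ᴹ x) +ᴹ -ᴹ (-ᴹ y)
  neg-diff x y = ≈ᴹ-sym (⁻¹-∙-comm x (-ᴹ y))

  ∼-neg : ∀ {x y} → x ∼ y → (-ᴹ x) ∼ (-ᴹ y)
  ∼-neg {x} {y} (mod p) = mod (S.resp (neg-diff x y) (S.-‿closed p))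

  ∼-sym : ∀ {x y} → x ∼ y → y ∼ x
  ∼-sym {x} {y} (mod p) = mod (S.resp (begin
    -ᴹ (x +ᴹ -ᴹ y)          ≈⟨ neg-diff x y ⟩
    (-ᴹ x) +ᴹ -ᴹ (-ᴹ y)     ≈⟨ +ᴹ-comm _ _ ⟩
    -ᴹ (-ᴹ y) +ᴹ -ᴹ x       ≈⟨ +ᴹ-cong (⁻¹-involutive y) ≈ᴹ-refl ⟩
    y +ᴹ -ᴹ x               ∎) (S.-‿closed p))

  ∼-trans : ∀ {x y z} → x ∼ y → y ∼ z → x ∼ z
  ∼-trans {x} {y} {z} (mod p) (mod q) = mod (S.resp (begin
    (x +ᴹ -ᴹ y) +ᴹ (y +ᴹ -ᴹ z)   ≈⟨ +ᴹ-assoc _ _ _ ⟩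
    x +ᴹ (-ᴹ y +ᴹ (y +ᴹ -ᴹ z))   ≈⟨ +ᴹ-cong ≈ᴹ-refl (+ᴹ-assoc _ _ _) ⟨
    x +ᴹ ((-ᴹ y +ᴹ y) +ᴹ -ᴹ z)   ≈⟨ +ᴹ-cong ≈ᴹ-refl (+ᴹ-cong (-ᴹ‿inverseˡ y) ≈ᴹ-refl) ⟩
    x +ᴹ (0ᴹ +ᴹ -ᴹ z)            ≈⟨ +ᴹ-cong ≈ᴹ-refl (+ᴹ-identityˡ _) ⟩
    x +ᴹ -ᴹ z                    ∎) (S.+-closed p q))

  ∼-+ : ∀ {x x′ y y′} → x ∼ x′ → y ∼ y′ → (x +ᴹ y) ∼ (x′ +ᴹ y′)
  ∼-+ {x} {x′} {y} {y′} (mod p) (mod q) = mod (S.resp (begin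
    (x +ᴹ -ᴹ x′) +ᴹ (y +ᴹ -ᴹ y′)   ≈⟨ interchange _ _ _ _ ⟩
    (x +ᴹ y) +ᴹ (-ᴹ x′ +ᴹ -ᴹ y′)   ≈⟨ +ᴹ-cong ≈ᴹ-refl (⁻¹-∙-comm x′ y′) ⟩
    (x +ᴹ y) +ᴹ -ᴹ (x′ +ᴹ y′)      ∎) (S.+-closed p q))

  ∼-* : ∀ a {x y} → x ∼ y → (a *ₗ x) ∼ (a *ₗ y)
  ∼-* a {x} {y} (mod p) = mod (S.resp (begin
    a *ₗ (x +ᴹ -ᴹ y)            ≈⟨ *ₗ-distribˡ a _ _ ⟩
    a *ₗ x +ᴹ a *ₗ (-ᴹ y)       ≈⟨ +ᴹ-cong ≈ᴹ-refl (inverseˡ-uniqueᴹ M _ _ (begin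
       a *ₗ (-ᴹ y) +ᴹ a *ₗ y      ≈⟨ *ₗ-distribˡ a _ _ ⟨
       a *ₗ (-ᴹ y +ᴹ y)           ≈⟨ *ₗ-cong refl (-ᴹ‿inverseˡ y) ⟩
       a *ₗ 0ᴹ                    ≈⟨ *ₗ-zeroʳ a ⟩
       0ᴹ                         ∎)) ⟩
    a *ₗ x +ᴹ -ᴹ (a *ₗ y)       ∎) (S.*-closed a p))

module _ (M : ℕ → VectorSpace) (π : ∀ n → LinearMap (M (suc n)) (M n)) where
  private
    module M n = LeftModule (M n)
    module π n = LinearMap (π n)

  IsCompatible : Pred (∀ n → ∣ M n ∣) 0ℓ
  IsCompatible x = ∀ n → M._≈ᴹ_ n (⟦ π n ⟧ (x (suc n))) (x n)

  IsCompatible-isSubspace : IsSubspace (Π ℕ M) IsCompatible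
  IsCompatible-isSubspace = record
    { resp = λ e p n → M.≈ᴹ-trans n (π.⟦⟧-cong n (M.≈ᴹ-sym (suc n) (e (suc n))))
                         (M.≈ᴹ-trans n (p n) (e n))
    ; 0-closed = π.0ᴹ-homo
    ; +-closed = λ p q n → M.≈ᴹ-trans n (π.+ᴹ-homo n _ _) (M.+ᴹ-cong n (p n) (q n))
    ; *-closed = λ a p n → M.≈ᴹ-trans n (π.*ₗ-homo n a _) (M.*ₗ-cong n refl (p n))
    }

  Lim : VectorSpace
  Lim = Subspace (Π ℕ M) IsCompatible-isSubspace

infixl 6 _⊞_
infixr 7 _⊡_

data Term (G : Set) : Set where
  gen : G → Term G
  𝟘   : Term G
  _⊞_ : Term G → Term G → Term G
  _⊡_ : ℚ → Term G → Term G

⊟_ : ∀ {G} → Term G → Term G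
⊟ x = (- 1ℚ) ⊡ x

module _ {G : Set} (R : Rel (Term G) 0ℓ) where

  infix 4 _≈ₜ_

  data _≈ₜ_ : Rel (Term G) 0ℓ where
    relation    : ∀ {x y} → R x y → x ≈ₜ y
    ≈-refl      : ∀ {x} → x ≈ₜ x
    ≈-sym       : ∀ {x y} → x ≈ₜ y → y ≈ₜ x
    ≈-trans     : ∀ {x y z} → x ≈ₜ y → y ≈ₜ z → x ≈ₜ z
    ⊞-cong      : ∀ {x x′ y y′} → x ≈ₜ x′ → y ≈ₜ y′ → x ⊞ y ≈ₜ x′ ⊞ y′
    ⊡-cong      : ∀ a {x y} → x ≈ₜ y → a ⊡ x ≈ₜ a ⊡ y
    ⊞-assoc     : ∀ x y z → (x ⊞ y) ⊞ z ≈ₜ x ⊞ (y ⊞ z)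
    ⊞-comm      : ∀ x y → x ⊞ y ≈ₜ y ⊞ x
    ⊞-identityˡ : ∀ x → 𝟘 ⊞ x ≈ₜ x
    ⊡-zeroˡ     : ∀ x → 0ℚ ⊡ x ≈ₜ 𝟘
    ⊡-zeroʳ     : ∀ a → a ⊡ 𝟘 ≈ₜ 𝟘
    ⊡-identityˡ : ∀ x → 1ℚ ⊡ x ≈ₜ x
    ⊡-assoc     : ∀ a b x → (a * b) ⊡ x ≈ₜ a ⊡ (b ⊡ x)
    ⊡-distribʳ  : ∀ x a b → (a + b) ⊡ x ≈ₜ a ⊡ x ⊞ b ⊡ x
    ⊡-distribˡ  : ∀ a x y → a ⊡ (x ⊞ y) ≈ₜ a ⊡ x ⊞ a ⊡ y

  Presented : VectorSpace
  Presented = record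
    { Carrierᴹ = Term G
    ; _≈ᴹ_ = _≈ₜ_
    ; _+ᴹ_ = _⊞_
    ; _*ₗ_ = _⊡_
    ; 0ᴹ = 𝟘
    ; -ᴹ_ = ⊟_
    ; isLeftModule = record
      { isLeftSemimodule = record
        { +ᴹ-isCommutativeMonoid = record
          { isMonoid = record
            { isSemigroup = record
              { isMagma = record
                { isEquivalence = record { refl = ≈-refl ; sym = ≈-sym ; trans = ≈-trans }
                ; ∙-cong = ⊞-cong
                }
              ; assoc = ⊞-assoc
              }
            ; identity = ⊞-identityˡ , λ x → ≈-trans (⊞-comm x 𝟘) (⊞-identityˡ x)
            }
          ; comm = ⊞-comm
          }
        ; isPreleftSemimodule = record
          { *ₗ-cong = λ { {a} refl p → ⊡-cong a p }
          ; *ₗ-zeroˡ = ⊡-zeroˡ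
          ; *ₗ-distribʳ = ⊡-distribʳ
          ; *ₗ-identityˡ = ⊡-identityˡ
          ; *ₗ-assoc = ⊡-assoc
          ; *ₗ-zeroʳ = ⊡-zeroʳ
          ; *ₗ-distribˡ = ⊡-distribˡ
          }
        }
      ; -ᴹ‿cong = ⊡-cong (- 1ℚ)
      ; -ᴹ‿inverse = inverseˡ , λ x → ≈-trans (⊞-comm x (⊟ x)) (inverseˡ x)
      }
    }
    where
    inverseˡ : ∀ x → ⊟ x ⊞ x ≈ₜ 𝟘
    inverseˡ x =
      ≈-trans (⊞-cong ≈-refl (≈-sym (⊡-identityˡ x)))
      (≈-trans (≈-sym (⊡-distribʳ x (- 1ℚ) 1ℚ)) (⊡-zeroˡ x))

extend : ∀ {G} (N : VectorSpace) → (G → ∣ N ∣) → Term G → ∣ N ∣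
extend N f (gen g) = f g
extend N f 𝟘       = LeftModule.0ᴹ N
extend N f (x ⊞ y) = LeftModule._+ᴹ_ N (extend N f x) (extend N f y)
extend N f (a ⊡ x) = LeftModule._*ₗ_ N a (extend N f x)

extend₂ : ∀ {G H} (N : VectorSpace) → (G → H → ∣ N ∣) → Term G → Term H → ∣ N ∣
extend₂ N f x y = extend N (λ g → extend N (f g) y) x

module _ (S : Setoid 0ℓ 0ℓ) where

  data FreeRelation : Rel (Term (Setoid.Carrier S)) 0ℓ where
    identify : ∀ {x y} → Setoid._≈_ S x y → FreeRelation (gen x) (gen y)

  Free : VectorSpace
  Free = Presented FreeRelation

module _ (M : VectorSpace) (m : ℕ) where
  private module M = LeftModule M

  data Multilinear : Rel (Term (Vec ∣ M ∣ m)) 0ℓ where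
    pointwise : ∀ {xs ys} → Pointwise M._≈ᴹ_ xs ys → Multilinear (gen xs) (gen ys)
    additive  : ∀ xs i y z →
      Multilinear (gen (xs [ i ]≔ (y M.+ᴹ z))) (gen (xs [ i ]≔ y) ⊞ gen (xs [ i ]≔ z))
    scalar    : ∀ xs i a y →
      Multilinear (gen (xs [ i ]≔ (a M.*ₗ y))) (a ⊡ gen (xs [ i ]≔ y))

  -- M ⊗ ⋯ ⊗ M (m factors); the generator gen (x₁ ∷ ⋯ ∷ xₘ ∷ []) is x₁ ⊗ ⋯ ⊗ xₘ.
  TensorPower : VectorSpace
  TensorPower = Presented Multilinear

⨁≤ : ℕ → (ℕ → VectorSpace) → VectorSpace
⨁≤ n M = Π (Fin (suc n)) (λ m → M (toℕ m))

productℚ : List ℚ → ℚ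
productℚ = foldr _*_ 1ℚ

record Finite (A : Set) : Set where
  field
    size  : ℕ
    index : A ↔ Fin size

  _≟_ : DecidableEquality A
  _≟_ = inj⇒≟ (↔⇒↣ index)

-- Possibly empty or disconnected.
record PreGraph : Set₁ where
  infix 8 _⁻¹
  field
    V E D            : Set
    V-finite         : Finite V
    E-finite         : Finite E
    D-finite         : Finite D
    source           : E ⊎ D → V
    _⁻¹              : E → E
    ⁻¹-involutive    : ∀ e → (e ⁻¹) ⁻¹ ≡ e
    ⁻¹-fixedPointFree : ∀ e → ¬ e ⁻¹ ≡ e

  s t : E → V
  s e = source (inj₁ e)
  t e = s (e ⁻¹)

module Paths (Γ : PreGraph) where
  open PreGraph Γ

  -- step e p q γ is the path eγ, i.e. γ followed by e.
  data Path (u : V) : V → Set where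
    const : Path u u
    step  : ∀ {v w} (e : E) → s e ≡ v → t e ≡ w → Path u v → Path u w

  infixr 9 _∙_

  _∙_ : ∀ {u v w} → Path v w → Path u v → Path u w
  const        ∙ γ = γ
  step e p q γ′ ∙ γ = step e p q (γ′ ∙ γ)

  data _⇝_ {u : V} : ∀ {v} → Rel (Path u v) 0ℓ where
    backtrack : ∀ {v w} e (p : s e ≡ v) (q : t e ≡ w) (p′ : s (e ⁻¹) ≡ w) (q′ : t (e ⁻¹) ≡ v) γ →
                step (e ⁻¹) p′ q′ (step e p q γ) ⇝ γ
    under     : ∀ {v w} e (p : s e ≡ v) (q : t e ≡ w) {γ γ′} →
                γ ⇝ γ′ → step e p q γ ⇝ step e p q γ′

  -- Homotopy is the equivalence relation generated by removing backtracks.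
  π₁ : V → V → Setoid 0ℓ 0ℓ
  π₁ u v = equivalenceClosure (_⇝_ {u} {v})

record Graph : Set₁ where
  field
    preGraph : PreGraph
  open PreGraph preGraph public
  open Paths preGraph public
  field
    nonempty  : V
    connected : ∀ u v → Path u v

record MetrisedGraph : Set₁ where
  field
    graph : Graph
  open Graph graph public
  field
    ℓ          : E → ℚ
    ℓ-positive : ∀ e → Positive (ℓ e)
    ℓ-⁻¹       : ∀ e → ℓ (e ⁻¹) ≡ ℓ e

module MetrisedGraphTheory (Γ : MetrisedGraph) where
  open MetrisedGraph Γ public

  data Antisymmetry : Rel (Term E) 0ℓ where
    inverse : ∀ e → Antisymmetry (gen (e ⁻¹)) (⊟ gen e)

  ℚE± : VectorSpace
  ℚE± = Presented Antisymmetry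

  ℚV : VectorSpace
  ℚV = Free (setoid V)

  ∂ : Term E → Term V
  ∂ = extend ℚV (λ e → gen (t e) ⊞ ⊟ gen (s e))

  private
    module ℚV = LeftModule ℚV

  ∂-inverse : ∀ e → ∂ (gen (e ⁻¹)) ℚV.≈ᴹ ∂ (⊟ gen e)
  ∂-inverse e rewrite ⁻¹-involutive e = ≈-sym (begin
    ⊟ (gen (t e) ⊞ ⊟ gen (s e))               ≈⟨ ⊡-distribˡ _ _ _ ⟩
    ⊟ gen (t e) ⊞ (- 1ℚ) ⊡ (⊟ gen (s e))      ≈⟨ ⊞-cong ≈-refl (⊡-assoc _ _ _) ⟨
    ⊟ gen (t e) ⊞ 1ℚ ⊡ gen (s e)              ≈⟨ ⊞-cong ≈-refl (⊡-identityˡ _) ⟩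
    ⊟ gen (t e) ⊞ gen (s e)                   ≈⟨ ⊞-comm _ _ ⟩
    gen (s e) ⊞ ⊟ gen (t e)                   ∎)
    where open SetoidReasoning ℚV.≈ᴹ-setoid

  ∂-cong : ∀ {x y} → LeftModule._≈ᴹ_ ℚE± x y → ∂ x ℚV.≈ᴹ ∂ y
  ∂-cong (relation (inverse e)) = ∂-inverse e
  ∂-cong ≈-refl                 = ≈-refl
  ∂-cong (≈-sym p)              = ≈-sym (∂-cong p)
  ∂-cong (≈-trans p q)          = ≈-trans (∂-cong p) (∂-cong q)
  ∂-cong (⊞-cong p q)           = ⊞-cong (∂-cong p) (∂-cong q)
  ∂-cong (⊡-cong a p)           = ⊡-cong a (∂-cong p)
  ∂-cong (⊞-assoc x y z)        = ⊞-assoc _ _ _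
  ∂-cong (⊞-comm x y)           = ⊞-comm _ _
  ∂-cong (⊞-identityˡ x)        = ⊞-identityˡ _
  ∂-cong (⊡-zeroˡ x)            = ⊡-zeroˡ _
  ∂-cong (⊡-zeroʳ a)            = ⊡-zeroʳ a
  ∂-cong (⊡-identityˡ x)        = ⊡-identityˡ _
  ∂-cong (⊡-assoc a b x)        = ⊡-assoc a b _
  ∂-cong (⊡-distribʳ x a b)     = ⊡-distribʳ _ a b
  ∂-cong (⊡-distribˡ a x y)     = ⊡-distribˡ a _ _

  ker∂-isSubspace : IsSubspace ℚE± (λ x → ∂ x ℚV.≈ᴹ 𝟘)
  ker∂-isSubspace = record
    { resp = λ e p → ≈-trans (≈-sym (∂-cong e)) p
    ; 0-closed = ≈-refl
    ; +-closed = λ p q → ≈-trans (⊞-cong p q) (⊞-identityˡ 𝟘)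
    ; *-closed = λ a p → ≈-trans (⊡-cong a p) (⊡-zeroʳ a)
    }

  H₁ : VectorSpace
  H₁ = Subspace ℚE± ker∂-isSubspace

  H¹ : VectorSpace
  H¹ = Dual H₁

  H₁⊗ H¹⊗ : ℕ → VectorSpace
  H₁⊗ = TensorPower H₁
  H¹⊗ = TensorPower H¹

  ℚπ₁ : V → V → VectorSpace
  ℚπ₁ u v = Free (π₁ u v)

  infixl 7 _·_

  _·_ : ∀ {u v w} → ∣ ℚπ₁ v w ∣ → ∣ ℚπ₁ u v ∣ → ∣ ℚπ₁ u w ∣
  _·_ {u} {v} {w} = extend₂ (ℚπ₁ u w) (λ γ′ γ → gen (γ′ ∙ γ))

  data Products {u v w} (A : Pred ∣ ℚπ₁ v w ∣ 0ℓ) (B : Pred ∣ ℚπ₁ u v ∣ 0ℓ) :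
                Pred ∣ ℚπ₁ u w ∣ 0ℓ where
    product : ∀ a b → a ∈ A → b ∈ B → (a · b) ∈ Products A B

  infixl 7 _⋆_

  _⋆_ : ∀ {u v w} → Pred ∣ ℚπ₁ v w ∣ 0ℓ → Pred ∣ ℚπ₁ u v ∣ 0ℓ → Pred ∣ ℚπ₁ u w ∣ 0ℓ
  _⋆_ {u} {v} {w} A B = Span (ℚπ₁ u w) (Products A B)

  augmentation : ∀ u → ∣ ℚπ₁ u u ∣ → ℚ
  augmentation u = extend ℚ¹ (λ _ → 1ℚ)

  J : ∀ u → Pred ∣ ℚπ₁ u u ∣ 0ℓ
  J u x = augmentation u x ≡ 0ℚ

  J^ : ℕ → ∀ u → Pred ∣ ℚπ₁ u u ∣ 0ℓ
  J^ zero    u = U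
  J^ (suc k) u = J^ k u ⋆ J u

  -- W₋ k is W_{-k}.
  W₋ : ℕ → ∀ u v → Pred ∣ ℚπ₁ u v ∣ 0ℓ
  W₋ k u v = U {A = ∣ ℚπ₁ u v ∣} ⋆ J^ k u

  ℚπ₁/W₋ : ℕ → V → V → VectorSpace
  ℚπ₁/W₋ k u v = Quotient (ℚπ₁ u v) (W₋ k u v) (Span-isSubspace _ _)

  J^-decreasing : ∀ k u → J^ (suc k) u ⊆ J^ k u
  J^-decreasing zero    u _ = _
  J^-decreasing (suc k) u   =
    Span-mono _ λ { (product a b p q) → product a b (J^-decreasing k u p) q }

  W₋-decreasing : ∀ k u v → W₋ (suc k) u v ⊆ W₋ k u v
  W₋-decreasing k u v = Span-mono _ λ { (product a b p q) → product a b p (J^-decreasing k u q) }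

  projection : ∀ u v k → LinearMap (ℚπ₁/W₋ (suc k) u v) (ℚπ₁/W₋ k u v)
  projection u v k = record
    { ⟦_⟧ = λ x → x
    ; isLinear = mkIsLinear (ℚπ₁/W₋ (suc k) u v) (ℚπ₁/W₋ k u v) _
        (λ { (mod p) → mod (W₋-decreasing k u v p) })
        (λ x y → LeftModule.≈ᴹ-refl (ℚπ₁/W₋ k u v))
        (λ a x → LeftModule.≈ᴹ-refl (ℚπ₁/W₋ k u v))
    }

  completedℚπ₁ : V → V → VectorSpace
  completedℚπ₁ u v = Lim (λ n → ℚπ₁/W₋ (suc n) u v) (λ n → projection u v (suc n))

  ∫ᴱᴱ : E → E → ℚ
  ∫ᴱᴱ e e′ with Finite._≟_ E-finite e′ e | Finite._≟_ E-finite e′ (e ⁻¹)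
  ... | yes _ | _     = ℓ e
  ... | no  _ | yes _ = - ℓ e
  ... | no  _ | no  _ = 0ℚ

  ∫ᴱ : E → ∣ H₁ ∣ → ℚ
  ∫ᴱ e (ω , _) = extend ℚ¹ (∫ᴱᴱ e) ω

  ∫ᴱ* : E → List ∣ H₁ ∣ → ℚ
  ∫ᴱ* e ωs = ((+ 1) / (length ωs !)) {{length ωs !≢0}} * productℚ (map (∫ᴱ e) ωs)

  ∫ᴾ : ∀ {u v} → Path u v → List ∣ H₁ ∣ → ℚ
  ∫ᴾ const          []      = 1ℚ
  ∫ᴾ const          (_ ∷ _) = 0ℚ
  ∫ᴾ (step e _ _ γ) ωs      =
    ∑[ i < suc (length ωs) ] (∫ᴱ* e (drop (toℕ i) ωs) * ∫ᴾ γ (take (toℕ i) ωs))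

  ∫⊗ : ∀ {u v} m → ∣ ℚπ₁ u v ∣ → ∣ H₁⊗ m ∣ → ℚ
  ∫⊗ m = extend₂ ℚ¹ (λ γ ωs → ∫ᴾ γ (toList ωs))

  ∫ : ∀ {u v} n → ∣ ℚπ₁ u v ∣ → ∣ ⨁≤ n H₁⊗ ∣ → ℚ
  ∫ n x w = ∑[ m < suc n ] ∫⊗ (toℕ m) x (w m)

  -- The duality ⟨f₁⊗⋯⊗fₘ , ω₁⊗⋯⊗ωₘ⟩ = f₁(ω₁)⋯fₘ(ωₘ) by which H¹⊗ m is the dual of H₁⊗ m.
  duality⊗ : ∀ m → ∣ H¹⊗ m ∣ → ∣ H₁⊗ m ∣ → ℚ
  duality⊗ m = extend₂ ℚ¹ (λ fs ωs → productℚ (toList (zipWith ⟦_⟧ fs ωs)))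

  duality : ∀ n → ∣ ⨁≤ n H¹⊗ ∣ → ∣ ⨁≤ n H₁⊗ ∣ → ℚ
  duality n f w = ∑[ m < suc n ] duality⊗ (toℕ m) (f m) (w m)

{-# OPTIONS --safe #-}
-- Integration along paths sends γ to a noncommutative power series in H¹ which is multiplicative
-- in γ: it is the product of the exponentials of the edges of γ.  Hence J^k, and with it W_{-k},
-- is sent to series of order ≥ k, and the leading coefficient of a product of elements of J is
-- the tensor product of their linear coefficients.
--
-- Choosing paths from u to all vertices closes every edge e up to a loop; the class of the loop
-- minus 1 in J / J² depends linearly on e, and for a loop γ the sum over its edges is γ - 1.  So
-- J / J² is H₁.  As the cycle pairing is positive definite, Gram–Schmidt yields an orthogonal
-- family of cycles, and products of the corresponding elements of J span J^k / J^(k+1) and have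
-- the dual family of tensors in H¹⊗k as leading coefficients.  Therefore an element of W_{-k}
-- lies in W_{-k-1} once its degree k coefficients vanish, and coefficients of any degree can be
-- corrected at will without changing the lower ones.  This makes the map to ⨁ H¹⊗m bijective;
-- the pairing is perfect because the duality between H¹⊗m and H₁⊗m is.

module Submission where

open import Defs
open import Level using (0ℓ)
open import Algebra.Bundles using (CommutativeMonoid; Ring)
open import Algebra.Module.Bundles using (LeftModule)
open import Algebra.Module.Morphism.Structures using (module LeftModuleMorphisms)
open import Algebra.Module.Properties.LeftModule using (inverseˡ-uniqueᴹ)
import Algebra.Properties.CommutativeSemigroup as CommutativeSemigroupProperties
open import Data.Fin.Base using (Fin; zero; suc; toℕ; fromℕ<)
import Data.Fin.Properties as Fin
import Data.Integer.Base as ℤ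
open import Data.Integer.Base using (+0; +[1+_]; -[1+_])
import Data.Integer.Properties as ℤ
open import Data.List.Base using (List; []; _∷_; _++_; concatMap; length; take; drop; map; tabulate)
open import Data.List.Relation.Unary.All using (All; []; _∷_)
import Data.List.Relation.Unary.All as All
import Data.List.Relation.Unary.All.Properties as All
open import Data.Nat.Base as ℕ using (ℕ; zero; suc; _!; _<_; s≤s; z≤n)
import Data.Nat.Properties as ℕ
open import Data.Nat.Properties using (_!≢0)
open import Data.Product.Base using (Σ-syntax; _×_; _,_; proj₁; proj₂)
open import Data.Rational.Base using (ℚ; mkℚ; 0ℚ; 1ℚ; ½; _+_; _*_; -_; _/_; 1/_; fromℚᵘ; toℚᵘ; Positive; NonNegative; ≢-nonZero)
import Data.Rational.Properties as ℚ
open import Data.Rational.Solver using (module +-*-Solver)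
import Data.Rational.Unnormalised.Base as ℚᵘ
import Data.Rational.Unnormalised.Properties as ℚᵘ
open import Data.Sum.Base using (_⊎_; inj₁; inj₂)
open import Data.Vec.Base as Vec using (Vec; []; _∷_; lookup; replicate; zipWith; toList; fromList; _[_]≔_)
open import Data.Vec.Properties using (length-toList; map-∘; toList∘fromList)
import Data.Vec.Relation.Binary.Pointwise.Inductive as Pointwise
open import Data.Vec.Relation.Binary.Pointwise.Inductive using (Pointwise; []; _∷_)
open import Function.Base using (_∘_; id; flip)
open import Function.Bundles using (Inverse)
open import Relation.Binary.Bundles using (Setoid)
import Relation.Binary.Construct.Closure.Equivalence as EqClosure
open import Relation.Binary.Construct.Closure.ReflexiveTransitive using (ε; _◅_)
open import Relation.Binary.Construct.Closure.Symmetric using (fwd)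
open import Relation.Binary.Core using (Rel)
open import Relation.Binary.PropositionalEquality using (_≡_; _≢_; _≗_; refl; sym; trans; cong; cong₂; subst; isEquivalence; module ≡-Reasoning)
import Relation.Binary.Reasoning.Setoid as SetoidReasoning
open import Relation.Nullary using (yes; no; contradiction)
open import Relation.Unary using (Pred; _⊆_)
open import Algebra.Properties.CommutativeMonoid.Sum ℚ.+-0-commutativeMonoid using (sum-syntax; sum-cong-≗; ∑-distrib-+; sum-replicate-zero)
open import Algebra.Properties.Semiring.Sum (Ring.semiring ℚ.+-*-ring) using (*-distribˡ-sum)
open +-*-Solver using (solve; _:=_; _:+_; _:*_; :-_; con)

-- Equality in these spaces is generated by relations, so bijectivity is obtained from explicit
-- formulas instead of a count of dimensions. The key estimate is therefore an explicit linear map: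
-- from the degree k coefficients of an element of `J^ k` it builds a combination of products of
-- dual loops, and the error lies in `J^ (suc k)`. When the coefficients vanish, so does the
-- approximation, and the element itself lies one step deeper. Orthogonality is the bridge between
-- the two sides. The element of J attached to a cycle b has linear coefficients ⟨b , ω⟩, and the
-- functional that an orthogonal family attaches to its member b is a rational multiple of ⟨b , -⟩.
-- So the functionals needed to expand cycles are all realised by elements of J, after a mere
-- rescaling. The order of the statement is reversed: the isomorphisms φ are constructed first, from
-- the integrals along words in these cycles, and the perfectness of `∫` is pulled back along them
-- from the duality of tensor powers.

infix 4 _⊢_≈_

_⊢_≈_ : (M : VectorSpace) → ∣ M ∣ → ∣ M ∣ → Set
_⊢_≈_ = LeftModule._≈ᴹ_

-- Linear combinations

module _ (M : VectorSpace) where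
  open LeftModule M
  open SetoidReasoning ≈ᴹ-setoid
  open CommutativeSemigroupProperties
    (CommutativeMonoid.commutativeSemigroup +ᴹ-commutativeMonoid) using (interchange)

  combination : ∀ {n} → Vec ℚ n → Vec ∣ M ∣ n → ∣ M ∣
  combination []       []       = 0ᴹ
  combination (a ∷ as) (x ∷ xs) = a *ₗ x +ᴹ combination as xs

  private
    coefficients : ∀ {n} → Term (Fin n) → Vec ℚ n
    coefficients (gen i) = replicate _ 0ℚ [ i ]≔ 1ℚ
    coefficients 𝟘       = replicate _ 0ℚ
    coefficients (x ⊞ y) = zipWith _+_ (coefficients x) (coefficients y)
    coefficients (a ⊡ x) = Vec.map (a *_) (coefficients x)

    combination-0 : ∀ {n} (xs : Vec ∣ M ∣ n) → combination (replicate n 0ℚ) xs ≈ᴹ 0ᴹ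
    combination-0 []       = ≈ᴹ-refl
    combination-0 (x ∷ xs) = begin
      0ℚ *ₗ x +ᴹ combination (replicate _ 0ℚ) xs  ≈⟨ +ᴹ-cong (*ₗ-zeroˡ x) (combination-0 xs) ⟩
      0ᴹ +ᴹ 0ᴹ                                    ≈⟨ +ᴹ-identityˡ 0ᴹ ⟩
      0ᴹ                                          ∎

    combination-unit : ∀ {n} (i : Fin n) xs → combination (replicate n 0ℚ [ i ]≔ 1ℚ) xs ≈ᴹ lookup xs i
    combination-unit zero (x ∷ xs) = begin
      1ℚ *ₗ x +ᴹ combination (replicate _ 0ℚ) xs  ≈⟨ +ᴹ-cong (*ₗ-identityˡ x) (combination-0 xs) ⟩
      x +ᴹ 0ᴹ                                     ≈⟨ +ᴹ-identityʳ x ⟩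
      x                                           ∎
    combination-unit (suc i) (x ∷ xs) = begin
      0ℚ *ₗ x +ᴹ combination (replicate _ 0ℚ [ i ]≔ 1ℚ) xs  ≈⟨ +ᴹ-cong (*ₗ-zeroˡ x) (combination-unit i xs) ⟩
      0ᴹ +ᴹ lookup xs i                                     ≈⟨ +ᴹ-identityˡ _ ⟩
      lookup xs i                                           ∎

    combination-+ : ∀ {n} as bs (xs : Vec ∣ M ∣ n) →
      combination (zipWith _+_ as bs) xs ≈ᴹ combination as xs +ᴹ combination bs xs
    combination-+ []       []       []       = ≈ᴹ-sym (+ᴹ-identityˡ 0ᴹ)
    combination-+ (a ∷ as) (b ∷ bs) (x ∷ xs) = ≈ᴹ-trans
      (+ᴹ-cong (*ₗ-distribʳ x a b) (combination-+ as bs xs)) (interchange _ _ _ _)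

    combination-* : ∀ {n} a bs (xs : Vec ∣ M ∣ n) →
      combination (Vec.map (a *_) bs) xs ≈ᴹ a *ₗ combination bs xs
    combination-* a []       []       = ≈ᴹ-sym (*ₗ-zeroʳ a)
    combination-* a (b ∷ bs) (x ∷ xs) = ≈ᴹ-trans
      (+ᴹ-cong (*ₗ-assoc a b x) (combination-* a bs xs)) (≈ᴹ-sym (*ₗ-distribˡ a _ _))

    normalise : ∀ {n} (x : Term (Fin n)) xs → extend M (lookup xs) x ≈ᴹ combination (coefficients x) xs
    normalise (gen i) xs = ≈ᴹ-sym (combination-unit i xs)
    normalise 𝟘       xs = ≈ᴹ-sym (combination-0 xs)
    normalise (x ⊞ y) xs = ≈ᴹ-trans (+ᴹ-cong (normalise x xs) (normalise y xs))
      (≈ᴹ-sym (combination-+ (coefficients x) (coefficients y) xs))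
    normalise (a ⊡ x) xs = ≈ᴹ-trans (*ₗ-cong refl (normalise x xs))
      (≈ᴹ-sym (combination-* a (coefficients x) xs))

  -- Identities between linear combinations of given vectors, by comparing coefficients.
  linearly : ∀ {n} (xs : Vec ∣ M ∣ n) (x y : Term (Fin n)) → coefficients x ≡ coefficients y →
             extend M (lookup xs) x ≈ᴹ extend M (lookup xs) y
  linearly xs x y eq = begin
    extend M (lookup xs) x            ≈⟨ normalise x xs ⟩
    combination (coefficients x) xs   ≡⟨ cong (λ as → combination as xs) eq ⟩
    combination (coefficients y) xs   ≈⟨ normalise y xs ⟨
    extend M (lookup xs) y            ∎

  -- `linearly` knows sums and multiples only; this brings the negation of an arbitrary space within
  -- its reach.
  -ᴹ≈-1* : ∀ x → -ᴹ x ≈ᴹ (- 1ℚ) *ₗ x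
  -ᴹ≈-1* x = ≈ᴹ-sym (inverseˡ-uniqueᴹ M _ x (begin
    (- 1ℚ) *ₗ x +ᴹ x   ≈⟨ linearly (x ∷ []) (⊟ gen zero ⊞ gen zero) 𝟘 refl ⟩
    0ᴹ                 ∎))

  difference≈0 : ∀ {x y} → x +ᴹ -ᴹ y ≈ᴹ 0ᴹ → x ≈ᴹ y
  difference≈0 {x} {y} eq = begin
    x                           ≈⟨ linearly (x ∷ y ∷ []) (gen zero)
                                     ((gen zero ⊞ ⊟ gen (suc zero)) ⊞ gen (suc zero)) refl ⟩
    (x +ᴹ (- 1ℚ) *ₗ y) +ᴹ y     ≈⟨ +ᴹ-cong (+ᴹ-cong ≈ᴹ-refl (-ᴹ≈-1* y)) ≈ᴹ-refl ⟨
    (x +ᴹ -ᴹ y) +ᴹ y            ≈⟨ +ᴹ-cong eq ≈ᴹ-refl ⟩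
    0ᴹ +ᴹ y                     ≈⟨ +ᴹ-identityˡ y ⟩
    y                           ∎

-- Linear maps and subspaces

idᴸ : ∀ {M} → LinearMap M M
idᴸ {M} = record
  { ⟦_⟧ = id ; isLinear = mkIsLinear M M _ id (λ _ _ → ≈ᴹ-refl) (λ _ _ → ≈ᴹ-refl) }
  where open LeftModule M

infixr 9 _∘ᴸ_

_∘ᴸ_ : ∀ {L M N} → LinearMap M N → LinearMap L M → LinearMap L N
_∘ᴸ_ {L} {M} {N} g f = record
  { ⟦_⟧ = ⟦ g ⟧ ∘ ⟦ f ⟧
  ; isLinear = mkIsLinear L N _ (g.⟦⟧-cong ∘ f.⟦⟧-cong)
      (λ x y → ≈ᴹ-trans (g.⟦⟧-cong (f.+ᴹ-homo x y)) (g.+ᴹ-homo _ _))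
      (λ a x → ≈ᴹ-trans (g.⟦⟧-cong (f.*ₗ-homo a x)) (g.*ₗ-homo a _))
  }
  where
  open LeftModule N
  module f = LinearMap f
  module g = LinearMap g

module _ {M N : VectorSpace} where
  private
    module M = LeftModule M
    module N = LeftModule N

  -- Together with `Span-least` this reduces the claim that a linear map sends a span into a
  -- subspace to the generators. The inclusions between products of powers of J are obtained in this
  -- way.
  preimage-isSubspace : ∀ {P} (f : LinearMap M N) → IsSubspace N P → IsSubspace M (P ∘ ⟦ f ⟧)
  preimage-isSubspace f sub = record
    { resp     = λ eq → P.resp (f.⟦⟧-cong eq)
    ; 0-closed = P.resp (N.≈ᴹ-sym f.0ᴹ-homo) P.0-closed
    ; +-closed = λ p q → P.resp (N.≈ᴹ-sym (f.+ᴹ-homo _ _)) (P.+-closed p q)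
    ; *-closed = λ a p → P.resp (N.≈ᴹ-sym (f.*ₗ-homo a _)) (P.*-closed a p)
    }
    where
    module f = LinearMap f
    module P = IsSubspace sub

  equaliser-isSubspace : (f g : LinearMap M N) → IsSubspace M (λ x → N ⊢ ⟦ f ⟧ x ≈ ⟦ g ⟧ x)
  equaliser-isSubspace f g = record
    { resp     = λ eq p → N.≈ᴹ-trans (f.⟦⟧-cong (M.≈ᴹ-sym eq)) (N.≈ᴹ-trans p (g.⟦⟧-cong eq))
    ; 0-closed = N.≈ᴹ-trans f.0ᴹ-homo (N.≈ᴹ-sym g.0ᴹ-homo)
    ; +-closed = λ p q → N.≈ᴹ-trans (f.+ᴹ-homo _ _)
        (N.≈ᴹ-trans (N.+ᴹ-cong p q) (N.≈ᴹ-sym (g.+ᴹ-homo _ _)))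
    ; *-closed = λ a p → N.≈ᴹ-trans (f.*ₗ-homo a _)
        (N.≈ᴹ-trans (N.*ₗ-cong refl p) (N.≈ᴹ-sym (g.*ₗ-homo a _)))
    }
    where
    module f = LinearMap f
    module g = LinearMap g

Span-least : ∀ {M S P} → IsSubspace M P → S ⊆ P → Span M S ⊆ P
Span-least sub S⊆P (resp eq p)    = IsSubspace.resp sub eq (Span-least sub S⊆P p)
Span-least sub S⊆P (incl s)       = S⊆P s
Span-least sub S⊆P 0-closed       = IsSubspace.0-closed sub
Span-least sub S⊆P (+-closed p q) = IsSubspace.+-closed sub (Span-least sub S⊆P p) (Span-least sub S⊆P q)
Span-least sub S⊆P (*-closed a p) = IsSubspace.*-closed sub a (Span-least sub S⊆P p)

module _ (M : VectorSpace) {P : Pred ∣ M ∣ 0ℓ} (sub : IsSubspace M P) where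
  private
    module M = LeftModule M
    module P = IsSubspace sub
    Q = Quotient M P sub
    open SetoidReasoning M.≈ᴹ-setoid

  quotient-≈ : ∀ {x y} → M ⊢ x ≈ y → Q ⊢ x ≈ y
  quotient-≈ {x} {y} eq = mod (P.resp
    (M.≈ᴹ-trans (M.≈ᴹ-sym (M.-ᴹ‿inverseʳ y)) (M.+ᴹ-cong (M.≈ᴹ-sym eq) M.≈ᴹ-refl)) P.0-closed)

  ∈⇒≈0 : ∀ {x} → P x → Q ⊢ x ≈ M.0ᴹ
  ∈⇒≈0 {x} p = mod (P.resp (begin
    x                          ≈⟨ linearly M (x ∷ []) (gen zero) (gen zero ⊞ ⊟ 𝟘) refl ⟩
    x M.+ᴹ (- 1ℚ) M.*ₗ M.0ᴹ    ≈⟨ M.+ᴹ-cong M.≈ᴹ-refl (-ᴹ≈-1* M M.0ᴹ) ⟨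
    x M.+ᴹ M.-ᴹ M.0ᴹ           ∎) p)

  ≈0⇒∈ : ∀ {x} → Q ⊢ x ≈ M.0ᴹ → P x
  ≈0⇒∈ {x} (mod p) = P.resp (begin
    x M.+ᴹ M.-ᴹ M.0ᴹ           ≈⟨ M.+ᴹ-cong M.≈ᴹ-refl (-ᴹ≈-1* M M.0ᴹ) ⟩
    x M.+ᴹ (- 1ℚ) M.*ₗ M.0ᴹ    ≈⟨ linearly M (x ∷ []) (gen zero ⊞ ⊟ 𝟘) (gen zero) refl ⟩
    x                          ∎) p

  quotientMap : LinearMap M Q
  quotientMap = record
    { ⟦_⟧ = id
    ; isLinear = mkIsLinear M Q _ quotient-≈
        (λ _ _ → LeftModule.≈ᴹ-refl Q) (λ _ _ → LeftModule.≈ᴹ-refl Q)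
    }

-- Presented spaces

⊡-congˡ : ∀ {G} {R : Rel (Term G) 0ℓ} {a b x} → a ≡ b → Presented R ⊢ a ⊡ x ≈ b ⊡ x
⊡-congˡ refl = ≈-refl

module _ {G : Set} {R : Rel (Term G) 0ℓ} where

  Term-induction : ∀ {P} → IsSubspace (Presented R) P → (∀ g → P (gen g)) → ∀ x → P x
  Term-induction sub base (gen g) = base g
  Term-induction sub base 𝟘       = IsSubspace.0-closed sub
  Term-induction sub base (x ⊞ y) =
    IsSubspace.+-closed sub (Term-induction sub base x) (Term-induction sub base y)
  Term-induction sub base (a ⊡ x) = IsSubspace.*-closed sub a (Term-induction sub base x)

  linear-unique : ∀ {N} (f g : LinearMap (Presented R) N) →
    (∀ x → N ⊢ ⟦ f ⟧ (gen x) ≈ ⟦ g ⟧ (gen x)) → ∀ x → N ⊢ ⟦ f ⟧ x ≈ ⟦ g ⟧ x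
  linear-unique f g = Term-induction (equaliser-isSubspace f g)

  module _ (N : VectorSpace) (f : G → ∣ N ∣)
           (respects : ∀ {x y} → R x y → N ⊢ extend N f x ≈ extend N f y) where
    open LeftModule N

    extend-cong : ∀ {x y} → Presented R ⊢ x ≈ y → N ⊢ extend N f x ≈ extend N f y
    extend-cong (relation r)       = respects r
    extend-cong ≈-refl             = ≈ᴹ-refl
    extend-cong (≈-sym p)          = ≈ᴹ-sym (extend-cong p)
    extend-cong (≈-trans p q)      = ≈ᴹ-trans (extend-cong p) (extend-cong q)
    extend-cong (⊞-cong p q)       = +ᴹ-cong (extend-cong p) (extend-cong q)
    extend-cong (⊡-cong a p)       = *ₗ-cong refl (extend-cong p)
    extend-cong (⊞-assoc x y z)    = +ᴹ-assoc _ _ _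
    extend-cong (⊞-comm x y)       = +ᴹ-comm _ _
    extend-cong (⊞-identityˡ x)    = +ᴹ-identityˡ _
    extend-cong (⊡-zeroˡ x)        = *ₗ-zeroˡ _
    extend-cong (⊡-zeroʳ a)        = *ₗ-zeroʳ a
    extend-cong (⊡-identityˡ x)    = *ₗ-identityˡ _
    extend-cong (⊡-assoc a b x)    = *ₗ-assoc a b _
    extend-cong (⊡-distribʳ x a b) = *ₗ-distribʳ _ a b
    extend-cong (⊡-distribˡ a x y) = *ₗ-distribˡ a _ _

    extendᴸ : LinearMap (Presented R) N
    extendᴸ = record
      { ⟦_⟧ = extend N f
      ; isLinear = mkIsLinear (Presented R) N _ extend-cong (λ _ _ → ≈ᴹ-refl) (λ _ _ → ≈ᴹ-refl)
      }

module _ (N : VectorSpace) where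
  open LeftModule N
  open CommutativeSemigroupProperties
    (CommutativeMonoid.commutativeSemigroup +ᴹ-commutativeMonoid) using (interchange)

  extend-pointwise : ∀ {G} {f g : G → ∣ N ∣} → (∀ x → N ⊢ f x ≈ g x) → ∀ x → N ⊢ extend N f x ≈ extend N g x
  extend-pointwise eq (gen x) = eq x
  extend-pointwise eq 𝟘       = ≈ᴹ-refl
  extend-pointwise eq (x ⊞ y) = +ᴹ-cong (extend-pointwise eq x) (extend-pointwise eq y)
  extend-pointwise eq (a ⊡ x) = *ₗ-cong refl (extend-pointwise eq x)

  extend-0 : ∀ {G} (x : Term G) → N ⊢ extend N (λ _ → 0ᴹ) x ≈ 0ᴹ
  extend-0 (gen x) = ≈ᴹ-refl
  extend-0 𝟘       = ≈ᴹ-refl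
  extend-0 (x ⊞ y) = ≈ᴹ-trans (+ᴹ-cong (extend-0 x) (extend-0 y)) (+ᴹ-identityˡ 0ᴹ)
  extend-0 (a ⊡ x) = ≈ᴹ-trans (*ₗ-cong refl (extend-0 x)) (*ₗ-zeroʳ a)

  extend-+ : ∀ {G} (f g : G → ∣ N ∣) x → N ⊢ extend N (λ y → f y +ᴹ g y) x ≈ extend N f x +ᴹ extend N g x
  extend-+ f g (gen x) = ≈ᴹ-refl
  extend-+ f g 𝟘       = ≈ᴹ-sym (+ᴹ-identityˡ 0ᴹ)
  extend-+ f g (x ⊞ y) = ≈ᴹ-trans (+ᴹ-cong (extend-+ f g x) (extend-+ f g y)) (interchange _ _ _ _)
  extend-+ f g (a ⊡ x) = ≈ᴹ-trans (*ₗ-cong refl (extend-+ f g x)) (*ₗ-distribˡ a _ _)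

  *ₗ-swap : ∀ a b x → N ⊢ a *ₗ (b *ₗ x) ≈ b *ₗ (a *ₗ x)
  *ₗ-swap a b x = ≈ᴹ-trans (≈ᴹ-sym (*ₗ-assoc a b x))
    (≈ᴹ-trans (*ₗ-cong (ℚ.*-comm a b) ≈ᴹ-refl) (*ₗ-assoc b a x))

  extend-* : ∀ {G} a (f : G → ∣ N ∣) x → N ⊢ extend N (λ y → a *ₗ f y) x ≈ a *ₗ extend N f x
  extend-* a f (gen x) = ≈ᴹ-refl
  extend-* a f 𝟘       = ≈ᴹ-sym (*ₗ-zeroʳ a)
  extend-* a f (x ⊞ y) = ≈ᴹ-trans (+ᴹ-cong (extend-* a f x) (extend-* a f y)) (≈ᴹ-sym (*ₗ-distribˡ a _ _))
  extend-* a f (b ⊡ x) = ≈ᴹ-trans (*ₗ-cong refl (extend-* a f x)) (*ₗ-swap b a _)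

  -- `extend₂` recurses on its left argument first. Exchanging the two lets a relation on the left
  -- be checked against a single generator on the right.
  extend₂-swap : ∀ {G H} (f : G → H → ∣ N ∣) x y → N ⊢ extend₂ N f x y ≈ extend₂ N (flip f) y x
  extend₂-swap f (gen x)  y = ≈ᴹ-refl
  extend₂-swap f 𝟘        y = ≈ᴹ-sym (extend-0 y)
  extend₂-swap f (x ⊞ x′) y = ≈ᴹ-trans (+ᴹ-cong (extend₂-swap f x y) (extend₂-swap f x′ y))
    (≈ᴹ-sym (extend-+ _ _ y))
  extend₂-swap f (a ⊡ x)  y = ≈ᴹ-trans (*ₗ-cong refl (extend₂-swap f x y)) (≈ᴹ-sym (extend-* a _ y))

  module _ {G H} (R : Rel (Term G) 0ℓ) (S : Rel (Term H) 0ℓ) (f : G → H → ∣ N ∣)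
           (respectsˡ : ∀ {x x′} h → R x x′ → N ⊢ extend N (λ g → f g h) x ≈ extend N (λ g → f g h) x′)
           (respectsʳ : ∀ {y y′} g → S y y′ → N ⊢ extend N (f g) y ≈ extend N (f g) y′) where

    extend₂-ˡ : Term H → LinearMap (Presented R) N
    extend₂-ˡ y = extendᴸ N (λ g → extend N (f g) y) λ {x} {x′} r →
      ≈ᴹ-trans (extend₂-swap f x y)
      (≈ᴹ-trans (extend-pointwise (λ h → respectsˡ h r) y) (≈ᴹ-sym (extend₂-swap f x′ y)))

    extend₂-ʳ : Term G → LinearMap (Presented S) N
    extend₂-ʳ x = record
      { ⟦_⟧ = extend₂ N f x
      ; isLinear = mkIsLinear (Presented S) N _
          (λ p → extend-pointwise (λ g → extend-cong N (f g) (respectsʳ g) p) x)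
          (λ y y′ → extend-+ _ _ x)
          (λ a y → extend-* a _ x)
      }

extend₂-isBilinear : ∀ {G H} (R : Rel (Term G) 0ℓ) (S : Rel (Term H) 0ℓ) (f : G → H → ℚ) →
  (∀ {x x′} h → R x x′ → extend ℚ¹ (λ g → f g h) x ≡ extend ℚ¹ (λ g → f g h) x′) →
  (∀ {y y′} g → S y y′ → extend ℚ¹ (f g) y ≡ extend ℚ¹ (f g) y′) →
  IsBilinear (Presented R) (Presented S) (extend₂ ℚ¹ f)
extend₂-isBilinear R S f respectsˡ respectsʳ = record
  { ⟨⟩-cong = λ {x} {x′} {y} {y′} p q → trans (LinearMap.⟦⟧-cong (l y) p) (LinearMap.⟦⟧-cong (r x′) q)
  ; +-homoˡ = λ _ _ _ → refl
  ; +-homoʳ = λ x → LinearMap.+ᴹ-homo (r x)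
  ; *-homoˡ = λ _ _ _ → refl
  ; *-homoʳ = λ a x → LinearMap.*ₗ-homo (r x) a
  }
  where
  l = extend₂-ˡ ℚ¹ R S f respectsˡ respectsʳ
  r = extend₂-ʳ ℚ¹ R S f respectsˡ respectsʳ

-- Sums over lists

sumOver : ∀ {I : Set} (N : VectorSpace) → List I → (I → ∣ N ∣) → ∣ N ∣
sumOver N []       f = LeftModule.0ᴹ N
sumOver N (i ∷ is) f = LeftModule._+ᴹ_ N (f i) (sumOver N is f)

module _ {I : Set} (N : VectorSpace) where
  open LeftModule N
  open CommutativeSemigroupProperties
    (CommutativeMonoid.commutativeSemigroup +ᴹ-commutativeMonoid) using (interchange)

  sumOver-cong : ∀ (is : List I) {f g} → (∀ i → N ⊢ f i ≈ g i) → N ⊢ sumOver N is f ≈ sumOver N is g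
  sumOver-cong []       eq = ≈ᴹ-refl
  sumOver-cong (i ∷ is) eq = +ᴹ-cong (eq i) (sumOver-cong is eq)

  sumOver-+ : ∀ (is : List I) f g →
    N ⊢ sumOver N is (λ i → f i +ᴹ g i) ≈ sumOver N is f +ᴹ sumOver N is g
  sumOver-+ []       f g = ≈ᴹ-sym (+ᴹ-identityˡ 0ᴹ)
  sumOver-+ (i ∷ is) f g = ≈ᴹ-trans (+ᴹ-cong ≈ᴹ-refl (sumOver-+ is f g)) (interchange _ _ _ _)

  sumOver-* : ∀ (is : List I) a f → N ⊢ sumOver N is (λ i → a *ₗ f i) ≈ a *ₗ sumOver N is f
  sumOver-* []       a f = ≈ᴹ-sym (*ₗ-zeroʳ a)
  sumOver-* (i ∷ is) a f = ≈ᴹ-trans (+ᴹ-cong ≈ᴹ-refl (sumOver-* is a f)) (≈ᴹ-sym (*ₗ-distribˡ a _ _))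

  sumOver-0 : ∀ (is : List I) {f} → (∀ i → N ⊢ f i ≈ 0ᴹ) → N ⊢ sumOver N is f ≈ 0ᴹ
  sumOver-0 []       eq = ≈ᴹ-refl
  sumOver-0 (i ∷ is) eq = ≈ᴹ-trans (+ᴹ-cong (eq i) (sumOver-0 is eq)) (+ᴹ-identityˡ 0ᴹ)

  sumOver-++ : ∀ (is js : List I) f → N ⊢ sumOver N (is ++ js) f ≈ sumOver N is f +ᴹ sumOver N js f
  sumOver-++ []       js f = ≈ᴹ-sym (+ᴹ-identityˡ _)
  sumOver-++ (i ∷ is) js f = ≈ᴹ-trans (+ᴹ-cong ≈ᴹ-refl (sumOver-++ is js f)) (≈ᴹ-sym (+ᴹ-assoc _ _ _))

  sumOver-map : ∀ {J : Set} (h : I → J) is f → N ⊢ sumOver N (map h is) f ≈ sumOver N is (f ∘ h)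
  sumOver-map h []       f = ≈ᴹ-refl
  sumOver-map h (i ∷ is) f = +ᴹ-cong ≈ᴹ-refl (sumOver-map h is f)

  sumOver-concatMap : ∀ {J : Set} (h : J → List I) js f →
    N ⊢ sumOver N (concatMap h js) f ≈ sumOver N js (λ j → sumOver N (h j) f)
  sumOver-concatMap h []       f = ≈ᴹ-refl
  sumOver-concatMap h (j ∷ js) f =
    ≈ᴹ-trans (sumOver-++ (h j) _ f) (+ᴹ-cong ≈ᴹ-refl (sumOver-concatMap h js f))

  sumOver-linear : ∀ {M} (f : LinearMap M N) (is : List I) g →
    N ⊢ ⟦ f ⟧ (sumOver M is g) ≈ sumOver N is (⟦ f ⟧ ∘ g)
  sumOver-linear f []       g = LinearMap.0ᴹ-homo f
  sumOver-linear f (i ∷ is) g =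
    ≈ᴹ-trans (LinearMap.+ᴹ-homo f _ _) (+ᴹ-cong ≈ᴹ-refl (sumOver-linear f is g))

  sumOver-combination : ∀ {M} (f : LinearMap M N) (is : List I) (a : I → ℚ) (g : I → ∣ M ∣) →
    N ⊢ ⟦ f ⟧ (sumOver M is (λ i → LeftModule._*ₗ_ M (a i) (g i))) ≈ sumOver N is (λ i → a i *ₗ ⟦ f ⟧ (g i))
  sumOver-combination f is a g = ≈ᴹ-trans (sumOver-linear f is _)
    (sumOver-cong is (λ i → LinearMap.*ₗ-homo f (a i) (g i)))

  -- The finite-rank map Σ cᵢ ⊗ bᵢ. Projections, leading terms and signatures all have this form, so
  -- their linearity is settled here.
  expansion : ∀ {M} → List I → (I → ∣ Dual M ∣) → (I → ∣ N ∣) → LinearMap M N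
  expansion {M} is c b = record
    { ⟦_⟧ = λ x → sumOver N is (λ i → ⟦ c i ⟧ x *ₗ b i)
    ; isLinear = mkIsLinear M N _
        (λ eq → sumOver-cong is λ i → *ₗ-cong (LinearMap.⟦⟧-cong (c i) eq) ≈ᴹ-refl)
        (λ x y → ≈ᴹ-trans
          (sumOver-cong is λ i → ≈ᴹ-trans (*ₗ-cong (LinearMap.+ᴹ-homo (c i) x y) ≈ᴹ-refl) (*ₗ-distribʳ _ _ _))
          (sumOver-+ is _ _))
        (λ a x → ≈ᴹ-trans
          (sumOver-cong is λ i → ≈ᴹ-trans (*ₗ-cong (LinearMap.*ₗ-homo (c i) a x) ≈ᴹ-refl) (*ₗ-assoc _ _ _))
          (sumOver-* is a _))
    }

words : ∀ {I : Set} → List I → ∀ m → List (Vec I m)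
words is zero    = [] ∷ []
words is (suc m) = concatMap (λ i → map (i ∷_) (words is m)) is

sumOver-words : ∀ {I : Set} (N : VectorSpace) (is : List I) m (f : Vec I (suc m) → ∣ N ∣) →
  N ⊢ sumOver N (words is (suc m)) f ≈ sumOver N is (λ i → sumOver N (words is m) (λ w → f (i ∷ w)))
sumOver-words N is m f = ≈ᴹ-trans (sumOver-concatMap N _ is f)
  (sumOver-cong N is λ i → sumOver-map N (i ∷_) (words is m) f)
  where open LeftModule N

sumOver-single : ∀ {I : Set} (N : VectorSpace) {n} (g : Fin n → I) (f : I → ∣ N ∣) i →
  (∀ j → j ≢ i → N ⊢ f (g j) ≈ LeftModule.0ᴹ N) → N ⊢ sumOver N (tabulate g) f ≈ f (g i)
sumOver-single N {suc n} g f zero    others = ≈ᴹ-trans (+ᴹ-cong ≈ᴹ-refl (rest (g ∘ suc) (λ j → others (suc j) λ ())))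
  (+ᴹ-identityʳ _)
  where
  open LeftModule N
  rest : ∀ {n} (h : Fin n → _) → (∀ j → N ⊢ f (h j) ≈ 0ᴹ) → N ⊢ sumOver N (tabulate h) f ≈ 0ᴹ
  rest {zero}  h eq = ≈ᴹ-refl
  rest {suc n} h eq = ≈ᴹ-trans (+ᴹ-cong (eq zero) (rest (h ∘ suc) (eq ∘ suc))) (+ᴹ-identityˡ 0ᴹ)
sumOver-single N {suc n} g f (suc i) others = ≈ᴹ-trans
  (+ᴹ-cong (others zero λ ()) (sumOver-single N (g ∘ suc) f i (λ j j≢i → others (suc j) λ { refl → j≢i refl })))
  (+ᴹ-identityˡ _)
  where open LeftModule N

sumOver∈ : ∀ {M P} {K : Set} → IsSubspace M P → (ks : List K) {f : K → ∣ M ∣} → (∀ k → P (f k)) → P (sumOver M ks f)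
sumOver∈ sub []       p = IsSubspace.0-closed sub
sumOver∈ sub (k ∷ ks) p = IsSubspace.+-closed sub (p k) (sumOver∈ sub ks p)

-- Tensor powers

evaluateAt : ∀ {M} → ∣ M ∣ → ∣ Dual (Dual M) ∣
evaluateAt {M} x = record
  { ⟦_⟧ = λ f → ⟦ f ⟧ x
  ; isLinear = mkIsLinear (Dual M) ℚ¹ _ (λ eq → eq x) (λ _ _ → refl) (λ _ _ → refl)
  }

module _ {M : VectorSpace} where
  open LeftModule M


  evaluate : ∀ {m} → Vec ∣ Dual M ∣ m → Vec ∣ M ∣ m → ℚ
  evaluate fs xs = productℚ (toList (zipWith ⟦_⟧ fs xs))

  evaluate-cong : ∀ {m} (fs : Vec ∣ Dual M ∣ m) {xs ys} → Pointwise _≈ᴹ_ xs ys → evaluate fs xs ≡ evaluate fs ys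
  evaluate-cong []       []         = refl
  evaluate-cong (f ∷ fs) (eq ∷ eqs) = cong₂ _*_ (LinearMap.⟦⟧-cong f eq) (evaluate-cong fs eqs)

  evaluate-+ : ∀ {m} (fs : Vec ∣ Dual M ∣ m) xs i y z →
    evaluate fs (xs [ i ]≔ (y +ᴹ z)) ≡ evaluate fs (xs [ i ]≔ y) + evaluate fs (xs [ i ]≔ z)
  evaluate-+ (f ∷ fs) (x ∷ xs) zero    y z =
    trans (cong (_* evaluate fs xs) (LinearMap.+ᴹ-homo f y z)) (ℚ.*-distribʳ-+ (evaluate fs xs) (⟦ f ⟧ y) (⟦ f ⟧ z))
  evaluate-+ (f ∷ fs) (x ∷ xs) (suc i) y z =
    trans (cong (⟦ f ⟧ x *_) (evaluate-+ fs xs i y z)) (ℚ.*-distribˡ-+ (⟦ f ⟧ x) _ _)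

  evaluate-* : ∀ {m} (fs : Vec ∣ Dual M ∣ m) xs i a y →
    evaluate fs (xs [ i ]≔ (a *ₗ y)) ≡ a * evaluate fs (xs [ i ]≔ y)
  evaluate-* (f ∷ fs) (x ∷ xs) zero    a y =
    trans (cong (_* evaluate fs xs) (LinearMap.*ₗ-homo f a y)) (ℚ.*-assoc a _ _)
  evaluate-* (f ∷ fs) (x ∷ xs) (suc i) a y =
    trans (cong (⟦ f ⟧ x *_) (evaluate-* fs xs i a y))
      (solve 3 (λ p q r → p :* (q :* r) := q :* (p :* r)) refl (⟦ f ⟧ x) a _)

  evaluate-Multilinear : ∀ {m} (fs : Vec ∣ Dual M ∣ m) {x y} → Multilinear M m x y →
    extend ℚ¹ (evaluate fs) x ≡ extend ℚ¹ (evaluate fs) y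
  evaluate-Multilinear fs (pointwise eqs)     = evaluate-cong fs eqs
  evaluate-Multilinear fs (additive xs i y z) = evaluate-+ fs xs i y z
  evaluate-Multilinear fs (scalar xs i a y)   = evaluate-* fs xs i a y

  tensorFunctional : ∀ {m} → Vec ∣ Dual M ∣ m → ∣ Dual (TensorPower M m) ∣
  tensorFunctional fs = extendᴸ ℚ¹ (evaluate fs) (evaluate-Multilinear fs)

  consᴸ : ∀ {m} → ∣ M ∣ → LinearMap (TensorPower M m) (TensorPower M (suc m))
  consᴸ x = extendᴸ _ (λ xs → gen (x ∷ xs)) λ
    { (pointwise eqs)     → relation (pointwise (≈ᴹ-refl ∷ eqs))
    ; (additive xs i y z) → relation (additive (x ∷ xs) (suc i) y z)
    ; (scalar xs i a y)   → relation (scalar (x ∷ xs) (suc i) a y)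
    }

  headᴸ : ∀ {m} → Vec ∣ M ∣ m → LinearMap M (TensorPower M (suc m))
  headᴸ xs = record
    { ⟦_⟧ = λ x → gen (x ∷ xs)
    ; isLinear = mkIsLinear M (TensorPower M _) _
        (λ eq → relation (pointwise (eq ∷ Pointwise.refl ≈ᴹ-refl)))
        (λ y z → relation (additive (y ∷ xs) zero y z))
        (λ a y → relation (scalar (y ∷ xs) zero a y))
    }

-- Vectors read as elements of the bidual make multilinearity in the functionals an instance of
-- multilinearity in the vectors.
evaluate-swap : ∀ {M m} (fs : Vec ∣ Dual M ∣ m) xs →
  evaluate fs xs ≡ evaluate {Dual M} (Vec.map evaluateAt xs) fs
evaluate-swap []       []       = refl
evaluate-swap (f ∷ fs) (x ∷ xs) = cong (⟦ f ⟧ x *_) (evaluate-swap fs xs)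

-- Frames replace bases: they pass to duals and tensor powers without any proof of linear
-- independence.
record Frame (M : VectorSpace) (I : Set) : Set where
  field
    support  : List I
    vector   : I → ∣ M ∣
    covector : I → ∣ Dual M ∣

  open LeftModule M

  field
    expand : ∀ x → M ⊢ x ≈ sumOver M support (λ i → ⟦ covector i ⟧ x *ₗ vector i)

module _ {M : VectorSpace} {I : Set} (F : Frame M I) where
  open Frame F

  expand-linear : ∀ {N} (f : LinearMap M N) x →
    N ⊢ ⟦ f ⟧ x ≈ sumOver N support (λ i → LeftModule._*ₗ_ N (⟦ covector i ⟧ x) (⟦ f ⟧ (vector i)))
  expand-linear {N} f x = LeftModule.≈ᴹ-trans N (LinearMap.⟦⟧-cong f (expand x))
    (sumOver-combination N f support _ _)

  -- A frame writes the identity as Σ covectorᵢ ⊗ vectorᵢ, and the transpose of the identity is the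
  -- identity of the dual.
  dualFrame : Frame (Dual M) I
  dualFrame = record
    { support  = support
    ; vector   = covector
    ; covector = evaluateAt ∘ vector
    ; expand   = λ f x → begin
        ⟦ f ⟧ x
          ≡⟨ expand-linear f x ⟩
        sumOver ℚ¹ support (λ i → ⟦ covector i ⟧ x * ⟦ f ⟧ (vector i))
          ≡⟨ sumOver-cong ℚ¹ support (λ i → ℚ.*-comm (⟦ covector i ⟧ x) (⟦ f ⟧ (vector i))) ⟩
        sumOver ℚ¹ support (λ i → ⟦ f ⟧ (vector i) * ⟦ covector i ⟧ x)
          ≡⟨ sumOver-linear ℚ¹ (evaluateAt x) support _ ⟨
        ⟦ sumOver (Dual M) support (λ i → LeftModule._*ₗ_ (Dual M) (⟦ f ⟧ (vector i)) (covector i)) ⟧ x ∎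
    }
    where open ≡-Reasoning

  private
    tensorCoefficient : ∀ {m} → Vec I m → Vec ∣ M ∣ m → ℚ
    tensorCoefficient w = evaluate (Vec.map covector w)

    expand-gen : ∀ m (xs : Vec ∣ M ∣ m) → TensorPower M m ⊢ gen xs ≈
      sumOver (TensorPower M m) (words support m) (λ w → tensorCoefficient w xs ⊡ gen (Vec.map vector w))
    expand-gen zero    []       = linearly (TensorPower M 0) (gen [] ∷ []) (gen zero) (1ℚ ⊡ gen zero ⊞ 𝟘) refl
    expand-gen (suc m) (x ∷ xs) = begin
      gen (x ∷ xs)
        ≈⟨ expand-linear (headᴸ xs) x ⟩
      sumOver T support (λ i → ⟦ covector i ⟧ x ⊡ gen (vector i ∷ xs))
        ≈⟨ sumOver-cong T support step ⟩
      sumOver T support (λ i → sumOver T (words support m)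
        (λ w → tensorCoefficient (i ∷ w) (x ∷ xs) ⊡ gen (Vec.map vector (i ∷ w))))
        ≈⟨ sumOver-words T support m _ ⟨
      sumOver T (words support (suc m)) (λ w → tensorCoefficient w (x ∷ xs) ⊡ gen (Vec.map vector w)) ∎
      where
      T = TensorPower M (suc m)
      open SetoidReasoning (LeftModule.≈ᴹ-setoid T)
      step : ∀ i → T ⊢ ⟦ covector i ⟧ x ⊡ gen (vector i ∷ xs) ≈ sumOver T (words support m)
        (λ w → tensorCoefficient (i ∷ w) (x ∷ xs) ⊡ gen (vector i ∷ Vec.map vector w))
      step i = begin
        a ⊡ gen (vector i ∷ xs)
          ≈⟨ ⊡-cong a (LinearMap.⟦⟧-cong (consᴸ (vector i)) (expand-gen m xs)) ⟩
        a ⊡ ⟦ consᴸ (vector i) ⟧ (sumOver (TensorPower M m) (words support m)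
          (λ w → tensorCoefficient w xs ⊡ gen (Vec.map vector w)))
          ≈⟨ ⊡-cong a (sumOver-combination T (consᴸ (vector i)) (words support m) _ _) ⟩
        a ⊡ sumOver T (words support m) (λ w → tensorCoefficient w xs ⊡ gen (vector i ∷ Vec.map vector w))
          ≈⟨ sumOver-* T (words support m) a _ ⟨
        sumOver T (words support m) (λ w → a ⊡ (tensorCoefficient w xs ⊡ gen (vector i ∷ Vec.map vector w)))
          ≈⟨ sumOver-cong T (words support m) (λ w → ≈-sym (⊡-assoc a _ _)) ⟩
        sumOver T (words support m) (λ w → tensorCoefficient (i ∷ w) (x ∷ xs) ⊡ gen (vector i ∷ Vec.map vector w)) ∎
        where a = ⟦ covector i ⟧ x

  -- The expansion is linear in the tensor, so pure tensors suffice, and these expand factor by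
  -- factor.
  tensorFrame : ∀ m → Frame (TensorPower M m) (Vec I m)
  tensorFrame m = record
    { support  = words support m
    ; vector   = λ w → gen (Vec.map vector w)
    ; covector = λ w → tensorFunctional (Vec.map covector w)
    ; expand   = linear-unique idᴸ
        (expansion T (words support m) (λ w → tensorFunctional (Vec.map covector w)) (λ w → gen (Vec.map vector w)))
        (expand-gen m)
    }
    where T = TensorPower M m

-- Perfect pairings

mkIsIsomorphism : ∀ {M N} (f : LinearMap M N) →
  (∀ {x y} → N ⊢ ⟦ f ⟧ x ≈ ⟦ f ⟧ y → M ⊢ x ≈ y) →
  (∀ y → Σ[ x ∈ ∣ M ∣ ] (N ⊢ ⟦ f ⟧ x ≈ y)) →
  IsIsomorphism M N ⟦ f ⟧
mkIsIsomorphism {M} {N} f injective surjective = record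
  { isLeftModuleMonomorphism = record
    { isLeftModuleHomomorphism = LinearMap.isLinear f ; injective = injective }
  ; surjective = λ y → proj₁ (surjective y) ,
      λ eq → LeftModule.≈ᴹ-trans N (LinearMap.⟦⟧-cong f eq) (proj₂ (surjective y))
  }

module IsIso {M N : VectorSpace} {f : ∣ M ∣ → ∣ N ∣} (iso : IsIsomorphism M N f) where
  open LeftModuleMorphisms.IsLeftModuleIsomorphism iso public
    using (injective; ⟦⟧-cong; +ᴹ-homo; *ₗ-homo)
  private
    module iso = LeftModuleMorphisms.IsLeftModuleIsomorphism iso
    module M = LeftModule M
    module N = LeftModule N

  inverse : ∣ N ∣ → ∣ M ∣
  inverse y = proj₁ (iso.surjective y)

  inverseʳ : ∀ y → N ⊢ f (inverse y) ≈ y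
  inverseʳ y = proj₂ (iso.surjective y) M.≈ᴹ-refl

  inverseˡ : ∀ x → M ⊢ inverse (f x) ≈ x
  inverseˡ x = injective (inverseʳ (f x))

  inverseᴸ : LinearMap N M
  inverseᴸ = record
    { ⟦_⟧ = inverse
    ; isLinear = mkIsLinear N M inverse
        (λ {x} {y} eq → injective (N.≈ᴹ-trans (inverseʳ x) (N.≈ᴹ-trans eq (N.≈ᴹ-sym (inverseʳ y)))))
        (λ x y → injective (N.≈ᴹ-trans (inverseʳ _) (N.≈ᴹ-sym
          (N.≈ᴹ-trans (+ᴹ-homo _ _) (N.+ᴹ-cong (inverseʳ x) (inverseʳ y))))))
        (λ a x → injective (N.≈ᴹ-trans (inverseʳ _) (N.≈ᴹ-sym
          (N.≈ᴹ-trans (*ₗ-homo a _) (N.*ₗ-cong refl (inverseʳ x))))))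
    }

flip-isBilinear : ∀ {M N p} → IsBilinear M N p → IsBilinear N M (flip p)
flip-isBilinear b = record
  { ⟨⟩-cong = λ eq eq′ → ⟨⟩-cong eq′ eq
  ; +-homoˡ = λ x x′ y → +-homoʳ y x x′
  ; +-homoʳ = λ x y y′ → +-homoˡ y y′ x
  ; *-homoˡ = λ a x y → *-homoʳ a y x
  ; *-homoʳ = λ a x y → *-homoˡ a y x
  }
  where open IsBilinear b

module _ {M N : VectorSpace} {p : ∣ M ∣ → ∣ N ∣ → ℚ} (b : IsBilinear M N p) where
  open IsBilinear b
  private
    module M = LeftModule M
    module N = LeftModule N

  adjointˡᴸ : LinearMap M (Dual N)
  adjointˡᴸ = record
    { ⟦_⟧ = adjointˡ
    ; isLinear = mkIsLinear M (Dual N) adjointˡ (λ eq y → ⟨⟩-cong eq N.≈ᴹ-refl) +-homoˡ *-homoˡ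
    }

  perfect : IsIsomorphism M (Dual N) adjointˡ →
            IsIsomorphism N (Dual M) (IsBilinear.adjointˡ (flip-isBilinear b)) → IsPerfectPairing M N p
  perfect isoˡ isoʳ = record
    { isBilinear = b ; adjointˡ-isIsomorphism = isoˡ ; adjointʳ-isIsomorphism = isoʳ }

  -- If Σ xᵢ ⊗ yᵢ inverts the pairing, then f ↦ Σ f(yᵢ) xᵢ inverts its adjoint.
  dualFamilies⇒isoˡ : ∀ {I : Set} (is : List I) (xs : I → ∣ M ∣) (ys : I → ∣ N ∣) →
    (∀ x → M ⊢ x ≈ sumOver M is (λ i → p x (ys i) M.*ₗ xs i)) →
    (∀ y → N ⊢ y ≈ sumOver N is (λ i → p (xs i) y N.*ₗ ys i)) →
    IsIsomorphism M (Dual N) adjointˡ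
  dualFamilies⇒isoˡ is xs ys expandˡ expandʳ = mkIsIsomorphism {M} {Dual N} adjointˡᴸ
    (λ {x} {x′} eq → M.≈ᴹ-trans (expandˡ x) (M.≈ᴹ-trans
      (sumOver-cong M is (λ i → M.*ₗ-cong (eq (ys i)) M.≈ᴹ-refl)) (M.≈ᴹ-sym (expandˡ x′))))
    (λ f → sumOver M is (λ i → ⟦ f ⟧ (ys i) M.*ₗ xs i) , λ y → begin
      p (sumOver M is (λ i → ⟦ f ⟧ (ys i) M.*ₗ xs i)) y
        ≡⟨ sumOver-combination ℚ¹ (adjointʳ y) is (⟦ f ⟧ ∘ ys) xs ⟩
      sumOver ℚ¹ is (λ i → ⟦ f ⟧ (ys i) * p (xs i) y)
        ≡⟨ sumOver-cong ℚ¹ is (λ i → ℚ.*-comm (⟦ f ⟧ (ys i)) (p (xs i) y)) ⟩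
      sumOver ℚ¹ is (λ i → p (xs i) y * ⟦ f ⟧ (ys i))
        ≡⟨ sumOver-combination ℚ¹ f is (λ i → p (xs i) y) ys ⟨
      ⟦ f ⟧ (sumOver N is (λ i → p (xs i) y N.*ₗ ys i))
        ≡⟨ LinearMap.⟦⟧-cong f (N.≈ᴹ-sym (expandʳ y)) ⟩
      ⟦ f ⟧ y ∎)
    where open ≡-Reasoning

module _ {L M N : VectorSpace} {φ : ∣ L ∣ → ∣ M ∣} (iso : IsIsomorphism L M φ)
         {p : ∣ M ∣ → ∣ N ∣ → ℚ} (pp : IsPerfectPairing M N p)
         {q : ∣ L ∣ → ∣ N ∣ → ℚ} (compatible : ∀ x y → p (φ x) y ≡ q x y) where
  private
    module φ = IsIso {L} {M} iso
    module p = IsPerfectPairing pp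
    module left = IsIso {M} {Dual N} p.adjointˡ-isIsomorphism
    module right = IsIso {N} {Dual M} p.adjointʳ-isIsomorphism
    module M = LeftModule M
    module N = LeftModule N

    bilinear : IsBilinear L N q
    bilinear = record
      { ⟨⟩-cong = λ {x} {x′} {y} {y′} eq eq′ →
          trans (sym (compatible x y)) (trans (p.⟨⟩-cong (φ.⟦⟧-cong eq) eq′) (compatible x′ y′))
      ; +-homoˡ = λ x x′ y → trans (sym (compatible _ y)) (trans (p.⟨⟩-cong (φ.+ᴹ-homo x x′) N.≈ᴹ-refl)
          (trans (p.+-homoˡ _ _ y) (cong₂ _+_ (compatible x y) (compatible x′ y))))
      ; +-homoʳ = λ x y y′ → trans (sym (compatible x _)) (trans (p.+-homoʳ _ y y′)
          (cong₂ _+_ (compatible x y) (compatible x y′)))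
      ; *-homoˡ = λ a x y → trans (sym (compatible _ y)) (trans (p.⟨⟩-cong (φ.*ₗ-homo a x) N.≈ᴹ-refl)
          (trans (p.*-homoˡ a _ y) (cong (a *_) (compatible x y))))
      ; *-homoʳ = λ a x y → trans (sym (compatible x _)) (trans (p.*-homoʳ a _ y)
          (cong (a *_) (compatible x y)))
      }

  -- The left adjoint of `q` is that of `p` after φ; the right adjoint is that of `p` followed by
  -- the transpose of φ, which is bijective along with φ.
  pullback-isPerfectPairing : IsPerfectPairing L N q
  pullback-isPerfectPairing = perfect bilinear
    (mkIsIsomorphism {L} {Dual N} (adjointˡᴸ bilinear)
      (λ {x} {x′} eq → φ.injective (left.injective (λ y →
        trans (compatible x y) (trans (eq y) (sym (compatible x′ y))))))
      (λ f → φ.inverse (left.inverse f) , λ y → trans (sym (compatible _ y))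
        (trans (p.⟨⟩-cong (φ.inverseʳ _) N.≈ᴹ-refl) (left.inverseʳ f y))))
    (mkIsIsomorphism {N} {Dual L} (adjointˡᴸ (flip-isBilinear bilinear))
      (λ {y} {y′} eq → right.injective (λ x → trans (p.⟨⟩-cong (M.≈ᴹ-sym (φ.inverseʳ x)) N.≈ᴹ-refl)
        (trans (compatible _ y) (trans (eq (φ.inverse x))
        (trans (sym (compatible _ y′)) (p.⟨⟩-cong (φ.inverseʳ x) N.≈ᴹ-refl))))))
      (λ f → right.inverse (f ∘ᴸ φ.inverseᴸ) , λ x → trans (sym (compatible x _))
        (trans (right.inverseʳ (f ∘ᴸ φ.inverseᴸ) (φ x)) (LinearMap.⟦⟧-cong f (φ.inverseˡ x)))))

-- Finite products of perfect pairings

module _ {k : ℕ} (M : Fin (suc k) → VectorSpace) where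
  private module M i = LeftModule (M i)

  cons : ∣ M zero ∣ → ∣ Π (Fin k) (M ∘ suc) ∣ → ∣ Π (Fin (suc k)) M ∣
  cons x xs zero    = x
  cons x xs (suc i) = xs i

  cons0ᴸ : LinearMap (Π (Fin k) (M ∘ suc)) (Π (Fin (suc k)) M)
  cons0ᴸ = record
    { ⟦_⟧ = cons (M.0ᴹ zero)
    ; isLinear = mkIsLinear (Π (Fin k) (M ∘ suc)) (Π (Fin (suc k)) M) _
        (λ eq → λ { zero → M.≈ᴹ-refl zero ; (suc i) → eq i })
        (λ _ _ → λ { zero → M.≈ᴹ-sym zero (M.+ᴹ-identityˡ zero _) ; (suc i) → M.≈ᴹ-refl (suc i) })
        (λ a _ → λ { zero → M.≈ᴹ-sym zero (M.*ₗ-zeroʳ zero a) ; (suc i) → M.≈ᴹ-refl (suc i) })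
    }

  consᶻᴸ : LinearMap (M zero) (Π (Fin (suc k)) M)
  consᶻᴸ = record
    { ⟦_⟧ = λ x → cons x (λ i → M.0ᴹ (suc i))
    ; isLinear = mkIsLinear (M zero) (Π (Fin (suc k)) M) _
        (λ eq → λ { zero → eq ; (suc i) → M.≈ᴹ-refl (suc i) })
        (λ _ _ → λ { zero → M.≈ᴹ-refl zero ; (suc i) → M.≈ᴹ-sym (suc i) (M.+ᴹ-identityˡ (suc i) _) })
        (λ a _ → λ { zero → M.≈ᴹ-refl zero ; (suc i) → M.≈ᴹ-sym (suc i) (M.*ₗ-zeroʳ (suc i) a) })
    }

-- Recursion on the index avoids a transport in the family `M` along a decided equality of indices.
injection : ∀ {k} (M : Fin k → VectorSpace) i → LinearMap (M i) (Π (Fin k) M)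
injection M zero    = consᶻᴸ M
injection M (suc i) = cons0ᴸ M ∘ᴸ injection (M ∘ suc) i

functional-Π : ∀ {k} (M : Fin k → VectorSpace) (f : ∣ Dual (Π (Fin k) M) ∣) x →
  ∑[ i < k ] ⟦ f ⟧ (⟦ injection M i ⟧ (x i)) ≡ ⟦ f ⟧ x
functional-Π {zero}  M f x = sym (trans (LinearMap.⟦⟧-cong f (λ ())) (LinearMap.0ᴹ-homo f))
functional-Π {suc k} M f x = begin
  ⟦ f ⟧ (⟦ consᶻᴸ M ⟧ (x zero)) + ∑[ i < k ] ⟦ f ∘ᴸ cons0ᴸ M ⟧ (⟦ injection (M ∘ suc) i ⟧ (x (suc i)))
    ≡⟨ cong (⟦ f ⟧ (⟦ consᶻᴸ M ⟧ (x zero)) +_) (functional-Π (M ∘ suc) (f ∘ᴸ cons0ᴸ M) (x ∘ suc)) ⟩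
  ⟦ f ⟧ (⟦ consᶻᴸ M ⟧ (x zero)) + ⟦ f ⟧ (⟦ cons0ᴸ M ⟧ (x ∘ suc))
    ≡⟨ LinearMap.+ᴹ-homo f _ _ ⟨
  ⟦ f ⟧ (LeftModule._+ᴹ_ (Π (Fin (suc k)) M) (⟦ consᶻᴸ M ⟧ (x zero)) (⟦ cons0ᴸ M ⟧ (x ∘ suc)))
    ≡⟨ LinearMap.⟦⟧-cong f (λ { zero → M.+ᴹ-identityʳ zero _ ; (suc i) → M.+ᴹ-identityˡ (suc i) _ }) ⟩
  ⟦ f ⟧ x ∎
  where
  open ≡-Reasoning
  module M i = LeftModule (M i)

module _ {k : ℕ} {M N : Fin k → VectorSpace} {p : ∀ i → ∣ M i ∣ → ∣ N i ∣ → ℚ}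
         (b : ∀ i → IsBilinear (M i) (N i) (p i)) where
  private module b i = IsBilinear (b i)

  Π-isBilinear : IsBilinear (Π (Fin k) M) (Π (Fin k) N) (λ x y → ∑[ i < k ] p i (x i) (y i))
  Π-isBilinear = record
    { ⟨⟩-cong = λ eq eq′ → sum-cong-≗ (λ i → b.⟨⟩-cong i (eq i) (eq′ i))
    ; +-homoˡ = λ x x′ y → trans (sum-cong-≗ (λ i → b.+-homoˡ i (x i) (x′ i) (y i)))
        (∑-distrib-+ (λ i → p i (x i) (y i)) (λ i → p i (x′ i) (y i)))
    ; +-homoʳ = λ x y y′ → trans (sum-cong-≗ (λ i → b.+-homoʳ i (x i) (y i) (y′ i)))
        (∑-distrib-+ (λ i → p i (x i) (y i)) (λ i → p i (x i) (y′ i)))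
    ; *-homoˡ = λ a x y → trans (sum-cong-≗ (λ i → b.*-homoˡ i a (x i) (y i))) 
        (sym (*-distribˡ-sum a (λ i → p i (x i) (y i))))
    ; *-homoʳ = λ a x y → trans (sum-cong-≗ (λ i → b.*-homoʳ i a (x i) (y i))) 
        (sym (*-distribˡ-sum a (λ i → p i (x i) (y i))))
    }

pairing-injection : ∀ {k} {M N : Fin k → VectorSpace} {p : ∀ i → ∣ M i ∣ → ∣ N i ∣ → ℚ} →
  (∀ i → IsBilinear (M i) (N i) (p i)) →
  ∀ (x : ∣ Π (Fin k) M ∣) i y → ∑[ j < k ] p j (x j) (⟦ injection N i ⟧ y j) ≡ p i (x i) y
pairing-injection {suc k} {p = p} b x zero y = trans
  (cong (p zero (x zero) y +_) (trans (sum-cong-≗ (λ i → LinearMap.0ᴹ-homo (IsBilinear.adjointˡ (b (suc i)) (x (suc i)))))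
    (sum-replicate-zero k)))
  (ℚ.+-identityʳ _)
pairing-injection {suc k} b x (suc i) y = trans
  (cong₂ _+_ (LinearMap.0ᴹ-homo (IsBilinear.adjointˡ (b zero) (x zero))) (pairing-injection (b ∘ suc) (x ∘ suc) i y))
  (ℚ.+-identityˡ _)

module _ {k : ℕ} {M N : Fin k → VectorSpace} {p : ∀ i → ∣ M i ∣ → ∣ N i ∣ → ℚ}
         (b : ∀ i → IsBilinear (M i) (N i) (p i))
         (isoˡ : ∀ i → IsIsomorphism (M i) (Dual (N i)) (IsBilinear.adjointˡ (b i))) where
  private module iso i = IsIso {M i} {Dual (N i)} (isoˡ i)

  Π-isoˡ : IsIsomorphism (Π (Fin k) M) (Dual (Π (Fin k) N)) (IsBilinear.adjointˡ (Π-isBilinear b))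
  Π-isoˡ = mkIsIsomorphism {Π (Fin k) M} {Dual (Π (Fin k) N)} (adjointˡᴸ (Π-isBilinear b))
    (λ {x} {x′} eq i → iso.injective i (λ y →
      trans (sym (pairing-injection b x i y)) (trans (eq (⟦ injection N i ⟧ y)) (pairing-injection b x′ i y))))
    (λ f → (λ i → iso.inverse i (f ∘ᴸ injection N i)) ,
           (λ y → trans (sum-cong-≗ (λ i → iso.inverseʳ i (f ∘ᴸ injection N i) (y i))) (functional-Π N f y)))

Π-isPerfectPairing : ∀ {k} {M N : Fin k → VectorSpace} {p : ∀ i → ∣ M i ∣ → ∣ N i ∣ → ℚ} →
  (∀ i → IsPerfectPairing (M i) (N i) (p i)) →
  IsPerfectPairing (Π (Fin k) M) (Π (Fin k) N) (λ x y → ∑[ i < k ] p i (x i) (y i))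
Π-isPerfectPairing pp = perfect (Π-isBilinear p.isBilinear)
  (Π-isoˡ p.isBilinear p.adjointˡ-isIsomorphism)
  (Π-isoˡ (λ i → flip-isBilinear (p.isBilinear i)) p.adjointʳ-isIsomorphism)
  where module p i = IsPerfectPairing (pp i)

-- The duality between tensor powers

module _ {M : VectorSpace} where

  tensorPairing : ∀ m → ∣ TensorPower (Dual M) m ∣ → ∣ TensorPower M m ∣ → ℚ
  tensorPairing m = extend₂ ℚ¹ (evaluate {M})

  private
    evaluate-Multilinearˡ : ∀ {m} (xs : Vec ∣ M ∣ m) {f g} → Multilinear (Dual M) m f g →
      extend ℚ¹ (λ fs → evaluate {M} fs xs) f ≡ extend ℚ¹ (λ fs → evaluate {M} fs xs) g
    evaluate-Multilinearˡ xs {f} {g} r = begin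
      extend ℚ¹ (λ fs → evaluate {M} fs xs) f                     ≡⟨ extend-pointwise ℚ¹ (λ fs → evaluate-swap {M} fs xs) f ⟩
      extend ℚ¹ (evaluate {Dual M} (Vec.map (evaluateAt {M}) xs)) f     ≡⟨ evaluate-Multilinear {Dual M} (Vec.map (evaluateAt {M}) xs) r ⟩
      extend ℚ¹ (evaluate {Dual M} (Vec.map (evaluateAt {M}) xs)) g     ≡⟨ extend-pointwise ℚ¹ (λ fs → evaluate-swap {M} fs xs) g ⟨
      extend ℚ¹ (λ fs → evaluate {M} fs xs) g                     ∎
      where open ≡-Reasoning

  tensorPairing-isBilinear : ∀ m → IsBilinear (TensorPower (Dual M) m) (TensorPower M m) (tensorPairing m)
  tensorPairing-isBilinear m = extend₂-isBilinear (Multilinear (Dual M) m) (Multilinear M m) (evaluate {M})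
    (λ xs r → evaluate-Multilinearˡ xs r) (λ fs r → evaluate-Multilinear {M} fs r)

  module _ {I : Set} (F : Frame M I) (m : ℕ) where
    open Frame F
    private
      T  = TensorPower M m
      T* = TensorPower (Dual M) m

    -- This is the tensor frame of the dual frame: its covectors evaluate at the `vector`s, so the
    -- coefficients are values of the pairing.
    tensorPairing-expandˡ : ∀ h → T* ⊢ h ≈ sumOver T* (words support m)
      (λ w → tensorPairing m h (gen (Vec.map vector w)) ⊡ gen (Vec.map covector w))
    tensorPairing-expandˡ h = ≈-trans (Frame.expand (tensorFrame (dualFrame F) m) h)
      (sumOver-cong T* (words support m)
        {λ w → extend ℚ¹ (evaluate {Dual M} (Vec.map (evaluateAt {M} ∘ vector) w)) h ⊡ gen (Vec.map covector w)}
        {λ w → tensorPairing m h (gen (Vec.map vector w)) ⊡ gen (Vec.map covector w)}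
        (λ w → ⊡-congˡ (coefficient w)))
      where
      coefficient : ∀ w → extend ℚ¹ (evaluate {Dual M} (Vec.map (evaluateAt {M} ∘ vector) w)) h ≡
        tensorPairing m h (gen (Vec.map vector w))
      coefficient w = extend-pointwise ℚ¹ (λ fs → trans
        (cong (λ xs → evaluate {Dual M} xs fs) (map-∘ (evaluateAt {M}) vector w)) (sym (evaluate-swap {M} fs (Vec.map vector w)))) h

    tensorPairing-expandʳ : ∀ x → T ⊢ x ≈ sumOver T (words support m)
      (λ w → tensorPairing m (gen (Vec.map covector w)) x ⊡ gen (Vec.map vector w))
    tensorPairing-expandʳ = Frame.expand (tensorFrame F m)

    tensorPairing-isPerfectPairing : IsPerfectPairing T* T (tensorPairing m)
    tensorPairing-isPerfectPairing = perfect {T*} {T} b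
      (dualFamilies⇒isoˡ {T*} {T} b (words support m) covectors vectors tensorPairing-expandˡ tensorPairing-expandʳ)
      (dualFamilies⇒isoˡ {T} {T*} (flip-isBilinear {T*} {T} b) (words support m) vectors covectors
        tensorPairing-expandʳ tensorPairing-expandˡ)
      where
      b = tensorPairing-isBilinear m
      vectors : Vec I m → ∣ T ∣
      vectors w = gen (Vec.map vector w)
      covectors : Vec I m → ∣ T* ∣
      covectors w = gen (Vec.map covector w)

-- Orthogonalisation

module _ (M : VectorSpace) (⟨_,_⟩ : ∣ M ∣ → ∣ M ∣ → ℚ) (bilinear : IsBilinear M M ⟨_,_⟩)
         (symmetric : ∀ x y → ⟨ x , y ⟩ ≡ ⟨ y , x ⟩)
         (definite : ∀ x → ⟨ x , x ⟩ ≡ 0ℚ → M ⊢ x ≈ LeftModule.0ᴹ M) where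
  open LeftModule M
  open IsBilinear bilinear
  open SetoidReasoning ≈ᴹ-setoid
  private module ≡R = ≡-Reasoning

  -- A pair (b , c) stands for a vector b with c = 1 / ⟨ b , b ⟩.
  orthogonalCovector : ∣ M ∣ × ℚ → ∣ Dual M ∣
  orthogonalCovector (b , c) = LeftModule._*ₗ_ (Dual M) c (adjointˡ b)

  project : List (∣ M ∣ × ℚ) → LinearMap M M
  project bs = expansion M bs orthogonalCovector proj₁

  project-selfAdjoint : ∀ bs x y → ⟨ ⟦ project bs ⟧ x , y ⟩ ≡ ⟨ x , ⟦ project bs ⟧ y ⟩
  project-selfAdjoint bs x y = ≡R.begin
    ⟨ ⟦ project bs ⟧ x , y ⟩
      ≡R.≡⟨ sumOver-combination ℚ¹ (adjointʳ y) bs _ _ ⟩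
    sumOver ℚ¹ bs (λ (b , c) → (c * ⟨ b , x ⟩) * ⟨ b , y ⟩)
      ≡R.≡⟨ sumOver-cong ℚ¹ bs (λ (b , c) → trans
             (solve 3 (λ p q r → (p :* q) :* r := (p :* r) :* q) refl c ⟨ b , x ⟩ ⟨ b , y ⟩)
             (cong ((c * ⟨ b , y ⟩) *_) (symmetric b x))) ⟩
    sumOver ℚ¹ bs (λ (b , c) → (c * ⟨ b , y ⟩) * ⟨ x , b ⟩)
      ≡R.≡⟨ sumOver-combination ℚ¹ (adjointˡ x) bs _ _ ⟨
    ⟨ x , ⟦ project bs ⟧ y ⟩ ≡R.∎

  -- The invariant speaks of the projection alone: its idempotence, with the self-adjointness that
  -- holds for any list, does the work of pairwise orthogonality. The residual `r` satisfies
  -- `p r ≈ 0`, hence is orthogonal to every `p x`.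
  gramSchmidt : ∀ xs → Σ[ bs ∈ List (∣ M ∣ × ℚ) ]
    (∀ x → M ⊢ ⟦ project bs ⟧ (⟦ project bs ⟧ x) ≈ ⟦ project bs ⟧ x) ×
    All (λ x → M ⊢ ⟦ project bs ⟧ x ≈ x) xs
  gramSchmidt []       = [] , (λ _ → ≈ᴹ-refl) , []
  gramSchmidt (y ∷ xs) with gramSchmidt xs
  ... | bs , idem , fixed = extended
    where
    module p = LinearMap (project bs)
    p = ⟦ project bs ⟧
    r = y +ᴹ (- 1ℚ) *ₗ p y

    y≈r+py : M ⊢ y ≈ r +ᴹ p y
    y≈r+py = linearly M (y ∷ p y ∷ []) (gen zero) ((gen zero ⊞ ⊟ gen (suc zero)) ⊞ gen (suc zero)) refl

    pr≈0 : M ⊢ p r ≈ 0ᴹ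
    pr≈0 = begin
      p r                              ≈⟨ p.+ᴹ-homo _ _ ⟩
      p y +ᴹ p ((- 1ℚ) *ₗ p y)         ≈⟨ +ᴹ-cong ≈ᴹ-refl (≈ᴹ-trans (p.*ₗ-homo _ _) (*ₗ-cong refl (idem y))) ⟩
      p y +ᴹ (- 1ℚ) *ₗ p y             ≈⟨ linearly M (p y ∷ []) (gen zero ⊞ ⊟ gen zero) 𝟘 refl ⟩
      0ᴹ                               ∎

    ⟨r,p⟩≡0 : ∀ x → ⟨ r , p x ⟩ ≡ 0ℚ
    ⟨r,p⟩≡0 x = trans (sym (project-selfAdjoint bs r x))
      (trans (⟨⟩-cong pr≈0 ≈ᴹ-refl) (LinearMap.0ᴹ-homo (adjointʳ x)))

    extended : Σ[ bs ∈ List (∣ M ∣ × ℚ) ]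
      (∀ x → M ⊢ ⟦ project bs ⟧ (⟦ project bs ⟧ x) ≈ ⟦ project bs ⟧ x) ×
      All (λ x → M ⊢ ⟦ project bs ⟧ x ≈ x) (y ∷ xs)
    extended with ⟨ r , r ⟩ ℚ.≟ 0ℚ
    -- By definiteness the residual is zero, so `y` is fixed already and the list stays as it is.
    ... | yes r²≡0 = bs , idem , ≈ᴹ-sym (≈ᴹ-trans y≈r+py
            (≈ᴹ-trans (+ᴹ-cong (definite r r²≡0) ≈ᴹ-refl) (+ᴹ-identityˡ _))) ∷ fixed
    ... | no  r²≢0 = (r , c) ∷ bs , idem′ , fixed-y ∷ All.map (λ {x} → fixed-old x) fixed
      where
      instance _ = ≢-nonZero r²≢0
      c = 1/ ⟨ r , r ⟩
      p′ = ⟦ project ((r , c) ∷ bs) ⟧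

      -- Since `r` is orthogonal to the image of `p`, only the multiple of `r` in `p′ x`
      -- contributes, and `c` cancels ⟨ r , r ⟩.
      c⟨r,_⟩ : ∀ x → c * ⟨ r , p′ x ⟩ ≡ c * ⟨ r , x ⟩
      c⟨r, x ⟩ = cong (c *_) (≡R.begin
        ⟨ r , (c * ⟨ r , x ⟩) *ₗ r +ᴹ p x ⟩
          ≡R.≡⟨ trans (+-homoʳ r _ _) (cong₂ _+_ (*-homoʳ _ r r) (⟨r,p⟩≡0 x)) ⟩
        (c * ⟨ r , x ⟩) * ⟨ r , r ⟩ + 0ℚ
          ≡R.≡⟨ solve 3 (λ a b d → (a :* b) :* d :+ con 0ℚ := (a :* d) :* b) refl c ⟨ r , x ⟩ ⟨ r , r ⟩ ⟩
        (c * ⟨ r , r ⟩) * ⟨ r , x ⟩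
          ≡R.≡⟨ cong (_* ⟨ r , x ⟩) (ℚ.*-inverseˡ ⟨ r , r ⟩) ⟩
        1ℚ * ⟨ r , x ⟩
          ≡R.≡⟨ ℚ.*-identityˡ _ ⟩
        ⟨ r , x ⟩ ≡R.∎)

      idem′ : ∀ x → M ⊢ p′ (p′ x) ≈ p′ x
      idem′ x = +ᴹ-cong (*ₗ-cong c⟨r, x ⟩ ≈ᴹ-refl) (begin
        p ((c * ⟨ r , x ⟩) *ₗ r +ᴹ p x)        ≈⟨ p.+ᴹ-homo _ _ ⟩
        p ((c * ⟨ r , x ⟩) *ₗ r) +ᴹ p (p x)    ≈⟨ +ᴹ-cong (≈ᴹ-trans (p.*ₗ-homo _ r) (≈ᴹ-trans (*ₗ-cong refl pr≈0) (*ₗ-zeroʳ _))) (idem x) ⟩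
        0ᴹ +ᴹ p x                              ≈⟨ +ᴹ-identityˡ _ ⟩
        p x                                    ∎)

      fixed-old : ∀ x → M ⊢ p x ≈ x → M ⊢ p′ x ≈ x
      fixed-old x px≈x = begin
        (c * ⟨ r , x ⟩) *ₗ r +ᴹ p x   ≈⟨ +ᴹ-cong (*ₗ-cong (cong (c *_) (trans (⟨⟩-cong ≈ᴹ-refl (≈ᴹ-sym px≈x)) (⟨r,p⟩≡0 x))) ≈ᴹ-refl) px≈x ⟩
        (c * 0ℚ) *ₗ r +ᴹ x            ≈⟨ +ᴹ-cong (≈ᴹ-trans (*ₗ-cong (ℚ.*-zeroʳ c) ≈ᴹ-refl) (*ₗ-zeroˡ r)) ≈ᴹ-refl ⟩
        0ᴹ +ᴹ x                       ≈⟨ +ᴹ-identityˡ x ⟩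
        x                             ∎

      fixed-y : M ⊢ p′ y ≈ y
      fixed-y = begin
        (c * ⟨ r , y ⟩) *ₗ r +ᴹ p y   ≈⟨ +ᴹ-cong (≈ᴹ-trans (*ₗ-cong (trans (cong (c *_) ⟨r,y⟩) (ℚ.*-inverseˡ ⟨ r , r ⟩)) ≈ᴹ-refl) (*ₗ-identityˡ r)) ≈ᴹ-refl ⟩
        r +ᴹ p y                      ≈⟨ y≈r+py ⟨
        y                             ∎
        where
        ⟨r,y⟩ : ⟨ r , y ⟩ ≡ ⟨ r , r ⟩
        ⟨r,y⟩ = trans (⟨⟩-cong ≈ᴹ-refl y≈r+py) (trans (+-homoʳ r r (p y))
          (trans (cong (⟨ r , r ⟩ +_) (⟨r,p⟩≡0 y)) (ℚ.+-identityʳ _)))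

-- Rational numbers

fromℚᵘ-homo-* : ∀ p q → fromℚᵘ (p ℚᵘ.* q) ≡ fromℚᵘ p * fromℚᵘ q
fromℚᵘ-homo-* p q = ℚ.toℚᵘ-injective (begin
  toℚᵘ (fromℚᵘ (p ℚᵘ.* q))                ≈⟨ ℚ.toℚᵘ-fromℚᵘ (p ℚᵘ.* q) ⟩
  p ℚᵘ.* q                                ≈⟨ ℚᵘ.*-cong (ℚ.toℚᵘ-fromℚᵘ p) (ℚ.toℚᵘ-fromℚᵘ q) ⟨
  toℚᵘ (fromℚᵘ p) ℚᵘ.* toℚᵘ (fromℚᵘ q)    ≈⟨ ℚ.toℚᵘ-homo-* (fromℚᵘ p) (fromℚᵘ q) ⟨
  toℚᵘ (fromℚᵘ p * fromℚᵘ q)              ∎)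
  where open ℚᵘ.≃-Reasoning

fromℚᵘ-homo-+ : ∀ p q → fromℚᵘ (p ℚᵘ.+ q) ≡ fromℚᵘ p + fromℚᵘ q
fromℚᵘ-homo-+ p q = ℚ.toℚᵘ-injective (begin
  toℚᵘ (fromℚᵘ (p ℚᵘ.+ q))                ≈⟨ ℚ.toℚᵘ-fromℚᵘ (p ℚᵘ.+ q) ⟩
  p ℚᵘ.+ q                                ≈⟨ ℚᵘ.+-cong (ℚ.toℚᵘ-fromℚᵘ p) (ℚ.toℚᵘ-fromℚᵘ q) ⟨
  toℚᵘ (fromℚᵘ p) ℚᵘ.+ toℚᵘ (fromℚᵘ q)    ≈⟨ ℚ.toℚᵘ-homo-+ (fromℚᵘ p) (fromℚᵘ q) ⟨
  toℚᵘ (fromℚᵘ p + fromℚᵘ q)              ∎)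
  where open ℚᵘ.≃-Reasoning

fromℕ : ℕ → ℚ
fromℕ n = (ℤ.+ n) / 1

fromℕ-suc : ∀ n → fromℕ (suc n) ≡ 1ℚ + fromℕ n
fromℕ-suc n = trans (ℚ.fromℚᵘ-cong {ℚᵘ.mkℚᵘ (ℤ.+ suc n) 0} {ℚᵘ.mkℚᵘ (ℤ.+ 1) 0 ℚᵘ.+ ℚᵘ.mkℚᵘ (ℤ.+ n) 0}
  (ℚᵘ.*≡* (cong (ℤ._* ℤ.+ 1) (cong (λ k → ℤ.+ 1 ℤ.+ k) (sym (ℤ.*-identityʳ (ℤ.+ n)))))))
  (fromℚᵘ-homo-+ (ℚᵘ.mkℚᵘ (ℤ.+ 1) 0) (ℚᵘ.mkℚᵘ (ℤ.+ n) 0))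

-- Spelt as in `∫ᴱ*`, so that `exp (∫ᴱ e)` and `∫ᴱ* e` agree by definition.
inverseFactorial : ℕ → ℚ
inverseFactorial n = ((ℤ.+ 1) / (n !)) {{n !≢0}}

private
  *-unitFraction : ∀ n d .{{_ : ℕ.NonZero d}} .{{_ : ℕ.NonZero (suc n ℕ.* d)}} →
    fromℕ (suc n) * ((ℤ.+ 1) / (suc n ℕ.* d)) ≡ (ℤ.+ 1) / d
  *-unitFraction n (suc d) = trans
    (sym (fromℚᵘ-homo-* (ℚᵘ.mkℚᵘ (ℤ.+ suc n) 0) (ℚᵘ.mkℚᵘ (ℤ.+ 1) (d ℕ.+ n ℕ.* suc d))))
    (ℚ.fromℚᵘ-cong {ℚᵘ.mkℚᵘ (ℤ.+ suc n) 0 ℚᵘ.* ℚᵘ.mkℚᵘ (ℤ.+ 1) (d ℕ.+ n ℕ.* suc d)} {ℚᵘ.mkℚᵘ (ℤ.+ 1) d}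
      (ℚᵘ.*≡* (cong ℤ.+_ eq)))
    where
    eq : suc n ℕ.* 1 ℕ.* suc d ≡ 1 ℕ.* (1 ℕ.* (suc n ℕ.* suc d))
    eq = trans (cong (ℕ._* suc d) (ℕ.*-identityʳ (suc n)))
      (sym (trans (ℕ.*-identityˡ _) (ℕ.*-identityˡ _)))

fromℕ-*-inverseFactorial : ∀ n → fromℕ (suc n) * inverseFactorial (suc n) ≡ inverseFactorial n
fromℕ-*-inverseFactorial n = *-unitFraction n (n !) {{n !≢0}} {{suc n !≢0}}

fromℕ-suc-cancel : ∀ n p → fromℕ (suc n) * p ≡ 0ℚ → p ≡ 0ℚ
fromℕ-suc-cancel n p eq = begin
  p                                    ≡⟨ ℚ.*-identityˡ p ⟨
  1ℚ * p                               ≡⟨ cong (_* p) (ℚ.*-inverseˡ (fromℕ (suc n))) ⟨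
  (1/ fromℕ (suc n)) * fromℕ (suc n) * p   ≡⟨ ℚ.*-assoc (1/ fromℕ (suc n)) _ p ⟩
  (1/ fromℕ (suc n)) * (fromℕ (suc n) * p) ≡⟨ cong ((1/ fromℕ (suc n)) *_) eq ⟩
  (1/ fromℕ (suc n)) * 0ℚ              ≡⟨ ℚ.*-zeroʳ (1/ fromℕ (suc n)) ⟩
  0ℚ                                   ∎
  where
  open ≡-Reasoning
  instance _ = ℚ.pos⇒nonZero (fromℕ (suc n)) {{ℚ.normalize-pos (suc n) 1}}

-- Noncommutative power series: f stands for the series with coefficient f w at the word w.

module _ {A : Set} where

  infixl 7 _⊛_

  -- The Cauchy product by recursion on the word: the cut comes before the first letter or after it,
  -- and `f ∘ (a ∷_)` is the left derivative of `f` at `a`.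
  _⊛_ : (List A → ℚ) → (List A → ℚ) → List A → ℚ
  (f ⊛ g) []       = f [] * g []
  (f ⊛ g) (a ∷ as) = f [] * g (a ∷ as) + ((f ∘ (a ∷_)) ⊛ g) as

  unit : List A → ℚ
  unit []      = 1ℚ
  unit (_ ∷ _) = 0ℚ

  -- Recognises the sum that defines `∫ᴾ` on a step as a product of series. The path travelled first
  -- takes the first letters, so its series `f` is the left factor.
  ⊛-splits : ∀ f g as → ∑[ i < suc (length as) ] (g (drop (toℕ i) as) * f (take (toℕ i) as)) ≡ (f ⊛ g) as
  ⊛-splits f g []       = trans (ℚ.+-identityʳ _) (ℚ.*-comm (g []) (f []))
  ⊛-splits f g (a ∷ as) = cong₂ _+_ (ℚ.*-comm (g (a ∷ as)) (f [])) (⊛-splits (f ∘ (a ∷_)) g as)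

  ⊛-cong : ∀ {f f′ g g′ : List A → ℚ} → f ≗ f′ → g ≗ g′ → f ⊛ g ≗ f′ ⊛ g′
  ⊛-cong p q []       = cong₂ _*_ (p []) (q [])
  ⊛-cong p q (a ∷ as) = cong₂ _+_ (cong₂ _*_ (p []) (q (a ∷ as))) (⊛-cong (p ∘ (a ∷_)) q as)

  ⊛-congˡ : ∀ {f f′ : List A → ℚ} g → f ≗ f′ → f ⊛ g ≗ f′ ⊛ g
  ⊛-congˡ {f} {f′} g p = ⊛-cong {f} {f′} {g} p (λ _ → refl)

  ⊛-congʳ : ∀ (f : List A → ℚ) {g g′} → g ≗ g′ → f ⊛ g ≗ f ⊛ g′
  ⊛-congʳ f {g} {g′} q = ⊛-cong {f} {f} {g} {g′} (λ _ → refl) q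

  ⊛-+ˡ : ∀ (f f′ g : List A → ℚ) as → ((λ w → f w + f′ w) ⊛ g) as ≡ (f ⊛ g) as + (f′ ⊛ g) as
  ⊛-+ˡ f f′ g []       = ℚ.*-distribʳ-+ (g []) (f []) (f′ [])
  ⊛-+ˡ f f′ g (a ∷ as) = trans (cong ((f [] + f′ []) * g (a ∷ as) +_) (⊛-+ˡ (f ∘ (a ∷_)) (f′ ∘ (a ∷_)) g as))
    (solve 5 (λ p q r s t → (p :+ q) :* r :+ (s :+ t) := (p :* r :+ s) :+ (q :* r :+ t)) refl
      (f []) (f′ []) (g (a ∷ as)) (((f ∘ (a ∷_)) ⊛ g) as) (((f′ ∘ (a ∷_)) ⊛ g) as))

  ⊛-*ˡ : ∀ c (f g : List A → ℚ) as → ((λ w → c * f w) ⊛ g) as ≡ c * (f ⊛ g) as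
  ⊛-*ˡ c f g []       = ℚ.*-assoc c (f []) (g [])
  ⊛-*ˡ c f g (a ∷ as) = trans (cong (c * f [] * g (a ∷ as) +_) (⊛-*ˡ c (f ∘ (a ∷_)) g as))
    (solve 4 (λ p q r s → p :* q :* r :+ p :* s := p :* (q :* r :+ s)) refl
      c (f []) (g (a ∷ as)) (((f ∘ (a ∷_)) ⊛ g) as))

  ⊛-0ˡ : ∀ {f : List A → ℚ} g → (∀ w → f w ≡ 0ℚ) → ∀ as → (f ⊛ g) as ≡ 0ℚ
  ⊛-0ˡ g p []       = trans (cong (_* g []) (p [])) (ℚ.*-zeroˡ (g []))
  ⊛-0ˡ g p (a ∷ as) = cong₂ _+_ (trans (cong (_* g (a ∷ as)) (p [])) (ℚ.*-zeroˡ (g (a ∷ as)))) (⊛-0ˡ g (p ∘ (a ∷_)) as)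

  ⊛-+ʳ : ∀ (f g g′ : List A → ℚ) as → (f ⊛ (λ w → g w + g′ w)) as ≡ (f ⊛ g) as + (f ⊛ g′) as
  ⊛-+ʳ f g g′ []       = ℚ.*-distribˡ-+ (f []) (g []) (g′ [])
  ⊛-+ʳ f g g′ (a ∷ as) = trans (cong (f [] * (g (a ∷ as) + g′ (a ∷ as)) +_) (⊛-+ʳ (f ∘ (a ∷_)) g g′ as))
    (solve 5 (λ p q r s t → p :* (q :+ r) :+ (s :+ t) := (p :* q :+ s) :+ (p :* r :+ t)) refl
      (f []) (g (a ∷ as)) (g′ (a ∷ as)) (((f ∘ (a ∷_)) ⊛ g) as) (((f ∘ (a ∷_)) ⊛ g′) as))

  ⊛-*ʳ : ∀ c (f g : List A → ℚ) as → (f ⊛ (λ w → c * g w)) as ≡ c * (f ⊛ g) as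
  ⊛-*ʳ c f g []       = solve 3 (λ p q r → q :* (p :* r) := p :* (q :* r)) refl c (f []) (g [])
  ⊛-*ʳ c f g (a ∷ as) = trans (cong (f [] * (c * g (a ∷ as)) +_) (⊛-*ʳ c (f ∘ (a ∷_)) g as))
    (solve 4 (λ p q r s → q :* (p :* r) :+ p :* s := p :* (q :* r :+ s)) refl
      c (f []) (g (a ∷ as)) (((f ∘ (a ∷_)) ⊛ g) as))

  ⊛-0ʳ : ∀ (f : List A → ℚ) {g} → (∀ w → g w ≡ 0ℚ) → ∀ as → (f ⊛ g) as ≡ 0ℚ
  ⊛-0ʳ f p []       = trans (cong (f [] *_) (p [])) (ℚ.*-zeroʳ (f []))
  ⊛-0ʳ f p (a ∷ as) = cong₂ _+_ (trans (cong (f [] *_) (p (a ∷ as))) (ℚ.*-zeroʳ (f []))) (⊛-0ʳ (f ∘ (a ∷_)) p as)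

  ⊛-identityˡ : ∀ (f : List A → ℚ) → unit ⊛ f ≗ f
  ⊛-identityˡ f []       = ℚ.*-identityˡ (f [])
  ⊛-identityˡ f (a ∷ as) = trans (cong₂ _+_ (ℚ.*-identityˡ (f (a ∷ as))) (⊛-0ˡ f (λ _ → refl) as)) (ℚ.+-identityʳ _)

  ⊛-identityʳ : ∀ (f : List A → ℚ) → f ⊛ unit ≗ f
  ⊛-identityʳ f []       = ℚ.*-identityʳ (f [])
  ⊛-identityʳ f (a ∷ as) = trans (cong₂ _+_ (ℚ.*-zeroʳ (f [])) (⊛-identityʳ (f ∘ (a ∷_)) as)) (ℚ.+-identityˡ _)

  ⊛-assoc : ∀ (f g h : List A → ℚ) → (f ⊛ g) ⊛ h ≗ f ⊛ (g ⊛ h)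
  ⊛-assoc f g h []       = ℚ.*-assoc (f []) (g []) (h [])
  ⊛-assoc f g h (a ∷ as) = begin
    f [] * g [] * h (a ∷ as) + ((λ w → f [] * g (a ∷ w) + (f′ ⊛ g) w) ⊛ h) as
      ≡⟨ cong (f [] * g [] * h (a ∷ as) +_) (⊛-+ˡ (λ w → f [] * g (a ∷ w)) (f′ ⊛ g) h as) ⟩
    f [] * g [] * h (a ∷ as) + (((λ w → f [] * g (a ∷ w)) ⊛ h) as + ((f′ ⊛ g) ⊛ h) as)
      ≡⟨ cong (f [] * g [] * h (a ∷ as) +_) (cong₂ _+_ (⊛-*ˡ (f []) g′ h as) (⊛-assoc f′ g h as)) ⟩
    f [] * g [] * h (a ∷ as) + (f [] * (g′ ⊛ h) as + (f′ ⊛ (g ⊛ h)) as)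
      ≡⟨ solve 5 (λ p q r s t → p :* q :* r :+ (p :* s :+ t) := p :* (q :* r :+ s) :+ t) refl
           (f []) (g []) (h (a ∷ as)) ((g′ ⊛ h) as) ((f′ ⊛ (g ⊛ h)) as) ⟩
    f [] * (g [] * h (a ∷ as) + (g′ ⊛ h) as) + (f′ ⊛ (g ⊛ h)) as ∎
    where
    open ≡-Reasoning
    f′ = f ∘ (a ∷_)
    g′ = g ∘ (a ∷_)

  -- The Euler derivation of the grading. Over ℚ its kernel consists of the constant series.
  degree : (List A → ℚ) → List A → ℚ
  degree f w = fromℕ (length w) * f w

  private
    degree-∷ : ∀ f a w → degree f (a ∷ w) ≡ f (a ∷ w) + degree (f ∘ (a ∷_)) w
    degree-∷ f a w = trans (cong (_* f (a ∷ w)) (fromℕ-suc (length w)))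
      (solve 2 (λ p q → (con 1ℚ :+ p) :* q := q :+ p :* q) refl (fromℕ (length w)) (f (a ∷ w)))

  -- At each cut the lengths of the two pieces add up to the length of the word.
  degree-⊛ : ∀ f g as → degree (f ⊛ g) as ≡ (degree f ⊛ g) as + (f ⊛ degree g) as
  degree-⊛ f g []       = solve 2 (λ p q → con 0ℚ :* (p :* q) := con 0ℚ :* p :* q :+ p :* (con 0ℚ :* q)) refl (f []) (g [])
  degree-⊛ f g (a ∷ as) = begin
    fromℕ (suc (length as)) * (f [] * g (a ∷ as) + (f′ ⊛ g) as)
      ≡⟨ cong (_* (f [] * g (a ∷ as) + (f′ ⊛ g) as)) (fromℕ-suc (length as)) ⟩
    (1ℚ + fromℕ (length as)) * (f [] * g (a ∷ as) + (f′ ⊛ g) as)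
      ≡⟨ solve 4 (λ n p q r → (con 1ℚ :+ n) :* (p :* q :+ r) := p :* ((con 1ℚ :+ n) :* q) :+ (r :+ n :* r)) refl
           (fromℕ (length as)) (f []) (g (a ∷ as)) ((f′ ⊛ g) as) ⟩
    f [] * ((1ℚ + fromℕ (length as)) * g (a ∷ as)) + ((f′ ⊛ g) as + degree (f′ ⊛ g) as)
      ≡⟨ cong₂ _+_ (cong (λ n → f [] * (n * g (a ∷ as))) (sym (fromℕ-suc (length as))))
                   (cong ((f′ ⊛ g) as +_) (degree-⊛ f′ g as)) ⟩
    f [] * degree g (a ∷ as) + ((f′ ⊛ g) as + ((degree f′ ⊛ g) as + (f′ ⊛ degree g) as))
      ≡⟨ solve 6 (λ u v x y z w → x :+ (y :+ (z :+ w)) := con 0ℚ :* u :* v :+ (y :+ z) :+ (x :+ w)) refl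
           (f []) (g (a ∷ as)) (f [] * degree g (a ∷ as)) ((f′ ⊛ g) as) ((degree f′ ⊛ g) as) ((f′ ⊛ degree g) as) ⟩
    0ℚ * f [] * g (a ∷ as) + ((f′ ⊛ g) as + (degree f′ ⊛ g) as) + (f ⊛ degree g) (a ∷ as)
      ≡⟨ cong (λ x → 0ℚ * f [] * g (a ∷ as) + x + (f ⊛ degree g) (a ∷ as))
           (trans (sym (⊛-+ˡ f′ (degree f′) g as)) (⊛-congˡ g (λ w → sym (degree-∷ f a w)) as)) ⟩
    (degree f ⊛ g) (a ∷ as) + (f ⊛ degree g) (a ∷ as) ∎
    where
    open ≡-Reasoning
    f′ = f ∘ (a ∷_)

  linear : (A → ℚ) → List A → ℚ
  linear x []          = 0ℚ
  linear x (a ∷ [])    = x a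
  linear x (_ ∷ _ ∷ _) = 0ℚ

  exp : (A → ℚ) → List A → ℚ
  exp x w = inverseFactorial (length w) * productℚ (map x w)

  private
    linear-∷ : ∀ x a → linear x ∘ (a ∷_) ≗ (λ w → x a * unit w)
    linear-∷ x a []      = sym (ℚ.*-identityʳ (x a))
    linear-∷ x a (_ ∷ _) = sym (ℚ.*-zeroʳ (x a))

    degree-exp-∷ : ∀ x a as → degree (exp x) (a ∷ as) ≡ x a * exp x as
    degree-exp-∷ x a as = begin
      fromℕ (suc n) * (inverseFactorial (suc n) * (x a * P))
        ≡⟨ solve 4 (λ p q r s → p :* (q :* (r :* s)) := p :* q :* (r :* s)) refl
             (fromℕ (suc n)) (inverseFactorial (suc n)) (x a) P ⟩
      fromℕ (suc n) * inverseFactorial (suc n) * (x a * P)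
        ≡⟨ cong (_* (x a * P)) (fromℕ-*-inverseFactorial n) ⟩
      inverseFactorial n * (x a * P)
        ≡⟨ solve 3 (λ p q r → p :* (q :* r) := q :* (p :* r)) refl (inverseFactorial n) (x a) P ⟩
      x a * (inverseFactorial n * P) ∎
      where
      open ≡-Reasoning
      n = length as
      P = productℚ (map x as)

  -- The differential equation of the exponential. The version with `linear x` on the right is
  -- wanted as well: in `exp x ⊛ exp y` the derivatives of both factors must leave their linear
  -- terms in the middle, where they cancel.
  degree-expˡ : ∀ x → degree (exp x) ≗ linear x ⊛ exp x
  degree-expˡ x []       = solve 1 (λ p → con 0ℚ :* p := con 0ℚ :* p) refl (exp x [])
  degree-expˡ x (a ∷ as) = begin
    degree (exp x) (a ∷ as)                               ≡⟨ degree-exp-∷ x a as ⟩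
    x a * exp x as                                        ≡⟨ cong (x a *_) (⊛-identityˡ (exp x) as) ⟨
    x a * (unit ⊛ exp x) as                               ≡⟨ ⊛-*ˡ (x a) unit (exp x) as ⟨
    ((λ w → x a * unit w) ⊛ exp x) as                     ≡⟨ ⊛-congˡ (exp x) (λ w → sym (linear-∷ x a w)) as ⟩
    ((linear x ∘ (a ∷_)) ⊛ exp x) as                      ≡⟨ solve 2 (λ p q → p := con 0ℚ :* q :+ p) refl _ (exp x (a ∷ as)) ⟩
    (linear x ⊛ exp x) (a ∷ as)                           ∎
    where open ≡-Reasoning

  private
    -- The induction for exp x ⊛ linear x needs arbitrary coefficients in place of the inverse factorials.
    weighted : (ℕ → ℚ) → (A → ℚ) → List A → ℚ
    weighted c x w = c (length w) * productℚ (map x w)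

    weighted-⊛-linear : ∀ c x a as →
      (weighted c x ⊛ linear x) (a ∷ as) ≡ c (length as) * productℚ (map x (a ∷ as))
    weighted-⊛-linear c x a []        =
      solve 3 (λ p q r → p :* con 1ℚ :* q :+ r :* con 0ℚ := p :* (q :* con 1ℚ)) refl (c 0) (x a) (weighted c x (a ∷ []))
    weighted-⊛-linear c x a (a′ ∷ as) = begin
      c 0 * 1ℚ * 0ℚ + ((weighted c x ∘ (a ∷_)) ⊛ linear x) (a′ ∷ as)
        ≡⟨ cong (c 0 * 1ℚ * 0ℚ +_) (⊛-congˡ (linear x) (λ w → solve 3 (λ p q r → p :* (q :* r) := q :* (p :* r)) refl
             (c (suc (length w))) (x a) (productℚ (map x w))) (a′ ∷ as)) ⟩
      c 0 * 1ℚ * 0ℚ + ((λ w → x a * weighted (c ∘ suc) x w) ⊛ linear x) (a′ ∷ as)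
        ≡⟨ cong (c 0 * 1ℚ * 0ℚ +_) (trans (⊛-*ˡ (x a) (weighted (c ∘ suc) x) (linear x) (a′ ∷ as))
             (cong (x a *_) (weighted-⊛-linear (c ∘ suc) x a′ as))) ⟩
      c 0 * 1ℚ * 0ℚ + x a * (c (suc (length as)) * productℚ (map x (a′ ∷ as)))
        ≡⟨ solve 4 (λ p q r s → p :* con 1ℚ :* con 0ℚ :+ q :* (r :* s) := r :* (q :* s)) refl
             (c 0) (x a) (c (suc (length as))) (productℚ (map x (a′ ∷ as))) ⟩
      c (suc (length as)) * (x a * productℚ (map x (a′ ∷ as))) ∎
      where open ≡-Reasoning

  degree-expʳ : ∀ x → degree (exp x) ≗ exp x ⊛ linear x
  degree-expʳ x []       = solve 1 (λ p → con 0ℚ :* p := p :* con 0ℚ) refl (exp x [])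
  degree-expʳ x (a ∷ as) = begin
    degree (exp x) (a ∷ as)                                     ≡⟨ degree-exp-∷ x a as ⟩
    x a * (inverseFactorial (length as) * productℚ (map x as))  ≡⟨ solve 3 (λ p q r → q :* (p :* r) := p :* (q :* r)) refl
                                                                     (inverseFactorial (length as)) (x a) (productℚ (map x as)) ⟩
    inverseFactorial (length as) * (x a * productℚ (map x as))  ≡⟨ weighted-⊛-linear inverseFactorial x a as ⟨
    (exp x ⊛ linear x) (a ∷ as)                                 ∎
    where open ≡-Reasoning

  -- The degree operator is a derivation killing exp x ⊛ exp (- x), which is therefore constant.
  exp-inverse : ∀ x y → (∀ a → y a ≡ - x a) → exp x ⊛ exp y ≗ unit
  exp-inverse x y y≡-x []       = refl
  exp-inverse x y y≡-x (a ∷ as) = fromℕ-suc-cancel (length as) _ (begin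
    degree (exp x ⊛ exp y) (a ∷ as)
      ≡⟨ degree-⊛ (exp x) (exp y) (a ∷ as) ⟩
    (degree (exp x) ⊛ exp y) (a ∷ as) + (exp x ⊛ degree (exp y)) (a ∷ as)
      ≡⟨ cong₂ _+_ (trans (⊛-congˡ (exp y) (degree-expʳ x) (a ∷ as)) (⊛-assoc (exp x) (linear x) (exp y) (a ∷ as)))
                   (⊛-congʳ (exp x) (degree-expˡ y) (a ∷ as)) ⟩
    (exp x ⊛ (linear x ⊛ exp y)) (a ∷ as) + (exp x ⊛ (linear y ⊛ exp y)) (a ∷ as)
      ≡⟨ ⊛-+ʳ (exp x) (linear x ⊛ exp y) (linear y ⊛ exp y) (a ∷ as) ⟨
    (exp x ⊛ (λ w → (linear x ⊛ exp y) w + (linear y ⊛ exp y) w)) (a ∷ as)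
      ≡⟨ ⊛-0ʳ (exp x) (λ w → trans (sym (⊛-+ˡ (linear x) (linear y) (exp y) w)) (⊛-0ˡ (exp y) cancel w)) (a ∷ as) ⟩
    0ℚ ∎)
    where
    open ≡-Reasoning
    cancel : ∀ w → linear x w + linear y w ≡ 0ℚ
    cancel []          = refl
    cancel (b ∷ [])    = trans (cong (x b +_) (y≡-x b)) (ℚ.+-inverseʳ (x b))
    cancel (_ ∷ _ ∷ _) = refl

  HasOrder : ℕ → (List A → ℚ) → Set
  HasOrder k f = ∀ w → length w < k → f w ≡ 0ℚ

  HasOrder-⊛ʳ : ∀ {k g} f → HasOrder k g → HasOrder k (f ⊛ g)
  HasOrder-⊛ʳ f ord []       l = trans (cong (f [] *_) (ord [] l)) (ℚ.*-zeroʳ (f []))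
  HasOrder-⊛ʳ f ord (a ∷ as) l = cong₂ _+_ (trans (cong (f [] *_) (ord (a ∷ as) l)) (ℚ.*-zeroʳ (f [])))
    (HasOrder-⊛ʳ (f ∘ (a ∷_)) ord as (ℕ.<-trans (ℕ.n<1+n _) l))

  leading-⊛ʳ : ∀ {k g} f → HasOrder k g → ∀ w → length w ≡ k → (f ⊛ g) w ≡ f [] * g w
  leading-⊛ʳ f ord []       eq   = refl
  leading-⊛ʳ {g = g} f ord (a ∷ as) refl = trans
    (cong (f [] * g (a ∷ as) +_) (HasOrder-⊛ʳ (f ∘ (a ∷_)) ord as (ℕ.n<1+n _))) (ℚ.+-identityʳ _)

  HasOrder-⊛ˡ : ∀ {k f} g → HasOrder k f → HasOrder k (f ⊛ g)
  HasOrder-⊛ˡ g ord []       l = trans (cong (_* g []) (ord [] l)) (ℚ.*-zeroˡ (g []))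
  HasOrder-⊛ˡ {suc k} g ord (a ∷ as) (s≤s l) = cong₂ _+_
    (trans (cong (_* g (a ∷ as)) (ord [] (s≤s z≤n))) (ℚ.*-zeroˡ (g (a ∷ as))))
    (HasOrder-⊛ˡ g (λ w l → ord (a ∷ w) (s≤s l)) as l)

  leading-⊛ˡ : ∀ {k f} g → HasOrder k f → ∀ w → length w ≡ k → (f ⊛ g) w ≡ f w * g []
  leading-⊛ˡ g ord []       eq   = refl
  leading-⊛ˡ {f = f} g ord (a ∷ as) refl = trans
    (cong₂ _+_ (trans (cong (_* g (a ∷ as)) (ord [] (s≤s z≤n))) (ℚ.*-zeroˡ (g (a ∷ as))))
               (leading-⊛ˡ g (λ w l → ord (a ∷ w) (s≤s l)) as refl))
    (ℚ.+-identityˡ _)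

  HasOrder-suc : ∀ {k f g} → f [] ≡ 0ℚ → HasOrder k g → HasOrder (suc k) (f ⊛ g)
  HasOrder-suc {g = g} f0 ord []       l       = trans (cong (_* g []) f0) (ℚ.*-zeroˡ (g []))
  HasOrder-suc {f = f} {g = g} f0 ord (a ∷ as) (s≤s l) = cong₂ _+_
    (trans (cong (_* g (a ∷ as)) f0) (ℚ.*-zeroˡ (g (a ∷ as)))) (HasOrder-⊛ʳ (f ∘ (a ∷_)) ord as l)

  -- Only the cut after the first letter survives: the empty prefix meets `f [] ≡ 0ℚ`, and a longer
  -- prefix leaves `g` a word of length below its order.
  leading-suc : ∀ {k f g} → f [] ≡ 0ℚ → HasOrder k g → ∀ a w → length w ≡ k →
    (f ⊛ g) (a ∷ w) ≡ f (a ∷ []) * g w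
  leading-suc {f = f} {g = g} f0 ord a w eq = trans
    (cong₂ _+_ (trans (cong (_* g (a ∷ w)) f0) (ℚ.*-zeroˡ (g (a ∷ w)))) (leading-⊛ʳ (f ∘ (a ∷_)) ord w eq))
    (ℚ.+-identityˡ _)

-- Multilinear series

-- Series live on lists, which can be cut without tracking lengths, while the relations of
-- `TensorPower` concern vectors; `toList` mediates.
record IsMultilinear (M : VectorSpace) (f : List ∣ M ∣ → ℚ) : Set where
  open LeftModule M
  field
    vec-cong : ∀ {m} {xs ys : Vec ∣ M ∣ m} → Pointwise _≈ᴹ_ xs ys → f (toList xs) ≡ f (toList ys)
    vec-+    : ∀ {m} (xs : Vec ∣ M ∣ m) i y z →
      f (toList (xs [ i ]≔ (y +ᴹ z))) ≡ f (toList (xs [ i ]≔ y)) + f (toList (xs [ i ]≔ z))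
    vec-*    : ∀ {m} (xs : Vec ∣ M ∣ m) i a y →
      f (toList (xs [ i ]≔ (a *ₗ y))) ≡ a * f (toList (xs [ i ]≔ y))

  respects : ∀ {m x y} → Multilinear M m x y → extend ℚ¹ (f ∘ toList) x ≡ extend ℚ¹ (f ∘ toList) y
  respects (pointwise eqs)     = vec-cong eqs
  respects (additive xs i y z) = vec-+ xs i y z
  respects (scalar xs i a y)   = vec-* xs i a y

module _ (M : VectorSpace) where
  open LeftModule M
  open IsMultilinear

  IsMultilinear-cong : ∀ {f g} → f ≗ g → IsMultilinear M g → IsMultilinear M f
  IsMultilinear-cong eq gm = record
    { vec-cong = λ eqs → trans (eq _) (trans (vec-cong gm eqs) (sym (eq _)))
    ; vec-+    = λ xs i y z → trans (eq _) (trans (vec-+ gm xs i y z) (cong₂ _+_ (sym (eq _)) (sym (eq _))))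
    ; vec-*    = λ xs i a y → trans (eq _) (trans (vec-* gm xs i a y) (cong (a *_) (sym (eq _))))
    }

  private
    tail-isMultilinear : ∀ {f} → IsMultilinear M f → ∀ x → IsMultilinear M (f ∘ (x ∷_))
    tail-isMultilinear fm x = record
      { vec-cong = λ eqs → vec-cong fm (≈ᴹ-refl ∷ eqs)
      ; vec-+    = λ xs i → vec-+ fm (x ∷ xs) (suc i)
      ; vec-*    = λ xs i → vec-* fm (x ∷ xs) (suc i)
      }

    head-+ : ∀ {f} → IsMultilinear M f → ∀ y z w → f (y +ᴹ z ∷ w) ≡ f (y ∷ w) + f (z ∷ w)
    head-+ {f} fm y z w = subst (λ w → f (y +ᴹ z ∷ w) ≡ f (y ∷ w) + f (z ∷ w)) (toList∘fromList w)
      (vec-+ fm (y ∷ fromList w) zero y z)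

    head-* : ∀ {f} → IsMultilinear M f → ∀ a y w → f (a *ₗ y ∷ w) ≡ a * f (y ∷ w)
    head-* {f} fm a y w = subst (λ w → f (a *ₗ y ∷ w) ≡ a * f (y ∷ w)) (toList∘fromList w)
      (vec-* fm (y ∷ fromList w) zero a y)

    -- Two series `f` and `f′` are needed for the induction: past the first letter the left factors
    -- are derivatives at letters that are only `≈ᴹ`-equal.
    ⊛-vec-cong : ∀ {f f′ g} → IsMultilinear M g →
      (∀ {m} {xs ys : Vec ∣ M ∣ m} → Pointwise _≈ᴹ_ xs ys → f (toList xs) ≡ f′ (toList ys)) →
      ∀ {m} {xs ys : Vec ∣ M ∣ m} → Pointwise _≈ᴹ_ xs ys → (f ⊛ g) (toList xs) ≡ (f′ ⊛ g) (toList ys)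
    ⊛-vec-cong {g = g} gm f≈f′ []         = cong (_* g []) (f≈f′ [])
    ⊛-vec-cong gm f≈f′ (eq ∷ eqs) = cong₂ _+_ (cong₂ _*_ (f≈f′ []) (vec-cong gm (eq ∷ eqs)))
      (⊛-vec-cong gm (λ eqs′ → f≈f′ (eq ∷ eqs′)) eqs)

    ⊛-vec-+ : ∀ {f g} → IsMultilinear M f → IsMultilinear M g → ∀ {m} (xs : Vec ∣ M ∣ m) i y z →
      (f ⊛ g) (toList (xs [ i ]≔ (y +ᴹ z))) ≡ (f ⊛ g) (toList (xs [ i ]≔ y)) + (f ⊛ g) (toList (xs [ i ]≔ z))
    ⊛-vec-+ {f} {g} fm gm (x ∷ xs) zero y z = trans
      (cong₂ _+_ (cong (f [] *_) (vec-+ gm (x ∷ xs) zero y z))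
        (trans (⊛-congˡ g (head-+ fm y z) w) (⊛-+ˡ (f ∘ (y ∷_)) (f ∘ (z ∷_)) g w)))
      (solve 5 (λ p q r s t → p :* (q :+ r) :+ (s :+ t) := (p :* q :+ s) :+ (p :* r :+ t)) refl
        (f []) (g (y ∷ w)) (g (z ∷ w)) (((f ∘ (y ∷_)) ⊛ g) w) (((f ∘ (z ∷_)) ⊛ g) w))
      where w = toList xs
    ⊛-vec-+ {f} {g} fm gm (x ∷ xs) (suc i) y z = trans
      (cong₂ _+_ (cong (f [] *_) (vec-+ gm (x ∷ xs) (suc i) y z)) (⊛-vec-+ (tail-isMultilinear fm x) gm xs i y z))
      (solve 5 (λ p q r s t → p :* (q :+ r) :+ (s :+ t) := (p :* q :+ s) :+ (p :* r :+ t)) refl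
        (f []) (g (x ∷ u)) (g (x ∷ v)) (((f ∘ (x ∷_)) ⊛ g) u) (((f ∘ (x ∷_)) ⊛ g) v))
      where
      u = toList (xs [ i ]≔ y)
      v = toList (xs [ i ]≔ z)

    ⊛-vec-* : ∀ {f g} → IsMultilinear M f → IsMultilinear M g → ∀ {m} (xs : Vec ∣ M ∣ m) i a y →
      (f ⊛ g) (toList (xs [ i ]≔ (a *ₗ y))) ≡ a * (f ⊛ g) (toList (xs [ i ]≔ y))
    ⊛-vec-* {f} {g} fm gm (x ∷ xs) zero a y = trans
      (cong₂ _+_ (cong (f [] *_) (vec-* gm (x ∷ xs) zero a y))
        (trans (⊛-congˡ g (head-* fm a y) w) (⊛-*ˡ a (f ∘ (y ∷_)) g w)))
      (solve 4 (λ p q r s → p :* (q :* r) :+ q :* s := q :* (p :* r :+ s)) refl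
        (f []) a (g (y ∷ w)) (((f ∘ (y ∷_)) ⊛ g) w))
      where w = toList xs
    ⊛-vec-* {f} {g} fm gm (x ∷ xs) (suc i) a y = trans
      (cong₂ _+_ (cong (f [] *_) (vec-* gm (x ∷ xs) (suc i) a y)) (⊛-vec-* (tail-isMultilinear fm x) gm xs i a y))
      (solve 4 (λ p q r s → p :* (q :* r) :+ q :* s := q :* (p :* r :+ s)) refl
        (f []) a (g (x ∷ w)) (((f ∘ (x ∷_)) ⊛ g) w))
      where w = toList (xs [ i ]≔ y)

  ⊛-isMultilinear : ∀ {f g} → IsMultilinear M f → IsMultilinear M g → IsMultilinear M (f ⊛ g)
  ⊛-isMultilinear fm gm = record
    { vec-cong = ⊛-vec-cong gm (vec-cong fm)
    ; vec-+    = ⊛-vec-+ fm gm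
    ; vec-*    = ⊛-vec-* fm gm
    }

  unit-isMultilinear : IsMultilinear M unit
  unit-isMultilinear = record
    { vec-cong = λ { [] → refl ; (_ ∷ _) → refl }
    ; vec-+    = λ { (_ ∷ _) zero _ _ → refl ; (_ ∷ _) (suc _) _ _ → refl }
    ; vec-*    = λ { (_ ∷ _) zero a _ → sym (ℚ.*-zeroʳ a) ; (_ ∷ _) (suc _) a _ → sym (ℚ.*-zeroʳ a) }
    }

  private
    exp-evaluate : ∀ (x : ∣ Dual M ∣) {m} (xs : Vec ∣ M ∣ m) →
      exp ⟦ x ⟧ (toList xs) ≡ inverseFactorial m * evaluate (replicate m x) xs
    exp-evaluate x xs = cong₂ _*_ (cong inverseFactorial (length-toList xs)) (product xs)
      where
      product : ∀ {m} (xs : Vec ∣ M ∣ m) → productℚ (map ⟦ x ⟧ (toList xs)) ≡ evaluate (replicate m x) xs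
      product []       = refl
      product (y ∷ xs) = cong (⟦ x ⟧ y *_) (product xs)

  exp-isMultilinear : ∀ (x : ∣ Dual M ∣) → IsMultilinear M (exp ⟦ x ⟧)
  exp-isMultilinear x = record
    { vec-cong = λ {m} {xs} {ys} eqs → trans (exp-evaluate x xs)
        (trans (cong (inverseFactorial m *_) (evaluate-cong (replicate m x) eqs)) (sym (exp-evaluate x ys)))
    ; vec-+ = λ {m} xs i y z → trans (exp-evaluate x (xs [ i ]≔ _))
        (trans (cong (inverseFactorial m *_) (evaluate-+ (replicate m x) xs i y z))
        (trans (ℚ.*-distribˡ-+ (inverseFactorial m) _ _)
        (cong₂ _+_ (sym (exp-evaluate x (xs [ i ]≔ y))) (sym (exp-evaluate x (xs [ i ]≔ z))))))
    ; vec-* = λ {m} xs i a y → trans (exp-evaluate x (xs [ i ]≔ _))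
        (trans (cong (inverseFactorial m *_) (evaluate-* (replicate m x) xs i a y))
        (trans (solve 3 (λ p q r → p :* (q :* r) := q :* (p :* r)) refl (inverseFactorial m) a _)
        (cong (a *_) (sym (exp-evaluate x (xs [ i ]≔ y))))))
    }

-- The length pairing on edges

square-cases : ∀ t → t ≡ 0ℚ ⊎ Positive (t * t)
square-cases t@(mkℚ +0 _ _)       = inj₁ (ℚ.↥p≡0⇒p≡0 t refl)
square-cases t@(mkℚ +[1+ _ ] _ _) = inj₂ (ℚ.pos*pos⇒pos t t)
square-cases t@(mkℚ -[1+ _ ] _ _) = inj₂ (ℚ.neg*neg⇒pos t t)

module _ {I : Set} (c t : I → ℚ) (c-positive : ∀ i → Positive (c i)) where
  private
    summand : I → ℚ
    summand i = c i * (t i * t i)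

    summand-cases : ∀ i → t i ≡ 0ℚ ⊎ Positive (summand i)
    summand-cases i with square-cases (t i)
    ... | inj₁ eq  = inj₁ eq
    ... | inj₂ pos = inj₂ (ℚ.pos*pos⇒pos (c i) {{c-positive i}} (t i * t i) {{pos}})

    summand-0 : ∀ i → t i ≡ 0ℚ → summand i ≡ 0ℚ
    summand-0 i eq = trans (cong (λ s → c i * (s * s)) eq) (ℚ.*-zeroʳ (c i))

    sum-nonNegative : ∀ is → NonNegative (sumOver ℚ¹ is summand)
    sum-nonNegative []       = _
    sum-nonNegative (i ∷ is) with summand-cases i
    ... | inj₁ eq  = subst NonNegative (sym (trans (cong (_+ rest) (summand-0 i eq)) (ℚ.+-identityˡ rest))) (sum-nonNegative is)
      where rest = sumOver ℚ¹ is summand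
    ... | inj₂ pos = ℚ.nonNeg+nonNeg⇒nonNeg (summand i) {{ℚ.pos⇒nonNeg (summand i) {{pos}}}}
                       (sumOver ℚ¹ is summand) {{sum-nonNegative is}}

  sumOfSquares≡0 : ∀ is → sumOver ℚ¹ is (λ i → c i * (t i * t i)) ≡ 0ℚ → All (λ i → t i ≡ 0ℚ) is
  sumOfSquares≡0 []       eq = []
  sumOfSquares≡0 (i ∷ is) eq with summand-cases i
  ... | inj₁ t≡0 = t≡0 ∷ sumOfSquares≡0 is
          (trans (sym (trans (cong (_+ sumOver ℚ¹ is summand) (summand-0 i t≡0)) (ℚ.+-identityˡ (sumOver ℚ¹ is summand)))) eq)
  ... | inj₂ pos = contradiction (subst Positive eq
          (ℚ.pos+nonNeg⇒pos (summand i) {{pos}} (sumOver ℚ¹ is summand) {{sum-nonNegative is}})) λ ()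

module EdgeForm (Γ : MetrisedGraph) where
  open MetrisedGraphTheory Γ

  δ : E → E → ℚ
  δ e e′ with Finite._≟_ E-finite e e′
  ... | yes _ = 1ℚ
  ... | no  _ = 0ℚ

  δ-refl : ∀ e → δ e e ≡ 1ℚ
  δ-refl e with Finite._≟_ E-finite e e
  ... | yes _   = refl
  ... | no  e≢e = contradiction refl e≢e

  δ-≢ : ∀ {e e′} → e ≢ e′ → δ e e′ ≡ 0ℚ
  δ-≢ {e} {e′} e≢e′ with Finite._≟_ E-finite e e′
  ... | yes eq = contradiction eq e≢e′
  ... | no  _  = refl

  δ-cong : ∀ {e₁ e₁′ e₂ e₂′} → (e₁ ≡ e₁′ → e₂ ≡ e₂′) → (e₂ ≡ e₂′ → e₁ ≡ e₁′) → δ e₁ e₁′ ≡ δ e₂ e₂′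
  δ-cong {e₁} {e₁′} {e₂} {e₂′} f g with Finite._≟_ E-finite e₁ e₁′ | Finite._≟_ E-finite e₂ e₂′
  ... | yes _ | yes _ = refl
  ... | yes p | no ¬q = contradiction (f p) ¬q
  ... | no ¬p | yes q = contradiction (g q) ¬p
  ... | no _  | no _  = refl

  ⁻¹-swap : ∀ {e e′} → e ⁻¹ ≡ e′ → e ≡ e′ ⁻¹
  ⁻¹-swap {e} refl = sym (⁻¹-involutive e)

  δ-⁻¹ : ∀ e e′ → δ (e ⁻¹) e′ ≡ δ e (e′ ⁻¹)
  δ-⁻¹ e e′ = δ-cong ⁻¹-swap (λ eq → sym (⁻¹-swap (sym eq)))

  δ-⁻¹-⁻¹ : ∀ e e′ → δ (e ⁻¹) (e′ ⁻¹) ≡ δ e e′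
  δ-⁻¹-⁻¹ e e′ = trans (δ-⁻¹ e (e′ ⁻¹)) (cong (δ e) (⁻¹-involutive e′))

  -- The inversion has no fixed points, so the two positive cases exclude each other and the cascade
  -- of tests becomes a difference.
  ∫ᴱᴱ-δ : ∀ e e′ → ∫ᴱᴱ e e′ ≡ ℓ e * (δ e′ e + - δ e′ (e ⁻¹))
  ∫ᴱᴱ-δ e e′ with Finite._≟_ E-finite e′ e | Finite._≟_ E-finite e′ (e ⁻¹)
  ... | yes p | yes q = contradiction (trans (sym q) p) (⁻¹-fixedPointFree e)
  ... | yes _ | no  _ = sym (ℚ.*-identityʳ (ℓ e))
  ... | no  _ | yes _ = solve 1 (λ l → :- l := l :* (con 0ℚ :+ :- con 1ℚ)) refl (ℓ e)
  ... | no  _ | no  _ = sym (ℚ.*-zeroʳ (ℓ e))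

  private
    antisymmetry : ∀ l a b → l * (a + - b) ≡ - 1ℚ * (l * (b + - a))
    antisymmetry = solve 3 (λ l a b → l :* (a :+ :- b) := :- con 1ℚ :* (l :* (b :+ :- a))) refl

  ∫ᴱᴱ-⁻¹ˡ : ∀ e e′ → ∫ᴱᴱ (e ⁻¹) e′ ≡ - 1ℚ * ∫ᴱᴱ e e′
  ∫ᴱᴱ-⁻¹ˡ e e′ = begin
    ∫ᴱᴱ (e ⁻¹) e′                                   ≡⟨ ∫ᴱᴱ-δ (e ⁻¹) e′ ⟩
    ℓ (e ⁻¹) * (δ e′ (e ⁻¹) + - δ e′ ((e ⁻¹) ⁻¹))   ≡⟨ cong₂ (λ l f → l * (δ e′ (e ⁻¹) + - δ e′ f)) (ℓ-⁻¹ e) (⁻¹-involutive e) ⟩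
    ℓ e * (δ e′ (e ⁻¹) + - δ e′ e)                  ≡⟨ antisymmetry (ℓ e) (δ e′ (e ⁻¹)) (δ e′ e) ⟩
    - 1ℚ * (ℓ e * (δ e′ e + - δ e′ (e ⁻¹)))         ≡⟨ cong (- 1ℚ *_) (∫ᴱᴱ-δ e e′) ⟨
    - 1ℚ * ∫ᴱᴱ e e′                                 ∎
    where open ≡-Reasoning

  ∫ᴱᴱ-⁻¹ʳ : ∀ e e′ → ∫ᴱᴱ e (e′ ⁻¹) ≡ - 1ℚ * ∫ᴱᴱ e e′
  ∫ᴱᴱ-⁻¹ʳ e e′ = begin
    ∫ᴱᴱ e (e′ ⁻¹)                                   ≡⟨ ∫ᴱᴱ-δ e (e′ ⁻¹) ⟩
    ℓ e * (δ (e′ ⁻¹) e + - δ (e′ ⁻¹) (e ⁻¹))        ≡⟨ cong₂ (λ a b → ℓ e * (a + - b)) (δ-⁻¹ e′ e) (δ-⁻¹-⁻¹ e′ e) ⟩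
    ℓ e * (δ e′ (e ⁻¹) + - δ e′ e)                  ≡⟨ antisymmetry (ℓ e) (δ e′ (e ⁻¹)) (δ e′ e) ⟩
    - 1ℚ * (ℓ e * (δ e′ e + - δ e′ (e ⁻¹)))         ≡⟨ cong (- 1ℚ *_) (∫ᴱᴱ-δ e e′) ⟨
    - 1ℚ * ∫ᴱᴱ e e′                                 ∎
    where open ≡-Reasoning

  ∫ᴱᴱ-sym : ∀ e e′ → ∫ᴱᴱ e e′ ≡ ∫ᴱᴱ e′ e
  ∫ᴱᴱ-sym e e′ = begin
    ∫ᴱᴱ e e′                                   ≡⟨ ∫ᴱᴱ-δ e e′ ⟩
    ℓ e * (δ e′ e + - δ e′ (e ⁻¹))             ≡⟨ distrib (ℓ e) (δ e′ e) (δ e′ (e ⁻¹)) ⟩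
    ℓ e * δ e′ e + - (ℓ e * δ e′ (e ⁻¹))       ≡⟨ cong₂ (λ a b → a + - b) (ℓδ λ { refl → refl }) (ℓδ λ { refl → sym (ℓ-⁻¹ e) }) ⟩
    ℓ e′ * δ e′ e + - (ℓ e′ * δ e′ (e ⁻¹))     ≡⟨ cong₂ (λ a b → ℓ e′ * a + - (ℓ e′ * b)) (δ-cong sym sym)
                                                    (δ-cong (⁻¹-swap ∘ sym) (⁻¹-swap ∘ sym)) ⟩
    ℓ e′ * δ e e′ + - (ℓ e′ * δ e (e′ ⁻¹))     ≡⟨ distrib (ℓ e′) (δ e e′) (δ e (e′ ⁻¹)) ⟨
    ℓ e′ * (δ e e′ + - δ e (e′ ⁻¹))            ≡⟨ ∫ᴱᴱ-δ e′ e ⟨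
    ∫ᴱᴱ e′ e                                   ∎
    where
    open ≡-Reasoning
    distrib : ∀ l a b → l * (a + - b) ≡ l * a + - (l * b)
    distrib = solve 3 (λ l a b → l :* (a :+ :- b) := l :* a :+ :- (l :* b)) refl

    ℓδ : ∀ {f} → (e′ ≡ f → ℓ e ≡ ℓ e′) → ℓ e * δ e′ f ≡ ℓ e′ * δ e′ f
    ℓδ {f} eq with Finite._≟_ E-finite e′ f
    ... | yes p = cong (_* 1ℚ) (eq p)
    ... | no  _ = trans (ℚ.*-zeroʳ (ℓ e)) (sym (ℚ.*-zeroʳ (ℓ e′)))

  ⟨_,_⟩ : Term E → Term E → ℚ
  ⟨_,_⟩ = extend₂ ℚ¹ ∫ᴱᴱ

  ⟨⟩-isBilinear : IsBilinear ℚE± ℚE± ⟨_,_⟩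
  ⟨⟩-isBilinear = extend₂-isBilinear Antisymmetry Antisymmetry ∫ᴱᴱ
    (λ { e′ (inverse e) → ∫ᴱᴱ-⁻¹ˡ e e′ }) (λ { e (inverse e′) → ∫ᴱᴱ-⁻¹ʳ e e′ })

  ⟨⟩-symmetric : ∀ x y → ⟨ x , y ⟩ ≡ ⟨ y , x ⟩
  ⟨⟩-symmetric x y = trans (extend₂-swap ℚ¹ ∫ᴱᴱ x y)
    (extend-pointwise ℚ¹ (λ e′ → extend-pointwise ℚ¹ (λ e → ∫ᴱᴱ-sym e e′) x) y)

  edges : List E
  edges = tabulate (Inverse.from (Finite.index E-finite))

  sumOver-δ : ∀ (N : VectorSpace) e (f : E → ∣ N ∣) →
    N ⊢ sumOver N edges (λ e′ → LeftModule._*ₗ_ N (δ e e′) (f e′)) ≈ f e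
  sumOver-δ N e f = ≈ᴹ-trans (sumOver-single N from (λ e′ → δ e e′ *ₗ f e′) (to e) off)
    (subst (λ e′ → N ⊢ δ e e′ *ₗ f e′ ≈ f e) (sym (strictlyInverseʳ e))
      (≈ᴹ-trans (*ₗ-cong (δ-refl e) ≈ᴹ-refl) (*ₗ-identityˡ (f e))))
    where
    open LeftModule N
    open Inverse (Finite.index E-finite)
    off : ∀ j → j ≢ to e → N ⊢ δ e (from j) *ₗ f (from j) ≈ 0ᴹ
    off j j≢ = ≈ᴹ-trans (*ₗ-cong (δ-≢ λ e≡ → j≢ (trans (sym (strictlyInverseˡ j)) (cong to (sym e≡)))) ≈ᴹ-refl) (*ₗ-zeroˡ _)

  private
    -- The list `edges` contains each geometric edge in both orientations, and both contribute
    -- equally to an expansion; hence the half.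
    edgeWeight : E → ℚ
    edgeWeight e = ½ * (1/ ℓ e) {{ℚ.pos⇒nonZero (ℓ e) {{ℓ-positive e}}}}

    edgeWeight-positive : ∀ e → Positive (edgeWeight e)
    edgeWeight-positive e = ℚ.pos*pos⇒pos ½ (1/ ℓ e) {{ℚ.1/pos⇒pos (ℓ e) {{ℓ-positive e}}}}
      where instance _ = ℚ.pos⇒nonZero (ℓ e) {{ℓ-positive e}}

    edgeWeight-∫ᴱᴱ : ∀ e e′ → edgeWeight e * ∫ᴱᴱ e e′ ≡ ½ * δ e′ e + - ½ * δ (e′ ⁻¹) e
    edgeWeight-∫ᴱᴱ e e′ = begin
      ½ * (1/ ℓ e) * ∫ᴱᴱ e e′
        ≡⟨ cong (½ * (1/ ℓ e) *_) (∫ᴱᴱ-δ e e′) ⟩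
      ½ * (1/ ℓ e) * (ℓ e * (δ e′ e + - δ e′ (e ⁻¹)))
        ≡⟨ solve 5 (λ h i l a b → h :* i :* (l :* (a :+ :- b)) := (i :* l) :* (h :* a :+ :- h :* b)) refl
             ½ (1/ ℓ e) (ℓ e) (δ e′ e) (δ e′ (e ⁻¹)) ⟩
      (1/ ℓ e) * ℓ e * (½ * δ e′ e + - ½ * δ e′ (e ⁻¹))
        ≡⟨ cong₂ (λ a b → a * (½ * δ e′ e + - ½ * b)) (ℚ.*-inverseˡ (ℓ e)) (sym (δ-⁻¹ e′ e)) ⟩
      1ℚ * (½ * δ e′ e + - ½ * δ (e′ ⁻¹) e)
        ≡⟨ ℚ.*-identityˡ _ ⟩
      ½ * δ e′ e + - ½ * δ (e′ ⁻¹) e ∎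
      where
      open ≡-Reasoning
      instance _ = ℚ.pos⇒nonZero (ℓ e) {{ℓ-positive e}}

  edgeFrame : Frame ℚE± E
  edgeFrame = record
    { support  = edges
    ; vector   = gen
    ; covector = coordinate
    ; expand   = linear-unique idᴸ (expansion ℚE± edges coordinate gen) λ e′ → ≈-sym (begin
        sumOver ℚE± edges (λ e → (edgeWeight e * ∫ᴱᴱ e e′) ⊡ gen e)
          ≈⟨ sumOver-cong ℚE± edges (λ e → M.≈ᴹ-trans (M.*ₗ-cong (edgeWeight-∫ᴱᴱ e e′) ≈-refl)
               (≈-trans (⊡-distribʳ (gen e) _ _) (⊞-cong (⊡-assoc _ _ _) (⊡-assoc _ _ _)))) ⟩
        sumOver ℚE± edges (λ e → ½ ⊡ (δ e′ e ⊡ gen e) ⊞ (- ½) ⊡ (δ (e′ ⁻¹) e ⊡ gen e))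
          ≈⟨ ≈-trans (sumOver-+ ℚE± edges _ _)
               (⊞-cong (sumOver-* ℚE± edges ½ _) (sumOver-* ℚE± edges (- ½) _)) ⟩
        ½ ⊡ sumOver ℚE± edges (λ e → δ e′ e ⊡ gen e) ⊞ (- ½) ⊡ sumOver ℚE± edges (λ e → δ (e′ ⁻¹) e ⊡ gen e)
          ≈⟨ ⊞-cong (⊡-cong ½ (sumOver-δ ℚE± e′ gen)) (⊡-cong (- ½) (sumOver-δ ℚE± (e′ ⁻¹) gen)) ⟩
        ½ ⊡ gen e′ ⊞ (- ½) ⊡ gen (e′ ⁻¹)
          ≈⟨ ⊞-cong ≈-refl (⊡-cong (- ½) (relation (inverse e′))) ⟩
        ½ ⊡ gen e′ ⊞ (- ½) ⊡ (⊟ gen e′)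
          ≈⟨ linearly ℚE± (gen e′ ∷ []) (½ ⊡ gen zero ⊞ (- ½) ⊡ (⊟ gen zero)) (gen zero) refl ⟩
        gen e′ ∎)
    }
    where
    module M = LeftModule ℚE±
    open SetoidReasoning M.≈ᴹ-setoid
    coordinate : E → ∣ Dual ℚE± ∣
    coordinate e = LeftModule._*ₗ_ (Dual ℚE±) (edgeWeight e) (IsBilinear.adjointˡ ⟨⟩-isBilinear (gen e))

  -- The frame serves twice: it writes ⟨ x , x ⟩ as a positive combination of the squares of the ⟨
  -- gen e , x ⟩, and it rebuilds `x` from these numbers once they vanish.
  ⟨⟩-definite : ∀ x → ⟨ x , x ⟩ ≡ 0ℚ → ℚE± ⊢ x ≈ 𝟘
  ⟨⟩-definite x x²≡0 = ≈-trans (Frame.expand edgeFrame x) (vanishing edges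
    (sumOfSquares≡0 edgeWeight (λ e → ⟨ gen e , x ⟩) edgeWeight-positive edges (begin
      sumOver ℚ¹ edges (λ e → edgeWeight e * (⟨ gen e , x ⟩ * ⟨ gen e , x ⟩))
        ≡⟨ sumOver-cong ℚ¹ edges (λ e → ℚ.*-assoc (edgeWeight e) ⟨ gen e , x ⟩ ⟨ gen e , x ⟩) ⟨
      sumOver ℚ¹ edges (λ e → edgeWeight e * ⟨ gen e , x ⟩ * ⟨ gen e , x ⟩)
        ≡⟨ expand-linear edgeFrame (IsBilinear.adjointʳ ⟨⟩-isBilinear x) x ⟨
      ⟨ x , x ⟩
        ≡⟨ x²≡0 ⟩
      0ℚ ∎)))
    where
    open ≡-Reasoning
    vanishing : ∀ es → All (λ e → ⟨ gen e , x ⟩ ≡ 0ℚ) es →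
      ℚE± ⊢ sumOver ℚE± es (λ e → (edgeWeight e * ⟨ gen e , x ⟩) ⊡ gen e) ≈ 𝟘
    vanishing []       []         = ≈-refl
    vanishing (e ∷ es) (eq ∷ eqs) = ≈-trans (⊞-cong
      (LeftModule.≈ᴹ-trans ℚE± (LeftModule.*ₗ-cong ℚE± (trans (cong (edgeWeight e *_) eq) (ℚ.*-zeroʳ (edgeWeight e))) ≈-refl) (⊡-zeroˡ (gen e)))
      (vanishing es eqs)) (⊞-identityˡ 𝟘)

-- Homotopy and the higher cycle pairing

module PathAlgebra (Γ : MetrisedGraph) where
  open MetrisedGraphTheory Γ
  open EdgeForm Γ

  infix 4 _~_

  _~_ : ∀ {u v} → Path u v → Path u v → Set
  _~_ {u} {v} = Setoid._≈_ (π₁ u v)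

  ~-refl : ∀ {u v} {γ : Path u v} → γ ~ γ
  ~-refl {u} {v} = Setoid.refl (π₁ u v)

  ~-sym : ∀ {u v} {γ δ : Path u v} → γ ~ δ → δ ~ γ
  ~-sym {u} {v} = Setoid.sym (π₁ u v)

  ~-trans : ∀ {u v} {γ δ η : Path u v} → γ ~ δ → δ ~ η → γ ~ η
  ~-trans {u} {v} = Setoid.trans (π₁ u v)

  ⇝⇒~ : ∀ {u v} {γ δ : Path u v} → γ ⇝ δ → γ ~ δ
  ⇝⇒~ r = fwd r ◅ ε

  ∙-congʳ : ∀ {u v w} (γ : Path v w) {δ δ′ : Path u v} → δ ~ δ′ → γ ∙ δ ~ γ ∙ δ′
  ∙-congʳ const          p = p
  ∙-congʳ (step e q r γ) p = EqClosure.gmap (step e q r) (under e q r) (∙-congʳ γ p)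

  ∙-congˡ : ∀ {u v w} {γ γ′ : Path v w} (δ : Path u v) → γ ~ γ′ → γ ∙ δ ~ γ′ ∙ δ
  ∙-congˡ {v = v} δ = EqClosure.gmap (_∙ δ) ⇝-∙
    where
    ⇝-∙ : ∀ {w} {γ γ′ : Path v w} → γ ⇝ γ′ → (γ ∙ δ) ⇝ (γ′ ∙ δ)
    ⇝-∙ (backtrack e p q p′ q′ γ) = backtrack e p q p′ q′ (γ ∙ δ)
    ⇝-∙ (under e p q r)           = under e p q (⇝-∙ r)

  ∙-assoc : ∀ {u v w z} (γ : Path w z) (δ : Path v w) (η : Path u v) → (γ ∙ δ) ∙ η ≡ γ ∙ (δ ∙ η)
  ∙-assoc const          δ η = refl
  ∙-assoc (step e p q γ) δ η = cong (step e p q) (∙-assoc γ δ η)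

  ∙-identityʳ : ∀ {u v} (γ : Path u v) → γ ∙ const ≡ γ
  ∙-identityʳ const          = refl
  ∙-identityʳ (step e p q γ) = cong (step e p q) (∙-identityʳ γ)

  reverse : ∀ {u v} → Path u v → Path v u
  reverse const          = const
  reverse (step e p q γ) = reverse γ ∙ step (e ⁻¹) q (trans (cong s (⁻¹-involutive e)) p) const

  reverse-inverseˡ : ∀ {u v} (γ : Path u v) → reverse γ ∙ γ ~ const
  reverse-inverseˡ const          = ~-refl
  reverse-inverseˡ (step e p q γ) = ~-trans
    (subst (_~ reverse γ ∙ γ) (sym (∙-assoc (reverse γ) _ (step e p q γ)))
      (∙-congʳ (reverse γ) (⇝⇒~ (backtrack e p q q _ γ))))
    (reverse-inverseˡ γ)

  private
    -- `backtrack` wants the outer edge to be literally the inverse of the inner one. Where the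
    -- inner edge is `e ⁻¹`, the outer edge `e` is its inverse only up to `⁻¹-involutive`.
    backtrack⁻¹ : ∀ {u v w} e e′ → e′ ≡ e ⁻¹ → (p : s e ≡ v) (q : t e ≡ w) (p′ : s e′ ≡ w) (q′ : t e′ ≡ v)
      (γ : Path u v) → step e′ p′ q′ (step e p q γ) ⇝ γ
    backtrack⁻¹ e _ refl p q p′ q′ γ = backtrack e p q p′ q′ γ

  reverse-inverseʳ : ∀ {u v} (γ : Path u v) → γ ∙ reverse γ ~ const
  reverse-inverseʳ const          = ~-refl
  reverse-inverseʳ (step e p q γ) = ~-trans
    (subst (_~ step e p q (const ∙ ē)) (cong (step e p q) (∙-assoc γ (reverse γ) ē))
      (∙-congʳ (step e p q const) (∙-congˡ ē (reverse-inverseʳ γ))))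
    (⇝⇒~ (backtrack⁻¹ (e ⁻¹) e (sym (⁻¹-involutive e)) q _ p q const))
    where ē = step (e ⁻¹) q (trans (cong s (⁻¹-involutive e)) p) const

  -- Iterated integrals as noncommutative series

  inclusion : LinearMap H₁ ℚE±
  inclusion = record
    { ⟦_⟧ = proj₁ ; isLinear = mkIsLinear H₁ ℚE± proj₁ id (λ _ _ → ≈-refl) (λ _ _ → ≈-refl) }

  edgeFunctional : E → ∣ H¹ ∣
  edgeFunctional e = IsBilinear.adjointˡ ⟨⟩-isBilinear (gen e) ∘ᴸ inclusion

  ∫ᴾ-step : ∀ {u v w} e (p : s e ≡ v) (q : t e ≡ w) (γ : Path u v) → ∫ᴾ (step e p q γ) ≗ ∫ᴾ γ ⊛ exp (∫ᴱ e)
  ∫ᴾ-step e p q γ = ⊛-splits (∫ᴾ γ) (exp (∫ᴱ e))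

  ∫ᴾ-const : ∀ {u} → ∫ᴾ (const {u}) ≗ unit
  ∫ᴾ-const []      = refl
  ∫ᴾ-const (_ ∷ _) = refl

  -- The factors change order because composition is written right to left, whereas the path
  -- travelled first takes the first forms.
  ∫ᴾ-∙ : ∀ {u v w} (γ : Path v w) (δ : Path u v) → ∫ᴾ (γ ∙ δ) ≗ ∫ᴾ δ ⊛ ∫ᴾ γ
  ∫ᴾ-∙ const          δ ωs = sym (trans (⊛-congʳ (∫ᴾ δ) ∫ᴾ-const ωs) (⊛-identityʳ (∫ᴾ δ) ωs))
  ∫ᴾ-∙ (step e p q γ) δ ωs = begin
    ∫ᴾ (step e p q (γ ∙ δ)) ωs             ≡⟨ ∫ᴾ-step e p q (γ ∙ δ) ωs ⟩
    (∫ᴾ (γ ∙ δ) ⊛ exp (∫ᴱ e)) ωs           ≡⟨ ⊛-congˡ (exp (∫ᴱ e)) (∫ᴾ-∙ γ δ) ωs ⟩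
    (∫ᴾ δ ⊛ ∫ᴾ γ ⊛ exp (∫ᴱ e)) ωs          ≡⟨ ⊛-assoc (∫ᴾ δ) (∫ᴾ γ) (exp (∫ᴱ e)) ωs ⟩
    (∫ᴾ δ ⊛ (∫ᴾ γ ⊛ exp (∫ᴱ e))) ωs        ≡⟨ ⊛-congʳ (∫ᴾ δ) (∫ᴾ-step e p q γ) ωs ⟨
    (∫ᴾ δ ⊛ ∫ᴾ (step e p q γ)) ωs          ∎
    where open ≡-Reasoning

  -- Opposite orientations have opposite functionals, so a backtrack contributes `exp x ⊛ exp y`
  -- with y = - x, which is `unit` although the variables do not commute.
  ∫ᴾ-⇝ : ∀ {u v} {γ δ : Path u v} → γ ⇝ δ → ∫ᴾ γ ≗ ∫ᴾ δ
  ∫ᴾ-⇝ (backtrack e p q p′ q′ γ) ωs = begin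
    ∫ᴾ (step (e ⁻¹) p′ q′ (step e p q γ)) ωs       ≡⟨ ∫ᴾ-step (e ⁻¹) p′ q′ (step e p q γ) ωs ⟩
    (∫ᴾ (step e p q γ) ⊛ exp (∫ᴱ (e ⁻¹))) ωs       ≡⟨ ⊛-congˡ (exp (∫ᴱ (e ⁻¹))) (∫ᴾ-step e p q γ) ωs ⟩
    (∫ᴾ γ ⊛ exp (∫ᴱ e) ⊛ exp (∫ᴱ (e ⁻¹))) ωs       ≡⟨ ⊛-assoc (∫ᴾ γ) (exp (∫ᴱ e)) (exp (∫ᴱ (e ⁻¹))) ωs ⟩
    (∫ᴾ γ ⊛ (exp (∫ᴱ e) ⊛ exp (∫ᴱ (e ⁻¹)))) ωs     ≡⟨ ⊛-congʳ (∫ᴾ γ) (exp-inverse (∫ᴱ e) (∫ᴱ (e ⁻¹)) negate) ωs ⟩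
    (∫ᴾ γ ⊛ unit) ωs                               ≡⟨ ⊛-identityʳ (∫ᴾ γ) ωs ⟩
    ∫ᴾ γ ωs                                        ∎
    where
    open ≡-Reasoning
    negate : ∀ ω → ∫ᴱ (e ⁻¹) ω ≡ - ∫ᴱ e ω
    negate ω = trans (IsBilinear.⟨⟩-cong ⟨⟩-isBilinear (relation (inverse e)) (≈-refl {x = proj₁ ω}))
      (solve 1 (λ x → :- con 1ℚ :* x := :- x) refl (∫ᴱ e ω))
  ∫ᴾ-⇝ (under e p q {γ} {δ} r) ωs = begin
    ∫ᴾ (step e p q γ) ωs         ≡⟨ ∫ᴾ-step e p q γ ωs ⟩
    (∫ᴾ γ ⊛ exp (∫ᴱ e)) ωs       ≡⟨ ⊛-congˡ (exp (∫ᴱ e)) (∫ᴾ-⇝ r) ωs ⟩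
    (∫ᴾ δ ⊛ exp (∫ᴱ e)) ωs       ≡⟨ ∫ᴾ-step e p q δ ωs ⟨
    ∫ᴾ (step e p q δ) ωs         ∎
    where open ≡-Reasoning

  ∫ᴾ-~ : ∀ {u v} {γ δ : Path u v} → γ ~ δ → ∀ ωs → ∫ᴾ γ ωs ≡ ∫ᴾ δ ωs
  ∫ᴾ-~ γ~δ ωs = EqClosure.gfold isEquivalence (λ γ → ∫ᴾ γ ωs) (λ r → ∫ᴾ-⇝ r ωs) γ~δ

  ∫ᴾ-isMultilinear : ∀ {u v} (γ : Path u v) → IsMultilinear H₁ (∫ᴾ γ)
  ∫ᴾ-isMultilinear const          = IsMultilinear-cong H₁ ∫ᴾ-const (unit-isMultilinear H₁)
  ∫ᴾ-isMultilinear (step e p q γ) = IsMultilinear-cong H₁ (∫ᴾ-step e p q γ)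
    (⊛-isMultilinear H₁ (∫ᴾ-isMultilinear γ) (exp-isMultilinear H₁ (edgeFunctional e)))

  ∫ᴾ-[] : ∀ {u v} (γ : Path u v) → ∫ᴾ γ [] ≡ 1ℚ
  ∫ᴾ-[] const          = refl
  ∫ᴾ-[] (step e p q γ) = trans (∫ᴾ-step e p q γ []) (cong (_* 1ℚ) (∫ᴾ-[] γ))

  ∫ᴾ-∙-singleton : ∀ {u v w} (γ : Path v w) (δ : Path u v) ω →
    ∫ᴾ (γ ∙ δ) (ω ∷ []) ≡ ∫ᴾ γ (ω ∷ []) + ∫ᴾ δ (ω ∷ [])
  ∫ᴾ-∙-singleton γ δ ω = trans (∫ᴾ-∙ γ δ (ω ∷ []))
    (cong₂ _+_ (trans (cong (_* ∫ᴾ γ (ω ∷ [])) (∫ᴾ-[] δ)) (ℚ.*-identityˡ (∫ᴾ γ (ω ∷ []))))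
               (trans (cong (∫ᴾ δ (ω ∷ []) *_) (∫ᴾ-[] γ)) (ℚ.*-identityʳ (∫ᴾ δ (ω ∷ [])))))

  ∫ᴾ-reverse-singleton : ∀ {u v} (γ : Path u v) ω → ∫ᴾ (reverse γ) (ω ∷ []) ≡ - ∫ᴾ γ (ω ∷ [])
  ∫ᴾ-reverse-singleton γ ω = begin
    a                ≡⟨ solve 2 (λ a b → a := (a :+ b) :+ :- b) refl a b ⟩
    (a + b) + - b    ≡⟨ cong (_+ - b) (trans (sym (∫ᴾ-∙-singleton (reverse γ) γ ω)) (∫ᴾ-~ (reverse-inverseˡ γ) (ω ∷ []))) ⟩
    0ℚ + - b         ≡⟨ ℚ.+-identityˡ (- b) ⟩
    - b              ∎
    where
    open ≡-Reasoning
    a = ∫ᴾ (reverse γ) (ω ∷ [])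
    b = ∫ᴾ γ (ω ∷ [])

  chain : ∀ {u v} → Path u v → Term E
  chain const          = 𝟘
  chain (step e _ _ γ) = gen e ⊞ chain γ

  ∫ᴾ-chain : ∀ {u v} (γ : Path u v) (ω : ∣ H₁ ∣) → ∫ᴾ γ (ω ∷ []) ≡ ⟨ chain γ , proj₁ ω ⟩
  ∫ᴾ-chain const          ω = refl
  ∫ᴾ-chain (step e p q γ) ω = begin
    ∫ᴾ (step e p q γ) (ω ∷ [])
      ≡⟨ ∫ᴾ-step e p q γ (ω ∷ []) ⟩
    ∫ᴾ γ [] * (1ℚ * (∫ᴱ e ω * 1ℚ)) + ∫ᴾ γ (ω ∷ []) * (1ℚ * 1ℚ)
      ≡⟨ cong₂ (λ a b → a * (1ℚ * (∫ᴱ e ω * 1ℚ)) + b * (1ℚ * 1ℚ)) (∫ᴾ-[] γ) (∫ᴾ-chain γ ω) ⟩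
    1ℚ * (1ℚ * (∫ᴱ e ω * 1ℚ)) + ⟨ chain γ , proj₁ ω ⟩ * (1ℚ * 1ℚ)
      ≡⟨ solve 2 (λ a b → con 1ℚ :* (con 1ℚ :* (a :* con 1ℚ)) :+ b :* (con 1ℚ :* con 1ℚ) := a :+ b) refl
           (∫ᴱ e ω) ⟨ chain γ , proj₁ ω ⟩ ⟩
    ∫ᴱ e ω + ⟨ chain γ , proj₁ ω ⟩ ∎
    where open ≡-Reasoning

  ∂-chain : ∀ {u v} (γ : Path u v) → ℚV ⊢ ∂ (chain γ) ≈ gen v ⊞ ⊟ gen u
  ∂-chain {u} const = ≈-sym (linearly ℚV (gen u ∷ []) (gen zero ⊞ ⊟ gen zero) 𝟘 refl)
  ∂-chain {u} (step e refl refl γ) = ≈-trans (⊞-cong ≈-refl (∂-chain γ))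
    (linearly ℚV (gen (t e) ∷ gen (s e) ∷ gen u ∷ [])
      ((x ⊞ ⊟ y) ⊞ (y ⊞ ⊟ z)) (x ⊞ ⊟ z) refl)
    where
    x = gen zero
    y = gen (suc zero)
    z = gen (suc (suc zero))

  series : ∀ {u v} → ∣ ℚπ₁ u v ∣ → List ∣ H₁ ∣ → ℚ
  series x ωs = extend ℚ¹ (λ γ → ∫ᴾ γ ωs) x

  seriesᴸ : ∀ {u v} → List ∣ H₁ ∣ → LinearMap (ℚπ₁ u v) ℚ¹
  seriesᴸ ωs = extendᴸ ℚ¹ (λ γ → ∫ᴾ γ ωs) λ { (identify p) → ∫ᴾ-~ p ωs }

  ∫⊗-isBilinear : ∀ {u v} m → IsBilinear (ℚπ₁ u v) (H₁⊗ m) (∫⊗ m)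
  ∫⊗-isBilinear {u} {v} m = extend₂-isBilinear (FreeRelation (π₁ u v)) (Multilinear H₁ m)
    (λ γ ωs → ∫ᴾ γ (toList ωs))
    (λ { ωs (identify p) → ∫ᴾ-~ p (toList ωs) })
    (λ γ → IsMultilinear.respects (∫ᴾ-isMultilinear γ))

  -- Multiplication in the path algebra

  module _ {u v w : V} where
    private
      respectsˡ : ∀ {x x′} (δ : Path u v) → FreeRelation (π₁ v w) x x′ →
        ℚπ₁ u w ⊢ extend (ℚπ₁ u w) (λ γ → gen (γ ∙ δ)) x ≈ extend (ℚπ₁ u w) (λ γ → gen (γ ∙ δ)) x′
      respectsˡ δ (identify p) = relation (identify (∙-congˡ δ p))

      respectsʳ : ∀ {x x′} (γ : Path v w) → FreeRelation (π₁ u v) x x′ →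
        ℚπ₁ u w ⊢ extend (ℚπ₁ u w) (λ δ → gen (γ ∙ δ)) x ≈ extend (ℚπ₁ u w) (λ δ → gen (γ ∙ δ)) x′
      respectsʳ γ (identify p) = relation (identify (∙-congʳ γ p))

    mulʳ : ∣ ℚπ₁ u v ∣ → LinearMap (ℚπ₁ v w) (ℚπ₁ u w)
    mulʳ = extend₂-ˡ (ℚπ₁ u w) (FreeRelation (π₁ v w)) (FreeRelation (π₁ u v)) _ respectsˡ respectsʳ

    mulˡ : ∣ ℚπ₁ v w ∣ → LinearMap (ℚπ₁ u v) (ℚπ₁ u w)
    mulˡ = extend₂-ʳ (ℚπ₁ u w) (FreeRelation (π₁ v w)) (FreeRelation (π₁ u v)) _ respectsˡ respectsʳ

    series-· : ∀ (a : ∣ ℚπ₁ v w ∣) (b : ∣ ℚπ₁ u v ∣) → series (a · b) ≗ series b ⊛ series a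
    series-· (gen γ)  (gen δ)  ωs = ∫ᴾ-∙ γ δ ωs
    series-· (gen γ)  𝟘        ωs = sym (⊛-0ˡ (∫ᴾ γ) (λ _ → refl) ωs)
    series-· (gen γ)  (b ⊞ b′) ωs = trans (cong₂ _+_ (series-· (gen γ) b ωs) (series-· (gen γ) b′ ωs))
      (sym (⊛-+ˡ (series b) (series b′) (∫ᴾ γ) ωs))
    series-· (gen γ)  (c ⊡ b)  ωs = trans (cong (c *_) (series-· (gen γ) b ωs)) (sym (⊛-*ˡ c (series b) (∫ᴾ γ) ωs))
    series-· 𝟘        b        ωs = sym (⊛-0ʳ (series b) (λ _ → refl) ωs)
    series-· (a ⊞ a′) b        ωs = trans (cong₂ _+_ (series-· a b ωs) (series-· a′ b ωs))
      (sym (⊛-+ʳ (series b) (series a) (series a′) ωs))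
    series-· (c ⊡ a)  b        ωs = trans (cong (c *_) (series-· a b ωs)) (sym (⊛-*ʳ c (series b) (series a) ωs))

  ·-assoc : ∀ {u v w z} (a : ∣ ℚπ₁ w z ∣) (b : ∣ ℚπ₁ v w ∣) (c : ∣ ℚπ₁ u v ∣) →
    ℚπ₁ u z ⊢ (a · b) · c ≈ a · (b · c)
  ·-assoc {u} {v} {w} {z} a b c = linear-unique {N = ℚπ₁ u z} (mulʳ c ∘ᴸ mulʳ b) (mulʳ (b · c)) (λ γ →
    linear-unique {N = ℚπ₁ u z} (mulʳ c ∘ᴸ mulˡ (gen γ)) (mulˡ (gen γ) ∘ᴸ mulʳ c) (λ δ →
      linear-unique {N = ℚπ₁ u z} (mulˡ (gen (γ ∙ δ))) (mulˡ (gen γ) ∘ᴸ mulˡ (gen δ)) (λ η →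
        LeftModule.≈ᴹ-reflexive (ℚπ₁ u z) (cong gen (∙-assoc γ δ η))) c) b) a

  ·-identityˡ : ∀ {u v} (a : ∣ ℚπ₁ u v ∣) → ℚπ₁ u v ⊢ gen const · a ≈ a
  ·-identityˡ = linear-unique (mulˡ (gen const)) idᴸ (λ _ → ≈-refl)

  ·-identityʳ : ∀ {u v} (a : ∣ ℚπ₁ u v ∣) → ℚπ₁ u v ⊢ a · gen const ≈ a
  ·-identityʳ {u} {v} = linear-unique (mulʳ (gen const)) idᴸ
    (λ γ → LeftModule.≈ᴹ-reflexive (ℚπ₁ u v) (cong gen (∙-identityʳ γ)))

  series-[] : ∀ {u} (x : ∣ ℚπ₁ u u ∣) → series x [] ≡ augmentation u x
  series-[] = extend-pointwise ℚ¹ ∫ᴾ-[]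

  augmentation-· : ∀ {u} (a b : ∣ ℚπ₁ u u ∣) → augmentation u (a · b) ≡ augmentation u b * augmentation u a
  augmentation-· {u} a b = trans (sym (series-[] (a · b))) (trans (series-· a b []) (cong₂ _*_ (series-[] b) (series-[] a)))

  -- The augmentation filtration

  J-idealʳ : ∀ {u a} b → J u a → J u (a · b)
  J-idealʳ {u} {a} b p = trans (augmentation-· a b) (trans (cong (augmentation u b *_) p) (ℚ.*-zeroʳ (augmentation u b)))

  J^-isSubspace : ∀ k u → IsSubspace (ℚπ₁ u u) (J^ k u)
  J^-isSubspace zero    u = record { resp = λ _ _ → _ ; 0-closed = _ ; +-closed = λ _ _ → _ ; *-closed = λ _ _ → _ }
  J^-isSubspace (suc k) u = Span-isSubspace _ _

  -- The rightmost factor of a product, which lies in J, absorbs `b`.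
  J^-idealʳ : ∀ {k u a} b → J^ k u a → J^ k u (a · b)
  J^-idealʳ {zero}  b _ = _
  J^-idealʳ {suc k} b p = Span-least (preimage-isSubspace (mulʳ b) (J^-isSubspace (suc k) _))
    (λ { (product c d c∈ d∈) → resp (≈-sym (·-assoc c d b)) (incl (product c (d · b) c∈ (J-idealʳ {a = d} b d∈))) }) p

  J⊆J^1 : ∀ {u x} → J u x → J^ 1 u x
  J⊆J^1 {x = x} p = resp (·-identityˡ x) (incl (product (gen const) x _ p))

  -- By definition `J^` grows by factors on the right. `W₋-remainder` produces its additional factor
  -- from J on the left.
  J·J^⊆J^ : ∀ {k u a b} → J u a → J^ k u b → J^ (suc k) u (a · b)
  J·J^⊆J^ {zero}  {a = a} {b} p _ = J⊆J^1 {x = a · b} (J-idealʳ {a = a} b p)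
  J·J^⊆J^ {suc k} {a = a} p q = Span-least (preimage-isSubspace (mulˡ a) (J^-isSubspace (suc (suc k)) _))
    (λ { (product c d c∈ d∈) → resp (·-assoc a c d) (incl (product (a · c) d (J·J^⊆J^ {k} {a = a} {c} p c∈) d∈)) }) q

  J^·J²⊆J^ : ∀ {k u a b} → J^ k u a → J^ 2 u b → J^ (suc (suc k)) u (a · b)
  J^·J²⊆J^ {k} {a = a} p = Span-least (preimage-isSubspace (mulˡ a) (J^-isSubspace (suc (suc k)) _))
    λ { (product c d c∈ d∈) → resp (·-assoc a c d) (incl (product (a · c) d (J^·J¹ {a = a} {c} p c∈) d∈)) }
    where
    J^·J¹ : ∀ {u a b} → J^ k u a → J^ 1 u b → J^ (suc k) u (a · b)
    J^·J¹ {a = a} p = Span-least (preimage-isSubspace (mulˡ a) (J^-isSubspace (suc k) _))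
      -- In a generator of `J^ 1` the factor `c` is arbitrary; `J^ k` absorbs it, and `d` supplies
      -- the extra factor.
      λ { (product c d _ d∈) → resp (·-assoc a c d) (incl (product (a · c) d (J^-idealʳ {k} {a = a} c p) d∈)) }

  HasOrder-isSubspace : ∀ {u v} k → IsSubspace (ℚπ₁ u v) (λ x → HasOrder k (series x))
  HasOrder-isSubspace k = record
    { resp     = λ eq p ωs l → trans (sym (LinearMap.⟦⟧-cong (seriesᴸ ωs) eq)) (p ωs l)
    ; 0-closed = λ _ _ → refl
    ; +-closed = λ p q ωs l → cong₂ _+_ (p ωs l) (q ωs l)
    ; *-closed = λ a p ωs l → trans (cong (a *_) (p ωs l)) (ℚ.*-zeroʳ a)
    }

  J^-HasOrder : ∀ {k u a} → J^ k u a → HasOrder k (series a)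
  J^-HasOrder {zero}  _ _ ()
  J^-HasOrder {suc k} p = Span-least (HasOrder-isSubspace (suc k))
    (λ { (product c d c∈ d∈) ωs l → trans (series-· c d ωs)
      (HasOrder-suc (trans (series-[] d) d∈) (J^-HasOrder {k} {a = c} c∈) ωs l) }) p

  W₋-HasOrder : ∀ {k u v x} → W₋ k u v x → HasOrder k (series x)
  W₋-HasOrder {k} = Span-least (HasOrder-isSubspace k)
    λ { (product c d _ d∈) ωs l → trans (series-· c d ωs) (HasOrder-⊛ˡ (series c) (J^-HasOrder {k} {a = d} d∈) ωs l) }

-- Cycles based at a vertex

module Based (Γ : MetrisedGraph) (u : MetrisedGraph.V Γ) where
  open MetrisedGraphTheory Γ
  open EdgeForm Γ
  open PathAlgebra Γ

  -- The given path from `u` to itself may be an essential loop. It is divided out, so that the path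
  -- to the base point becomes null-homotopic.
  pathTo : ∀ w → Path u w
  pathTo w = connected u w ∙ reverse (connected u u)

  pathTo-base : pathTo u ~ const
  pathTo-base = reverse-inverseʳ (connected u u)

  loop : E → Path u u
  loop e = reverse (pathTo (t e)) ∙ step e refl refl (pathTo (s e))

  one : ∣ ℚπ₁ u u ∣
  one = gen const

  -- On cycles κ represents the inverse of the Hurewicz map J / J² → H₁.
  κ : Term E → ∣ ℚπ₁ u u ∣
  κ = extend (ℚπ₁ u u) (λ e → gen (loop e) ⊞ ⊟ one)

  κ∈J : ∀ x → J u (κ x)
  κ∈J (gen e) = refl
  κ∈J 𝟘       = refl
  κ∈J (x ⊞ y) = cong₂ _+_ (κ∈J x) (κ∈J y)
  κ∈J (a ⊡ x) = trans (cong (a *_) (κ∈J x)) (ℚ.*-zeroʳ a)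

  private
    A/J² : VectorSpace
    A/J² = Quotient (ℚπ₁ u u) (J^ 2 u) (J^-isSubspace 2 u)

    module A/J² = LeftModule A/J²

    lift : ∀ {x y} → ℚπ₁ u u ⊢ x ≈ y → A/J² ⊢ x ≈ y
    lift = quotient-≈ (ℚπ₁ u u) (J^-isSubspace 2 u)

    closed : ∀ {w} → Path u w → ∣ ℚπ₁ u u ∣
    closed {w} γ = gen (reverse (pathTo w) ∙ γ) ⊞ ⊟ one

    closed-~ : ∀ {w} {γ δ : Path u w} → γ ~ δ → ℚπ₁ u u ⊢ closed γ ≈ closed δ
    closed-~ {w} p = ⊞-cong (relation (identify (∙-congʳ (reverse (pathTo w)) p))) ≈-refl

    closed-pathTo : ∀ w → ℚπ₁ u u ⊢ closed (pathTo w) ≈ 𝟘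
    closed-pathTo w = ≈-trans (⊞-cong (relation (identify (reverse-inverseˡ (pathTo w)))) ≈-refl)
      (linearly (ℚπ₁ u u) (one ∷ []) (gen zero ⊞ ⊟ gen zero) 𝟘 refl)

    -- (a - 1)(b - 1) = (ab - 1) - (a - 1) - (b - 1)
    product-1 : ∀ α β → A/J² ⊢ (gen α ⊞ ⊟ one) ⊞ (gen β ⊞ ⊟ one) ≈ gen (α ∙ β) ⊞ ⊟ one
    product-1 α β = begin
      a ⊞ b                                    ≈⟨ lift (linearly A (a ∷ b ∷ a · b ∷ []) (x ⊞ y) ((z ⊞ x ⊞ y) ⊞ ⊟ z) refl) ⟩
      (a · b ⊞ a ⊞ b) ⊞ ⊟ (a · b)              ≈⟨ A/J².+ᴹ-cong (lift expand) (A/J².*ₗ-cong {x = - 1ℚ} refl ab≈0) ⟩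
      (gen (α ∙ β) ⊞ ⊟ one) ⊞ ⊟ 𝟘              ≈⟨ lift (linearly A ((gen (α ∙ β) ⊞ ⊟ one) ∷ []) (x ⊞ ⊟ 𝟘) x refl) ⟩
      gen (α ∙ β) ⊞ ⊟ one                      ∎
      where
      open SetoidReasoning A/J².≈ᴹ-setoid
      A = ℚπ₁ u u
      x : ∀ {n} → Term (Fin (suc n))
      x = gen zero
      y : ∀ {n} → Term (Fin (suc (suc n)))
      y = gen (suc zero)
      z : ∀ {n} → Term (Fin (suc (suc (suc n))))
      z = gen (suc (suc zero))
      a = gen α ⊞ ⊟ one
      b = gen β ⊞ ⊟ one

      ab≈0 : A/J² ⊢ a · b ≈ 𝟘
      ab≈0 = ∈⇒≈0 A (J^-isSubspace 2 u) (incl (product a b (J⊆J^1 {x = a} refl) refl))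

      expand : A ⊢ a · b ⊞ a ⊞ b ≈ gen (α ∙ β) ⊞ ⊟ one
      expand = ≈-trans (⊞-cong (⊞-cong (⊞-cong (⊞-cong ≈-refl (⊡-cong (- 1ℚ)
          (LeftModule.≈ᴹ-reflexive A (cong gen (∙-identityʳ α))))) ≈-refl) ≈-refl) ≈-refl)
        (linearly A (gen (α ∙ β) ∷ gen α ∷ gen β ∷ one ∷ [])
          (((x ⊞ ⊟ y) ⊞ ⊟ (z ⊞ ⊟ o)) ⊞ (y ⊞ ⊟ o) ⊞ (z ⊞ ⊟ o)) (x ⊞ ⊟ o) refl)
        where o = gen (suc (suc (suc zero)))

    -- Modulo `J^ 2` products of loops become sums, and the loops of consecutive edges telescope:
    -- the return along `pathTo` that ends one of them cancels against the departure that begins the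
    -- next.
    κ-chain-closed : ∀ {w} (γ : Path u w) → A/J² ⊢ κ (chain γ) ≈ closed γ
    -- The constant path is closed up by the reverse of `pathTo u`, which is trivial by the
    -- normalisation of `pathTo`.
    κ-chain-closed const = lift (≈-sym (≈-trans
      (closed-~ (~-sym pathTo-base)) (closed-pathTo u)))
    κ-chain-closed (step e refl refl γ) = begin
      (gen (loop e) ⊞ ⊟ one) ⊞ κ (chain γ)
        ≈⟨ A/J².+ᴹ-cong A/J².≈ᴹ-refl (κ-chain-closed γ) ⟩
      (gen (loop e) ⊞ ⊟ one) ⊞ (gen (reverse (pathTo (s e)) ∙ γ) ⊞ ⊟ one)
        ≈⟨ product-1 (loop e) (reverse (pathTo (s e)) ∙ γ) ⟩
      gen (loop e ∙ (reverse (pathTo (s e)) ∙ γ)) ⊞ ⊟ one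
        ≈⟨ lift (⊞-cong (relation (identify cancel)) ≈-refl) ⟩
      gen (reverse (pathTo (t e)) ∙ step e refl refl γ) ⊞ ⊟ one ∎
      where
      open SetoidReasoning A/J².≈ᴹ-setoid
      r = reverse (pathTo (t e))
      p = pathTo (s e)
      cancel : loop e ∙ (reverse p ∙ γ) ~ r ∙ step e refl refl γ
      cancel = subst (_~ r ∙ step e refl refl γ)
        (trans (cong (λ η → r ∙ step e refl refl η) (∙-assoc p (reverse p) γ))
               (sym (∙-assoc r (step e refl refl p) (reverse p ∙ γ))))
        (∙-congʳ r (∙-congʳ (step e refl refl const) (∙-congˡ γ (reverse-inverseʳ p))))

    -- The path `back` runs along `p`, then along `e` and back, so it is homotopic to `p`. By
    -- `κ-chain-closed` their chains have the same image, and the chains differ by the sum of `e ⁻¹`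
    -- and `e`.
    κ-antisymmetric : ∀ e → A/J² ⊢ κ (gen (e ⁻¹)) ≈ κ (⊟ gen e)
    κ-antisymmetric e = begin
      ē                                         ≈⟨ lift (linearly A (ē ∷ κ (gen e) ∷ c ∷ []) x ((x ⊞ (y ⊞ z)) ⊞ (⊟ z ⊞ ⊟ y)) refl) ⟩
      κ (chain back) ⊞ (⊟ c ⊞ ⊟ κ (gen e))      ≈⟨ A/J².+ᴹ-cong (κ-chain-closed back) A/J².≈ᴹ-refl ⟩
      closed back ⊞ (⊟ c ⊞ ⊟ κ (gen e))         ≈⟨ A/J².+ᴹ-cong (lift (closed-~ (⇝⇒~ (backtrack e refl refl refl eq p)))) A/J².≈ᴹ-refl ⟩
      closed p ⊞ (⊟ c ⊞ ⊟ κ (gen e))            ≈⟨ A/J².+ᴹ-cong (κ-chain-closed p) A/J².≈ᴹ-refl ⟨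
      c ⊞ (⊟ c ⊞ ⊟ κ (gen e))                   ≈⟨ lift (linearly A (c ∷ κ (gen e) ∷ []) (x ⊞ (⊟ x ⊞ ⊟ y)) (⊟ y) refl) ⟩
      ⊟ κ (gen e)                               ∎
      where
      open SetoidReasoning A/J².≈ᴹ-setoid
      A = ℚπ₁ u u
      x : ∀ {n} → Term (Fin (suc n))
      x = gen zero
      y : ∀ {n} → Term (Fin (suc (suc n)))
      y = gen (suc zero)
      z : ∀ {n} → Term (Fin (suc (suc (suc n))))
      z = gen (suc (suc zero))
      p = pathTo (s e)
      eq = cong s (⁻¹-involutive e)
      back = step (e ⁻¹) refl eq (step e refl refl p)
      ē = κ (gen (e ⁻¹))
      c = κ (chain p)

    κᴸ : LinearMap ℚE± A/J²
    κᴸ = record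
      { ⟦_⟧ = κ
      ; isLinear = mkIsLinear ℚE± A/J² κ
          (λ {x} {y} p → A/J².≈ᴹ-trans (A/J².≈ᴹ-reflexive (κ-extend x))
            (A/J².≈ᴹ-trans (extend-cong A/J² _ (λ { (inverse e) → κ-antisymmetric e }) p)
            (A/J².≈ᴹ-reflexive (sym (κ-extend y)))))
          (λ _ _ → A/J².≈ᴹ-refl) (λ _ _ → A/J².≈ᴹ-refl)
      }
      where
      κ-extend : ∀ x → κ x ≡ extend A/J² (λ e → gen (loop e) ⊞ ⊟ one) x
      κ-extend (gen e) = refl
      κ-extend 𝟘       = refl
      κ-extend (x ⊞ y) = cong₂ _⊞_ (κ-extend x) (κ-extend y)
      κ-extend (a ⊡ x) = cong (a ⊡_) (κ-extend x)

    κ-chain : ∀ (γ : Path u u) → A/J² ⊢ κ (chain γ) ≈ gen γ ⊞ ⊟ one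
    κ-chain γ = A/J².≈ᴹ-trans (κ-chain-closed γ) (lift (⊞-cong (relation (identify (∙-congˡ γ reverse~const))) ≈-refl))
      where
      reverse~const : reverse (pathTo u) ~ const
      reverse~const = ~-trans (subst (_~ reverse (pathTo u) ∙ pathTo u) (∙-identityʳ (reverse (pathTo u)))
        (∙-congʳ (reverse (pathTo u)) (~-sym pathTo-base))) (reverse-inverseˡ (pathTo u))

  ∂ᴸ : LinearMap ℚE± ℚV
  ∂ᴸ = record
    { ⟦_⟧ = ∂ ; isLinear = mkIsLinear ℚE± ℚV ∂ ∂-cong (λ _ _ → ≈-refl) (λ _ _ → ≈-refl) }

  -- The chosen paths act as a spanning tree rooted at `u`: the chain attached to `w` has boundary
  -- `w` minus `u`.
  tree : LinearMap ℚV ℚE±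
  tree = extendᴸ ℚE± (λ w → chain (pathTo w)) λ { (identify refl) → ≈-refl }

  -- The projection onto the cycles that closes up an edge by the paths to its endpoints.
  close : LinearMap ℚE± ℚE±
  close = LeftModule._+ᴹ_ (Hom ℚE± ℚE±) idᴸ (LeftModule._*ₗ_ (Hom ℚE± ℚE±) (- 1ℚ) (tree ∘ᴸ ∂ᴸ))

  ∂-close : ∀ x → ℚV ⊢ ∂ (⟦ close ⟧ x) ≈ 𝟘
  ∂-close = linear-unique (∂ᴸ ∘ᴸ close) (LeftModule.0ᴹ (Hom ℚE± ℚV)) (λ e → ≈-trans
    (⊞-cong ≈-refl (⊡-cong (- 1ℚ) (⊞-cong (∂-chain (pathTo (t e))) (⊡-cong (- 1ℚ) (∂-chain (pathTo (s e)))))))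
    (linearly ℚV (gen (t e) ∷ gen (s e) ∷ gen u ∷ [])
      ((x ⊞ ⊟ y) ⊞ ⊟ ((x ⊞ ⊟ z) ⊞ ⊟ (y ⊞ ⊟ z))) 𝟘 refl))
    where
    x = gen zero
    y = gen (suc zero)
    z = gen (suc (suc zero))

  close-cycle : ∀ {x} → ℚV ⊢ ∂ x ≈ 𝟘 → ℚE± ⊢ ⟦ close ⟧ x ≈ x
  close-cycle {x} p = ≈-trans (⊞-cong ≈-refl (⊡-cong (- 1ℚ) (LinearMap.⟦⟧-cong tree p)))
    (linearly ℚE± (x ∷ []) (gen zero ⊞ ⊟ 𝟘) (gen zero) refl)

  closeᴴ : LinearMap ℚE± H₁
  closeᴴ = record
    { ⟦_⟧ = λ x → ⟦ close ⟧ x , ∂-close x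
    ; isLinear = mkIsLinear ℚE± H₁ _ (LinearMap.⟦⟧-cong close) (LinearMap.+ᴹ-homo close) (LinearMap.*ₗ-homo close)
    }

  cyclePairing : ∣ H₁ ∣ → ∣ H₁ ∣ → ℚ
  cyclePairing (x , _) (y , _) = ⟨ x , y ⟩

  cyclePairing-isBilinear : IsBilinear H₁ H₁ cyclePairing
  cyclePairing-isBilinear = record
    { ⟨⟩-cong = b.⟨⟩-cong
    ; +-homoˡ = λ (x , _) (x′ , _) (y , _) → b.+-homoˡ x x′ y
    ; +-homoʳ = λ (x , _) (y , _) (y′ , _) → b.+-homoʳ x y y′
    ; *-homoˡ = λ a (x , _) (y , _) → b.*-homoˡ a x y
    ; *-homoʳ = λ a (x , _) (y , _) → b.*-homoʳ a x y
    }
    where module b = IsBilinear ⟨⟩-isBilinear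

  private
    symmetric : ∀ x y → cyclePairing x y ≡ cyclePairing y x
    symmetric (x , _) (y , _) = ⟨⟩-symmetric x y

    definite : ∀ x → cyclePairing x x ≡ 0ℚ → H₁ ⊢ x ≈ LeftModule.0ᴹ H₁
    definite (x , _) = ⟨⟩-definite x

    projectTo : List (∣ H₁ ∣ × ℚ) → LinearMap H₁ H₁
    projectTo = project H₁ cyclePairing cyclePairing-isBilinear symmetric definite

  abstract
    -- The input to Gram-Schmidt is the list of closed-up edges. They generate `H₁` because `close`
    -- fixes every cycle.
    orthogonalCycles : List (∣ H₁ ∣ × ℚ)
    orthogonalCycles = proj₁ (gramSchmidt H₁ cyclePairing cyclePairing-isBilinear symmetric definite
      (tabulate (λ i → ⟦ closeᴴ ⟧ (gen (Inverse.from (Finite.index E-finite) i)))))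

    orthogonalCycles-fixed : ∀ e → H₁ ⊢ ⟦ projectTo orthogonalCycles ⟧ (⟦ closeᴴ ⟧ (gen e)) ≈ ⟦ closeᴴ ⟧ (gen e)
    orthogonalCycles-fixed e = subst (λ e → H₁ ⊢ ⟦ projectTo orthogonalCycles ⟧ (⟦ closeᴴ ⟧ (gen e)) ≈ ⟦ closeᴴ ⟧ (gen e))
      (strictlyInverseʳ e)
      (All.tabulate⁻ (proj₂ (proj₂ (gramSchmidt H₁ cyclePairing cyclePairing-isBilinear symmetric definite
        (tabulate (λ i → ⟦ closeᴴ ⟧ (gen (from i))))))) (to e))
      where open Inverse (Finite.index E-finite)

  I : Set
  I = ∣ H₁ ∣ × ℚ

  cycleFrame : Frame H₁ I
  cycleFrame = record
    { support  = orthogonalCycles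
    ; vector   = proj₁
    ; covector = orthogonalCovector H₁ cyclePairing cyclePairing-isBilinear symmetric definite
    ; expand   = λ (x , p) → ≈-sym (begin
        proj₁ (⟦ proj ⟧ (x , p))                ≈⟨ LinearMap.⟦⟧-cong proj {⟦ closeᴴ ⟧ x} {x , p} (close-cycle {x} p) ⟨
        proj₁ (⟦ proj ⟧ (⟦ closeᴴ ⟧ x))         ≈⟨ linear-unique {N = H₁} (proj ∘ᴸ closeᴴ) closeᴴ orthogonalCycles-fixed x ⟩
        ⟦ close ⟧ x                             ≈⟨ close-cycle p ⟩
        x                                       ∎)
    }
    where
    open SetoidReasoning (LeftModule.≈ᴹ-setoid ℚE±)
    proj = projectTo orthogonalCycles

  open Frame cycleFrame using (support; covector)

  series-κ : ∀ (ω ω′ : ∣ H₁ ∣) → series (κ (proj₁ ω)) (ω′ ∷ []) ≡ ⟨ proj₁ ω , proj₁ ω′ ⟩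
  series-κ (x , p) ω′ = trans (general x) (IsBilinear.⟨⟩-cong ⟨⟩-isBilinear (close-cycle {x} p) (≈-refl {x = proj₁ ω′}))
    where
    pairing = IsBilinear.adjointʳ ⟨⟩-isBilinear (proj₁ ω′) ∘ᴸ close
    ∫₁ : ∀ {w} → Path u w → ℚ
    ∫₁ γ = ∫ᴾ γ (ω′ ∷ [])

    -- An induction on terms leaves the cycles, so the formula is proved for all chains, where `κ x`
    -- pairs as `close x` does; on a cycle the two readings agree.
    general : ∀ x → series (κ x) (ω′ ∷ []) ≡ ⟦ pairing ⟧ x
    general (gen e) = begin
      ∫ᴾ (loop e) (ω′ ∷ []) + - 1ℚ * 0ℚ
        ≡⟨ cong (_+ - 1ℚ * 0ℚ) (∫ᴾ-∙-singleton (reverse (pathTo (t e))) (step e refl refl (pathTo (s e))) ω′) ⟩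
      ∫ᴾ (reverse (pathTo (t e))) (ω′ ∷ []) + ∫₁ (step e refl refl (pathTo (s e))) + - 1ℚ * 0ℚ
        ≡⟨ cong₂ (λ a b → a + b + - 1ℚ * 0ℚ)
             (trans (∫ᴾ-reverse-singleton (pathTo (t e)) ω′) (cong -_ (∫ᴾ-chain (pathTo (t e)) ω′)))
             (∫ᴾ-chain (step e refl refl (pathTo (s e))) ω′) ⟩
      - b + (a + c) + - 1ℚ * 0ℚ
        ≡⟨ solve 3 (λ a b c → :- b :+ (a :+ c) :+ :- con 1ℚ :* con 0ℚ := a :+ :- con 1ℚ :* (b :+ :- con 1ℚ :* c)) refl a b c ⟩
      a + - 1ℚ * (b + - 1ℚ * c) ∎
      where
      open ≡-Reasoning
      a = ∫ᴱ e ω′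
      b = ⟨ chain (pathTo (t e)) , proj₁ ω′ ⟩
      c = ⟨ chain (pathTo (s e)) , proj₁ ω′ ⟩
    general 𝟘       = sym (LinearMap.0ᴹ-homo pairing)
    general (x ⊞ y) = trans (cong₂ _+_ (general x) (general y)) (sym (LinearMap.+ᴹ-homo pairing x y))
    general (a ⊡ x) = trans (cong (a *_) (general x)) (sym (LinearMap.*ₗ-homo pairing a x))

  -- The covector of an orthogonal cycle `b` is itself a multiple of the pairing with `b`, and so is
  -- the linear part of the series of `κ`; the same scalar `c` makes them equal.
  dualLoop : I → ∣ ℚπ₁ u u ∣
  dualLoop (b , c) = c ⊡ κ (proj₁ b)

  dualLoop∈J : ∀ i → J u (dualLoop i)
  dualLoop∈J (b , c) = trans (cong (c *_) (κ∈J (proj₁ b))) (ℚ.*-zeroʳ c)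

  series-dualLoop : ∀ i ω → series (dualLoop i) (ω ∷ []) ≡ ⟦ covector i ⟧ ω
  series-dualLoop (b , c) ω = cong (c *_) (series-κ b ω)

  -- The factors are reversed because series (a · b) = series b ⊛ series a.
  dualWord : ∀ {k} → Vec I k → ∣ ℚπ₁ u u ∣
  dualWord []      = one
  dualWord (i ∷ w) = dualWord w · dualLoop i

  dualWord∈J^ : ∀ {k} (w : Vec I k) → J^ k u (dualWord w)
  dualWord∈J^ []      = _
  dualWord∈J^ (i ∷ w) = incl (product (dualWord w) (dualLoop i) (dualWord∈J^ w) (dualLoop∈J i))

  series-dualWord : ∀ {k} (w : Vec I k) ωs → series (dualWord w) (toList ωs) ≡ evaluate (Vec.map covector w) ωs
  series-dualWord []      []       = refl
  series-dualWord {suc k} (i ∷ w) (ω ∷ ωs) = begin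
    series (dualWord w · dualLoop i) (ω ∷ toList ωs)
      ≡⟨ series-· (dualWord w) (dualLoop i) (ω ∷ toList ωs) ⟩
    (series (dualLoop i) ⊛ series (dualWord w)) (ω ∷ toList ωs)
      ≡⟨ leading-suc {f = series (dualLoop i)} (trans (series-[] (dualLoop i)) (dualLoop∈J i))
           (J^-HasOrder {k} {a = dualWord w} (dualWord∈J^ w)) ω (toList ωs) (length-toList ωs) ⟩
    series (dualLoop i) (ω ∷ []) * series (dualWord w) (toList ωs)
      ≡⟨ cong₂ _*_ (series-dualLoop i ω) (series-dualWord w ωs) ⟩
    ⟦ covector i ⟧ ω * evaluate (Vec.map covector w) ωs ∎
    where open ≡-Reasoning

  -- Leading terms in the group algebra

  cycles : ∀ {k} → Vec I k → List ∣ H₁ ∣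
  cycles w = toList (Vec.map proj₁ w)

  length-cycles : ∀ {k} (w : Vec I k) → length (cycles w) ≡ k
  length-cycles w = length-toList (Vec.map proj₁ w)

  -- An approximation that sees only coefficients of degree k, yet is linear on the whole algebra,
  -- so that its error on `J^ k` can be studied on generators.
  leadingTerm : ∀ k → LinearMap (ℚπ₁ u u) (ℚπ₁ u u)
  leadingTerm k = expansion (ℚπ₁ u u) (words support k) (seriesᴸ ∘ cycles) dualWord

  -- This is `leadingTerm 1` without the factor `one` at the start of every `dualWord`.
  linearTerm : LinearMap (ℚπ₁ u u) (ℚπ₁ u u)
  linearTerm = expansion (ℚπ₁ u u) support (λ i → seriesᴸ (proj₁ i ∷ [])) dualLoop

  remainder : LinearMap (ℚπ₁ u u) (ℚπ₁ u u) → LinearMap (ℚπ₁ u u) (ℚπ₁ u u)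
  remainder f = LeftModule._+ᴹ_ H idᴸ (LeftModule._*ₗ_ H (- 1ℚ) f)
    where H = Hom (ℚπ₁ u u) (ℚπ₁ u u)

  private
    loopClass : Path u u → ∣ H₁ ∣
    loopClass γ = chain γ , ≈-trans (∂-chain γ) (linearly ℚV (gen u ∷ []) (gen zero ⊞ ⊟ gen zero) 𝟘 refl)

    sumOver-A/J² : ∀ f → A/J² ⊢ sumOver (ℚπ₁ u u) support f ≈ sumOver A/J² support f
    sumOver-A/J² = sumOver-linear A/J² (quotientMap (ℚπ₁ u u) (J^-isSubspace 2 u)) support

    -- Expand the homology class of γ in the orthogonal cycles and apply `κ`. By the symmetry of the
    -- pairing the coefficients are integrals along γ.
    linearTerm-gen : ∀ γ → A/J² ⊢ gen γ ⊞ ⊟ one ≈ ⟦ linearTerm ⟧ (gen γ)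
    linearTerm-gen γ = begin
      gen γ ⊞ ⊟ one
        ≈⟨ κ-chain γ ⟨
      κ (chain γ)
        ≈⟨ expand-linear cycleFrame {N = A/J²} (κᴸ ∘ᴸ inclusion) (loopClass γ) ⟩
      sumOver A/J² support (λ i → ⟦ covector i ⟧ (loopClass γ) ⊡ κ (proj₁ (proj₁ i)))
        ≈⟨ sumOver-cong A/J² support (λ i → lift (summand i)) ⟩
      sumOver A/J² support (λ i → ∫ᴾ γ (proj₁ i ∷ []) ⊡ dualLoop i)
        ≈⟨ sumOver-A/J² _ ⟨
      ⟦ linearTerm ⟧ (gen γ) ∎
      where
      open SetoidReasoning A/J².≈ᴹ-setoid
      summand : ∀ i → ℚπ₁ u u ⊢ ⟦ covector i ⟧ (loopClass γ) ⊡ κ (proj₁ (proj₁ i)) ≈ ∫ᴾ γ (proj₁ i ∷ []) ⊡ dualLoop i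
      summand (b , c) = LeftModule.≈ᴹ-trans (ℚπ₁ u u)
        (LeftModule.*ₗ-cong (ℚπ₁ u u) (trans (ℚ.*-comm c _) (cong (_* c)
          (trans (⟨⟩-symmetric (proj₁ b) (chain γ)) (sym (∫ᴾ-chain γ b))))) ≈-refl)
        (⊡-assoc (∫ᴾ γ (b ∷ [])) c (κ (proj₁ b)))

    -- The linear extension of γ = 1 + (γ - 1) from group elements. On J the first summand vanishes.
    decomposition : ∀ x → A/J² ⊢ x ≈ ⟦ leadingTerm 0 ⟧ x ⊞ ⟦ linearTerm ⟧ x
    decomposition = linear-unique q
      (q ∘ᴸ LeftModule._+ᴹ_ (Hom (ℚπ₁ u u) (ℚπ₁ u u)) (leadingTerm 0) linearTerm)
      (λ γ → begin
        gen γ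
          ≈⟨ lift (linearly (ℚπ₁ u u) (gen γ ∷ one ∷ []) x ((1ℚ ⊡ y ⊞ 𝟘) ⊞ (x ⊞ ⊟ y)) refl) ⟩
        (1ℚ ⊡ one ⊞ 𝟘) ⊞ (gen γ ⊞ ⊟ one)
          ≈⟨ A/J².+ᴹ-cong (lift (LeftModule.+ᴹ-cong (ℚπ₁ u u)
               (LeftModule.*ₗ-cong (ℚπ₁ u u) (sym (∫ᴾ-[] γ)) ≈-refl) ≈-refl)) (linearTerm-gen γ) ⟩
        (∫ᴾ γ [] ⊡ one ⊞ 𝟘) ⊞ ⟦ linearTerm ⟧ (gen γ) ∎)
      where
      open SetoidReasoning A/J².≈ᴹ-setoid
      q = quotientMap (ℚπ₁ u u) (J^-isSubspace 2 u)
      x = gen zero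
      y = gen (suc zero)

  linearTerm-remainder : ∀ {a} → J u a → J^ 2 u (⟦ remainder linearTerm ⟧ a)
  linearTerm-remainder {a} a∈J = ≈0⇒∈ (ℚπ₁ u u) (J^-isSubspace 2 u) (begin
    a ⊞ ⊟ l
      ≈⟨ A/J².+ᴹ-cong (decomposition a) A/J².≈ᴹ-refl ⟩
    ((series a [] ⊡ one ⊞ 𝟘) ⊞ l) ⊞ ⊟ l
      ≈⟨ lift (⊞-cong (⊞-cong (⊞-cong (LeftModule.*ₗ-cong (ℚπ₁ u u) (trans (series-[] a) a∈J) ≈-refl) ≈-refl) ≈-refl) ≈-refl) ⟩
    ((0ℚ ⊡ one ⊞ 𝟘) ⊞ l) ⊞ ⊟ l
      ≈⟨ lift (linearly (ℚπ₁ u u) (one ∷ l ∷ []) (((0ℚ ⊡ x ⊞ 𝟘) ⊞ y) ⊞ ⊟ y) 𝟘 refl) ⟩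
    𝟘 ∎)
    where
    open SetoidReasoning A/J².≈ᴹ-setoid
    l = ⟦ linearTerm ⟧ a
    x = gen zero
    y = gen (suc zero)

  leadingTerm∈J^ : ∀ k a → J^ k u (⟦ leadingTerm k ⟧ a)
  leadingTerm∈J^ k a = sumOver∈ (J^-isSubspace k u) (words support k)
    (λ w → IsSubspace.*-closed (J^-isSubspace k u) (series a (cycles w)) (dualWord∈J^ w))

  -- A word of length k + 1 splits into its first letter, read by `d`, and the rest, read by `c`;
  -- `dualWord` is built in the matching order.
  leadingTerm-· : ∀ k c d → J^ k u c → J u d →
    ℚπ₁ u u ⊢ ⟦ leadingTerm (suc k) ⟧ (c · d) ≈ ⟦ leadingTerm k ⟧ c · ⟦ linearTerm ⟧ d
  leadingTerm-· k c d c∈ d∈ = begin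
    ⟦ leadingTerm (suc k) ⟧ (c · d)
      ≈⟨ sumOver-words A support k _ ⟩
    sumOver A support (λ i → sumOver A (words support k) (λ w →
      series (c · d) (proj₁ i ∷ cycles w) ⊡ (dualWord w · dualLoop i)))
      ≈⟨ sumOver-cong A support (λ i → sumOver-cong A (words support k) (λ w →
           LeftModule.≈ᴹ-trans A (LeftModule.*ₗ-cong A (coefficient i w) ≈-refl) (⊡-assoc _ _ _))) ⟩
    sumOver A support (λ i → sumOver A (words support k) (λ w →
      series d (proj₁ i ∷ []) ⊡ (series c (cycles w) ⊡ (dualWord w · dualLoop i))))
      ≈⟨ sumOver-cong A support (λ i → sumOver-* A (words support k) _ _) ⟩
    sumOver A support (λ i → series d (proj₁ i ∷ []) ⊡
      sumOver A (words support k) (λ w → series c (cycles w) ⊡ (dualWord w · dualLoop i)))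
      ≈⟨ sumOver-cong A support (λ i → ⊡-cong (series d (proj₁ i ∷ []))
           (sumOver-combination A (mulʳ (dualLoop i)) (words support k) (series c ∘ cycles) dualWord)) ⟨
    sumOver A support (λ i → series d (proj₁ i ∷ []) ⊡ (⟦ leadingTerm k ⟧ c · dualLoop i))
      ≈⟨ sumOver-combination A (mulˡ (⟦ leadingTerm k ⟧ c)) support (λ i → series d (proj₁ i ∷ [])) dualLoop ⟨
    ⟦ leadingTerm k ⟧ c · ⟦ linearTerm ⟧ d ∎
    where
    A = ℚπ₁ u u
    open SetoidReasoning (LeftModule.≈ᴹ-setoid A)
    coefficient : ∀ i (w : Vec I k) →
      series (c · d) (proj₁ i ∷ cycles w) ≡ series d (proj₁ i ∷ []) * series c (cycles w)
    coefficient i w = trans (series-· c d (proj₁ i ∷ cycles w))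
      (leading-suc {f = series d} (trans (series-[] d) d∈) (J^-HasOrder {k} {a = c} c∈) (proj₁ i) (cycles w) (length-cycles w))

  -- With primes for the approximations, cd - c′d′ = (c - c′)d + c′(d - d′). Here c - c′ lies in
  -- `J^ (suc k)` by induction and d - d′ in `J^ 2`.
  leadingTerm-remainder : ∀ k {a} → J^ k u a → J^ (suc k) u (⟦ remainder (leadingTerm k) ⟧ a)
  leadingTerm-remainder zero    {a} _ = J⊆J^1 {x = ⟦ remainder (leadingTerm 0) ⟧ a} (begin
    augmentation u a + - 1ℚ * (series a [] * 1ℚ + 0ℚ)
      ≡⟨ cong (λ z → augmentation u a + - 1ℚ * (z * 1ℚ + 0ℚ)) (series-[] a) ⟩
    augmentation u a + - 1ℚ * (augmentation u a * 1ℚ + 0ℚ)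
      ≡⟨ solve 1 (λ z → z :+ :- con 1ℚ :* (z :* con 1ℚ :+ con 0ℚ) := con 0ℚ) refl (augmentation u a) ⟩
    0ℚ ∎)
    where open ≡-Reasoning
  leadingTerm-remainder (suc k) p = Span-least
    (preimage-isSubspace (remainder (leadingTerm (suc k))) (J^-isSubspace (suc (suc k)) u))
    (λ { (product c d c∈ d∈) → resp (≈-sym (expand c d c∈ d∈))
      (+-closed (incl (product (⟦ remainder (leadingTerm k) ⟧ c) d (leadingTerm-remainder k c∈) d∈))
                (J^·J²⊆J^ {k} {a = ⟦ leadingTerm k ⟧ c} {b = ⟦ remainder linearTerm ⟧ d} (leadingTerm∈J^ k c) (linearTerm-remainder {d} d∈))) }) p
    where
    A = ℚπ₁ u u
    open SetoidReasoning (LeftModule.≈ᴹ-setoid A)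
    x = gen zero
    y = gen (suc zero)
    z = gen (suc (suc zero))
    expand : ∀ c d → J^ k u c → J u d → A ⊢ ⟦ remainder (leadingTerm (suc k)) ⟧ (c · d) ≈
      ⟦ remainder (leadingTerm k) ⟧ c · d ⊞ ⟦ leadingTerm k ⟧ c · ⟦ remainder linearTerm ⟧ d
    expand c d c∈ d∈ = begin
      c · d ⊞ ⊟ ⟦ leadingTerm (suc k) ⟧ (c · d)
        ≈⟨ ⊞-cong ≈-refl (⊡-cong (- 1ℚ) (leadingTerm-· k c d c∈ d∈)) ⟩
      c · d ⊞ ⊟ (c′ · d′)
        ≈⟨ linearly A (c · d ∷ c′ · d ∷ c′ · d′ ∷ []) (x ⊞ ⊟ z) ((x ⊞ ⊟ y) ⊞ (y ⊞ ⊟ z)) refl ⟩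
      (c · d ⊞ ⊟ (c′ · d)) ⊞ (c′ · d ⊞ ⊟ (c′ · d′))
        ≈⟨ ⊞-cong ≈-refl (⊞-cong ≈-refl (LinearMap.*ₗ-homo (mulˡ c′) (- 1ℚ) d′)) ⟨
      (c · d ⊞ ⊟ (c′ · d)) ⊞ (c′ · d ⊞ c′ · (⊟ d′))
        ≈⟨ ⊞-cong ≈-refl (LinearMap.+ᴹ-homo (mulˡ c′) d (⊟ d′)) ⟨
      (c ⊞ ⊟ c′) · d ⊞ c′ · (d ⊞ ⊟ d′) ∎
      where
      c′ = ⟦ leadingTerm k ⟧ c
      d′ = ⟦ linearTerm ⟧ d

  -- Transport to an arbitrary end point

  module _ (v : V) where
    private
      B = ℚπ₁ u v
      g : ∣ B ∣
      g = gen (pathTo v)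

    transport : ∀ {k} → Vec I k → ∣ ℚπ₁ u v ∣
    transport w = gen (pathTo v) · dualWord w

    transport∈W₋ : ∀ {k} (w : Vec I k) → W₋ k u v (transport w)
    transport∈W₋ w = incl (product (gen (pathTo v)) (dualWord w) _ (dualWord∈J^ w))

    series-transport : ∀ {k} (w : Vec I k) ωs → series (transport w) (toList ωs) ≡ evaluate (Vec.map covector w) ωs
    series-transport {k} w ωs = begin
      series (transport w) (toList ωs)
        ≡⟨ series-· g (dualWord w) (toList ωs) ⟩
      (series (dualWord w) ⊛ series g) (toList ωs)
        ≡⟨ leading-⊛ˡ (series g) (J^-HasOrder {k} {a = dualWord w} (dualWord∈J^ w)) (toList ωs) (length-toList ωs) ⟩
      series (dualWord w) (toList ωs) * ∫ᴾ (pathTo v) []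
        ≡⟨ cong₂ _*_ (series-dualWord w ωs) (∫ᴾ-[] (pathTo v)) ⟩
      evaluate (Vec.map covector w) ωs * 1ℚ
        ≡⟨ ℚ.*-identityʳ _ ⟩
      evaluate (Vec.map covector w) ωs ∎
      where open ≡-Reasoning

    leadingTermᵛ : ∀ k → LinearMap (ℚπ₁ u v) (ℚπ₁ u v)
    leadingTermᵛ k = expansion (ℚπ₁ u v) (words support k) (seriesᴸ ∘ cycles) transport

    -- As `a` has order k already, only the constant term of `x` reaches degree k.
    leadingTermᵛ-· : ∀ k x a → J^ k u a →
      B ⊢ ⟦ leadingTermᵛ k ⟧ (x · a) ≈ series x [] ⊡ (g · ⟦ leadingTerm k ⟧ a)
    leadingTermᵛ-· k x a a∈ = begin
      sumOver B (words support k) (λ w → series (x · a) (cycles w) ⊡ (g · dualWord w))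
        ≈⟨ sumOver-cong B (words support k) (λ w → LeftModule.≈ᴹ-trans B
             (LeftModule.*ₗ-cong B (coefficient w) ≈-refl) (⊡-assoc (series x []) _ _)) ⟩
      sumOver B (words support k) (λ w → series x [] ⊡ (series a (cycles w) ⊡ (g · dualWord w)))
        ≈⟨ sumOver-* B (words support k) (series x []) _ ⟩
      series x [] ⊡ sumOver B (words support k) (λ w → series a (cycles w) ⊡ (g · dualWord w))
        ≈⟨ ⊡-cong (series x []) (sumOver-combination B (mulˡ g) (words support k) (series a ∘ cycles) dualWord) ⟨
      series x [] ⊡ (g · ⟦ leadingTerm k ⟧ a) ∎
      where
      open SetoidReasoning (LeftModule.≈ᴹ-setoid B)
      coefficient : ∀ (w : Vec I k) → series (x · a) (cycles w) ≡ series x [] * series a (cycles w)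
      coefficient w = trans (series-· x a (cycles w))
        (trans (leading-⊛ˡ (series x) (J^-HasOrder {k} {a = a} a∈) (cycles w) (length-cycles w)) (ℚ.*-comm _ (series x [])))

    -- Up to homotopy `g` is invertible, so x = g · j x + c g with `j x` in J and c the constant
    -- term of `x`. In `x · a` the first part gains a factor from J, and the second reduces to
    -- `leadingTerm-remainder` for `a`.
    W₋-remainder : ∀ k {x} → W₋ k u v x → W₋ (suc k) u v (x ⊞ ⊟ ⟦ leadingTermᵛ k ⟧ x)
    W₋-remainder k = Span-least
      (preimage-isSubspace {B} {B} (LeftModule._+ᴹ_ (Hom B B) idᴸ (LeftModule._*ₗ_ (Hom B B) (- 1ℚ) (leadingTermᵛ k)))
        (Span-isSubspace B _))
      λ { (product x a _ a∈) → resp (≈-sym (expand x a a∈))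
        (+-closed (incl (product g (j x · a) _ (J·J^⊆J^ {k} {a = j x} {b = a} (j∈J x) a∈)))
                  (*-closed (series x []) (incl (product g (⟦ remainder (leadingTerm k) ⟧ a) _ (leadingTerm-remainder k a∈))))) }
      where
      open SetoidReasoning (LeftModule.≈ᴹ-setoid B)
      y₀ = gen zero
      y₁ = gen (suc zero)
      y₂ = gen (suc (suc zero))

      ḡ : ∣ ℚπ₁ v u ∣
      ḡ = gen (reverse (pathTo v))

      j : ∣ B ∣ → ∣ ℚπ₁ u u ∣
      j x = ḡ · x ⊞ ⊟ (series x [] ⊡ one)

      j∈J : ∀ x → J u (j x)
      j∈J x = trans (cong₂ (λ a b → a + - 1ℚ * (b * 1ℚ)) aug (refl {x = series x []}))
        (solve 1 (λ a → a :+ :- con 1ℚ :* (a :* con 1ℚ) := con 0ℚ) refl (series x []))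
        where
        aug : augmentation u (ḡ · x) ≡ series x []
        aug = trans (sym (series-[] (ḡ · x))) (trans (series-· ḡ x [])
          (trans (cong (series x [] *_) (∫ᴾ-[] (reverse (pathTo v)))) (ℚ.*-identityʳ _)))

      g·j : ∀ x → B ⊢ g · j x ≈ x ⊞ ⊟ (series x [] ⊡ g)
      g·j x = begin
        g · (ḡ · x ⊞ ⊟ (series x [] ⊡ one))
          ≈⟨ LinearMap.+ᴹ-homo (mulˡ g) (ḡ · x) (⊟ (series x [] ⊡ one)) ⟩
        g · (ḡ · x) ⊞ g · (⊟ (series x [] ⊡ one))
          ≈⟨ ⊞-cong (≈-sym (·-assoc g ḡ x)) (≈-trans (LinearMap.*ₗ-homo (mulˡ g) (- 1ℚ) (series x [] ⊡ one))
               (⊡-cong (- 1ℚ) (LinearMap.*ₗ-homo (mulˡ g) (series x []) one))) ⟩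
        (g · ḡ) · x ⊞ ⊟ (series x [] ⊡ (g · one))
          ≈⟨ ⊞-cong (≈-trans (LinearMap.⟦⟧-cong (mulʳ x) (relation (identify (reverse-inverseʳ (pathTo v))))) (·-identityˡ x))
               (⊡-cong (- 1ℚ) (⊡-cong (series x []) (·-identityʳ g))) ⟩
        x ⊞ ⊟ (series x [] ⊡ g) ∎

      expand : ∀ x a → J^ k u a → B ⊢ x · a ⊞ ⊟ ⟦ leadingTermᵛ k ⟧ (x · a) ≈
        g · (j x · a) ⊞ series x [] ⊡ (g · ⟦ remainder (leadingTerm k) ⟧ a)
      expand x a a∈ = begin
        x · a ⊞ ⊟ ⟦ leadingTermᵛ k ⟧ (x · a)
          ≈⟨ ⊞-cong ≈-refl (⊡-cong (- 1ℚ) (leadingTermᵛ-· k x a a∈)) ⟩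
        x · a ⊞ ⊟ (c ⊡ (g · a′))
          ≈⟨ linearly B (x · a ∷ c ⊡ (g · a) ∷ c ⊡ (g · a′) ∷ [])
               (y₀ ⊞ ⊟ y₂) ((y₀ ⊞ ⊟ y₁) ⊞ (y₁ ⊞ ⊟ y₂)) refl ⟩
        (x ⊞ ⊟ (c ⊡ g)) · a ⊞ (c ⊡ (g · a) ⊞ ⊟ (c ⊡ (g · a′)))
          ≈⟨ ⊞-cong (≈-trans (LinearMap.⟦⟧-cong (mulʳ a) (≈-sym (g·j x))) (·-assoc g (j x) a)) right ⟩
        g · (j x · a) ⊞ c ⊡ (g · (a ⊞ ⊟ a′)) ∎
        where
        c = series x []
        a′ = ⟦ leadingTerm k ⟧ a
        right : B ⊢ c ⊡ (g · a) ⊞ ⊟ (c ⊡ (g · a′)) ≈ c ⊡ (g · (a ⊞ ⊟ a′))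
        right = ≈-trans (⊞-cong ≈-refl (*ₗ-swap B (- 1ℚ) c (g · a′))) (≈-trans (≈-sym (⊡-distribˡ c _ _))
          (⊡-cong c (≈-sym (≈-trans (LinearMap.+ᴹ-homo (mulˡ g) a (⊟ a′)) (⊞-cong ≈-refl (LinearMap.*ₗ-homo (mulˡ g) (- 1ℚ) a′))))))

-- The comparison isomorphisms and the completion

extendByZero : ∀ k (M : ℕ → VectorSpace) → ∣ Π (Fin k) (M ∘ toℕ) ∣ → ∣ Π ℕ M ∣
extendByZero zero    M x m       = LeftModule.0ᴹ (M m)
extendByZero (suc k) M x zero    = x zero
extendByZero (suc k) M x (suc m) = extendByZero k (M ∘ suc) (x ∘ suc) m

extendByZero-toℕ : ∀ k (M : ℕ → VectorSpace) (x : ∣ Π (Fin k) (M ∘ toℕ) ∣) i → extendByZero k M x (toℕ i) ≡ x i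
extendByZero-toℕ (suc k) M x zero    = refl
extendByZero-toℕ (suc k) M x (suc i) = extendByZero-toℕ k (M ∘ suc) (x ∘ suc) i

module Comparison (Γ : MetrisedGraph) (u v : MetrisedGraph.V Γ) where
  open MetrisedGraphTheory Γ
  open PathAlgebra Γ
  open Based Γ u
  open Frame cycleFrame using (support; vector; covector)

  private
    B = ℚπ₁ u v

    B/W : ℕ → VectorSpace
    B/W k = ℚπ₁/W₋ k u v

    cycles⊗ : ∀ {m} → Vec I m → ∣ H₁⊗ m ∣
    cycles⊗ w = gen (Vec.map vector w)

    covectors⊗ : ∀ {m} → Vec I m → ∣ H¹⊗ m ∣
    covectors⊗ w = gen (Vec.map covector w)

  -- The degree m part of the series as a tensor in H¹, rebuilt from its values on words in the
  -- orthogonal cycles.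
  signature : ∀ m → LinearMap (ℚπ₁ u v) (H¹⊗ m)
  signature m = expansion (H¹⊗ m) (words support m) (seriesᴸ ∘ cycles) covectors⊗

  private
    dualityʳ : ∀ m → ∣ H₁⊗ m ∣ → LinearMap (H¹⊗ m) ℚ¹
    dualityʳ m = IsBilinear.adjointʳ (tensorPairing-isBilinear {H₁} m)

    ∫⊗ˡ : ∀ m → ∣ ℚπ₁ u v ∣ → LinearMap (H₁⊗ m) ℚ¹
    ∫⊗ˡ m = IsBilinear.adjointˡ (∫⊗-isBilinear m)

  -- Both sides are Σ ∫⊗ m x (cycles⊗ w) times the coefficient of τ at `w`: expand τ in the tensor
  -- frame. The multilinearity of iterated integrals makes this legitimate.
  duality-signature : ∀ m x τ → duality⊗ m (⟦ signature m ⟧ x) τ ≡ ∫⊗ m x τ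
  duality-signature m x τ = begin
    duality⊗ m (⟦ signature m ⟧ x) τ
      ≡⟨ sumOver-combination ℚ¹ {H¹⊗ m} (dualityʳ m τ) (words support m) (series x ∘ cycles) covectors⊗ ⟩
    sumOver ℚ¹ (words support m) (λ w → series x (cycles w) * duality⊗ m (covectors⊗ w) τ)
      ≡⟨ sumOver-cong ℚ¹ (words support m) (λ w → ℚ.*-comm (series x (cycles w)) (duality⊗ m (covectors⊗ w) τ)) ⟩
    sumOver ℚ¹ (words support m) (λ w → duality⊗ m (covectors⊗ w) τ * ∫⊗ m x (cycles⊗ w))
      ≡⟨ expand-linear {H₁⊗ m} (tensorFrame {H₁} cycleFrame m) {ℚ¹} (∫⊗ˡ m x) τ ⟨
    ∫⊗ m x τ ∎
    where open ≡-Reasoning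

  signature-W₋ : ∀ {k m x} → m < k → W₋ k u v x → H¹⊗ m ⊢ ⟦ signature m ⟧ x ≈ 𝟘
  signature-W₋ {k} {m} {x} m<k x∈ = sumOver-0 (H¹⊗ m) (words support m) (λ w → ≈-trans
    (⊡-congˡ (W₋-HasOrder {k} {x = x} x∈ (cycles w) (subst (_< k) (sym (length-cycles w)) m<k)))
    (⊡-zeroˡ (covectors⊗ w)))

  -- The coefficients of `transport v w` are the values of `covectors⊗ w` on the frame tensors, and
  -- a dual tensor is the frame combination of its own values.
  signature-transport : ∀ {m} (w : Vec I m) → H¹⊗ m ⊢ ⟦ signature m ⟧ (transport v w) ≈ covectors⊗ w
  signature-transport {m} w = ≈-trans
    (sumOver-cong (H¹⊗ m) (words support m)
      {λ w′ → series (transport v w) (cycles w′) ⊡ covectors⊗ w′}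
      {λ w′ → duality⊗ m (covectors⊗ w) (cycles⊗ w′) ⊡ covectors⊗ w′}
      (λ w′ → ⊡-congˡ (series-transport v w (Vec.map vector w′))))
    (≈-sym (tensorPairing-expandˡ {H₁} cycleFrame m (covectors⊗ w)))

  signature-kernel : ∀ k {x} → (∀ m → m < k → H¹⊗ m ⊢ ⟦ signature m ⟧ x ≈ 𝟘) → W₋ k u v x
  signature-kernel zero    {x} _ = resp (·-identityʳ x) (incl (product x one _ _))
  signature-kernel (suc k) {x} vanishes = resp (begin
    x ⊞ ⊟ ⟦ leadingTermᵛ v k ⟧ x   ≈⟨ ⊞-cong ≈-refl (⊡-cong (- 1ℚ) leading≈0) ⟩
    x ⊞ ⊟ 𝟘                        ≈⟨ linearly B (x ∷ []) (gen zero ⊞ ⊟ 𝟘) (gen zero) refl ⟩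
    x                              ∎)
    (W₋-remainder v k {x} (signature-kernel k {x} (λ m m<k → vanishes m (ℕ.m<n⇒m<1+n m<k))))
    where
    open SetoidReasoning (LeftModule.≈ᴹ-setoid B)
    coefficient≡0 : ∀ (w : Vec I k) → series x (cycles w) ≡ 0ℚ
    coefficient≡0 w = trans (sym (duality-signature k x (cycles⊗ w)))
      (LinearMap.⟦⟧-cong (dualityʳ k (cycles⊗ w)) (vanishes k (ℕ.n<1+n k)))
    leading≈0 : B ⊢ ⟦ leadingTermᵛ v k ⟧ x ≈ 𝟘
    leading≈0 = sumOver-0 B (words support k)
      (λ w → ≈-trans (⊡-congˡ (coefficient≡0 w)) (⊡-zeroˡ (transport v w)))

  module _ (h : ∀ m → ∣ H¹⊗ m ∣) where
    -- Degree by degree correction, which is possible since transport w has leading term covectors⊗ w.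
    approximate : ℕ → ∣ ℚπ₁ u v ∣
    private
      defect : ∀ k → ∣ H¹⊗ k ∣
      defect k = h k ⊞ ⊟ ⟦ signature k ⟧ (approximate k)

      correction : ℕ → ∣ ℚπ₁ u v ∣
      correction k = sumOver B (words support k) (λ w → duality⊗ k (defect k) (cycles⊗ w) ⊡ transport v w)

    approximate zero    = 𝟘
    approximate (suc k) = approximate k ⊞ correction k

    private
      correction∈W₋ : ∀ k → W₋ k u v (correction k)
      correction∈W₋ k = sumOver∈ (Span-isSubspace B _) (words support k)
        (λ w → *-closed _ (transport∈W₋ v w))

      signature-correction : ∀ k → H¹⊗ k ⊢ ⟦ signature k ⟧ (correction k) ≈ defect k
      signature-correction k = ≈-trans
        (sumOver-combination (H¹⊗ k) {B} (signature k) (words support k)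
          (λ w → duality⊗ k (defect k) (cycles⊗ w)) (transport v))
        (≈-trans
          (sumOver-cong (H¹⊗ k) (words support k)
            {λ w → duality⊗ k (defect k) (cycles⊗ w) ⊡ ⟦ signature k ⟧ (transport v w)}
            {λ w → duality⊗ k (defect k) (cycles⊗ w) ⊡ covectors⊗ w}
            (λ w → ⊡-cong (duality⊗ k (defect k) (cycles⊗ w)) (signature-transport w)))
          (≈-sym (tensorPairing-expandˡ {H₁} cycleFrame k (defect k))))

      signature-suc : ∀ k m {x y} → H¹⊗ m ⊢ ⟦ signature m ⟧ (approximate k) ≈ x → H¹⊗ m ⊢ ⟦ signature m ⟧ (correction k) ≈ y →
        H¹⊗ m ⊢ ⟦ signature m ⟧ (approximate (suc k)) ≈ x ⊞ y
      signature-suc k m p q = ≈-trans (LinearMap.+ᴹ-homo (signature m) (approximate k) (correction k)) (⊞-cong p q)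

      signature-low : ∀ k m → m < k → H¹⊗ m ⊢ ⟦ signature m ⟧ (correction k) ≈ 𝟘
      signature-low k m m<k = signature-W₋ {k} {m} {correction k} m<k (correction∈W₋ k)

      signature-top : ∀ k → H¹⊗ k ⊢ ⟦ signature k ⟧ (approximate (suc k)) ≈ h k
      signature-top k = ≈-trans (signature-suc k k ≈-refl (signature-correction k))
        (linearly (H¹⊗ k) (⟦ signature k ⟧ (approximate k) ∷ h k ∷ [])
          (gen zero ⊞ (gen (suc zero) ⊞ ⊟ gen zero)) (gen (suc zero)) refl)

    signature-approximate : ∀ k m → m < k → H¹⊗ m ⊢ ⟦ signature m ⟧ (approximate k) ≈ h m
    signature-approximate (suc k) m m<1+k = case (ℕ.m<1+n⇒m<n∨m≡n m<1+k)
      where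
      case : m < k ⊎ m ≡ k → H¹⊗ m ⊢ ⟦ signature m ⟧ (approximate (suc k)) ≈ h m
      case (inj₁ m<k)  = ≈-trans (signature-suc k m (signature-approximate k m m<k) (signature-low k m m<k))
        (linearly (H¹⊗ m) (h m ∷ []) (gen zero ⊞ 𝟘) (gen zero) refl)
      case (inj₂ refl) = signature-top k

  signature-mod-W₋ : ∀ {k m x y} → m < k → B/W k ⊢ x ≈ y → H¹⊗ m ⊢ ⟦ signature m ⟧ x ≈ ⟦ signature m ⟧ y
  signature-mod-W₋ {k} {m} {x} {y} m<k (mod p) = difference≈0 (H¹⊗ m)
    (≈-trans (⊞-cong ≈-refl (≈-sym (LinearMap.*ₗ-homo (signature m) (- 1ℚ) y)))
    (≈-trans (≈-sym (LinearMap.+ᴹ-homo (signature m) x (⊟ y))) (signature-W₋ {k} {m} {x ⊞ ⊟ y} m<k p)))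

  φ : ∀ n → ∣ ℚπ₁/W₋ (suc n) u v ∣ → ∣ ⨁≤ n H¹⊗ ∣
  φ n x m = ⟦ signature (toℕ m) ⟧ x

  φᴸ : ∀ n → LinearMap (ℚπ₁/W₋ (suc n) u v) (⨁≤ n H¹⊗)
  φᴸ n = record
    { ⟦_⟧ = φ n
    ; isLinear = mkIsLinear (ℚπ₁/W₋ (suc n) u v) (⨁≤ n H¹⊗) (φ n)
        (λ p m → signature-mod-W₋ {suc n} {toℕ m} (Fin.toℕ<n m) p)
        (λ x y m → LinearMap.+ᴹ-homo (signature (toℕ m)) x y)
        (λ a x m → LinearMap.*ₗ-homo (signature (toℕ m)) a x)
    }

  φ-injective : ∀ n {x y} → ⨁≤ n H¹⊗ ⊢ φ n x ≈ φ n y → B/W (suc n) ⊢ x ≈ y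
  φ-injective n {x} {y} eq = mod (signature-kernel (suc n) {x ⊞ ⊟ y} (λ m m<1+n →
    subst (λ m → H¹⊗ m ⊢ ⟦ signature m ⟧ (x ⊞ ⊟ y) ≈ 𝟘) (Fin.toℕ-fromℕ< m<1+n) (vanishes (fromℕ< m<1+n))))
    where
    vanishes : ∀ (m : Fin (suc n)) → H¹⊗ (toℕ m) ⊢ ⟦ signature (toℕ m) ⟧ (x ⊞ ⊟ y) ≈ 𝟘
    vanishes m = ≈-trans (LinearMap.+ᴹ-homo (signature (toℕ m)) x (⊟ y))
      (≈-trans (⊞-cong (eq m) (LinearMap.*ₗ-homo (signature (toℕ m)) (- 1ℚ) y))
      (linearly (H¹⊗ (toℕ m)) (⟦ signature (toℕ m) ⟧ y ∷ []) (gen zero ⊞ ⊟ gen zero) 𝟘 refl))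

  φ-isIsomorphism : ∀ n → IsIsomorphism (ℚπ₁/W₋ (suc n) u v) (⨁≤ n H¹⊗) (φ n)
  φ-isIsomorphism n = mkIsIsomorphism (φᴸ n) (φ-injective n) λ h →
    -- Padding by zero makes the construction for full sequences serve the finite levels too;
    -- `suc n` corrections settle the degrees 0 to n.
    approximate (extendByZero (suc n) H¹⊗ h) (suc n) , λ m → LeftModule.≈ᴹ-trans (H¹⊗ (toℕ m))
      (signature-approximate (extendByZero (suc n) H¹⊗ h) (suc n) (toℕ m) (Fin.toℕ<n m))
      (LeftModule.≈ᴹ-reflexive (H¹⊗ (toℕ m)) (extendByZero-toℕ (suc n) H¹⊗ h m))

  duality-φ : ∀ n x w → duality n (φ n x) w ≡ ∫ n x w
  duality-φ n x w = sum-cong-≗ {suc n} (λ m → duality-signature (toℕ m) x (w m))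

  duality-isPerfectPairing : ∀ n → IsPerfectPairing (⨁≤ n H¹⊗) (⨁≤ n H₁⊗) (duality n)
  duality-isPerfectPairing n =
    Π-isPerfectPairing {suc n} {λ m → H¹⊗ (toℕ m)} {λ m → H₁⊗ (toℕ m)} {λ m → duality⊗ (toℕ m)}
      (λ m → tensorPairing-isPerfectPairing {H₁} cycleFrame (toℕ m))

  ∫-isPerfectPairing : ∀ n → IsPerfectPairing (ℚπ₁/W₋ (suc n) u v) (⨁≤ n H₁⊗) (∫ n)
  ∫-isPerfectPairing n = pullback-isPerfectPairing {ℚπ₁/W₋ (suc n) u v} {⨁≤ n H¹⊗} {⨁≤ n H₁⊗}
    (φ-isIsomorphism n) (duality-isPerfectPairing n) (duality-φ n)

  Φ : ∣ completedℚπ₁ u v ∣ → ∣ Π ℕ H¹⊗ ∣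
  Φ (x , _) m = ⟦ signature m ⟧ (x m)

  private
    Ĉ = completedℚπ₁ u v

    signature-compatible : ∀ (x : ∣ Ĉ ∣) m n → m ℕ.≤ n →
      H¹⊗ m ⊢ ⟦ signature m ⟧ (proj₁ x n) ≈ ⟦ signature m ⟧ (proj₁ x m)
    signature-compatible x m n m≤n = go (ℕ.≤⇒≤′ m≤n)
      where
      go : ∀ {n} → m ℕ.≤′ n → H¹⊗ m ⊢ ⟦ signature m ⟧ (proj₁ x n) ≈ ⟦ signature m ⟧ (proj₁ x m)
      go ℕ.≤′-refl             = ≈-refl
      go (ℕ.≤′-step {n} m≤′n) = ≈-trans
        (signature-mod-W₋ {suc n} {m} {proj₁ x (suc n)} {proj₁ x n} (s≤s (ℕ.≤′⇒≤ m≤′n)) (proj₂ x n)) (go m≤′n)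

  Φ-φ : ∀ x n (m : Fin (suc n)) → H¹⊗ (toℕ m) ⊢ Φ x (toℕ m) ≈ φ n (proj₁ x n) m
  Φ-φ x n m = ≈-sym (signature-compatible x (toℕ m) n (ℕ.≤-pred (Fin.toℕ<n m)))

  Φᴸ : LinearMap (completedℚπ₁ u v) (Π ℕ H¹⊗)
  Φᴸ = record
    { ⟦_⟧ = Φ
    ; isLinear = mkIsLinear Ĉ (Π ℕ H¹⊗) Φ
        (λ p m → signature-mod-W₋ {suc m} {m} (ℕ.n<1+n m) (p m))
        (λ (x , _) (y , _) m → LinearMap.+ᴹ-homo (signature m) (x m) (y m))
        (λ a (x , _) m → LinearMap.*ₗ-homo (signature m) a (x m))
    }

  Φ-isIsomorphism : IsIsomorphism (completedℚπ₁ u v) (Π ℕ H¹⊗) Φ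
  Φ-isIsomorphism = mkIsIsomorphism Φᴸ
    (λ {x} {y} eq n → φ-injective n (λ m → ≈-trans (≈-sym (Φ-φ x n m)) (≈-trans (eq (toℕ m)) (Φ-φ y n m))))
    -- Entry n has to be right in degrees up to n, whence `suc n`. Consecutive entries agree in
    -- these degrees, so compatibility follows from the injectivity of `φ n`.
    (λ h → ((λ n → approximate h (suc n)) ,
             λ n → φ-injective n (λ m → ≈-trans
               (signature-approximate h (suc (suc n)) (toℕ m) (ℕ.m<n⇒m<1+n (Fin.toℕ<n m)))
               (≈-sym (signature-approximate h (suc n) (toℕ m) (Fin.toℕ<n m))))) ,
           λ m → signature-approximate h (suc m) m (ℕ.n<1+n m))

theorem4p2 : (Γ : MetrisedGraph) → let open MetrisedGraphTheory Γ in
    (u v : V) →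
    (∀ n → IsPerfectPairing (ℚπ₁/W₋ (suc n) u v) (⨁≤ n H₁⊗) (∫ n)) ×
    (Σ[ φ ∈ (∀ n → ∣ ℚπ₁/W₋ (suc n) u v ∣ → ∣ ⨁≤ n H¹⊗ ∣) ]
    (∀ n → IsIsomorphism (ℚπ₁/W₋ (suc n) u v) (⨁≤ n H¹⊗) (φ n)) ×
    (∀ n x w → duality n (φ n x) w ≡ ∫ n x w) ×
    (Σ[ Φ ∈ (∣ completedℚπ₁ u v ∣ → ∣ Π ℕ H¹⊗ ∣) ]
    IsIsomorphism (completedℚπ₁ u v) (Π ℕ H¹⊗) Φ ×
    (∀ x n (m : Fin (suc n)) →
    LeftModule._≈ᴹ_ (H¹⊗ (toℕ m)) (Φ x (toℕ m)) (φ n (proj₁ x n) m))))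
theorem4p2 Γ u v = ∫-isPerfectPairing , φ , φ-isIsomorphism , duality-φ , Φ , Φ-isIsomorphism , Φ-φ
  where open Comparison Γ u v
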